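{- Let $n\ge 2$ and $m\ge 2$ be integers. The number of regular tame friezes of width $m$ over the ring $\mathbb{Z}/n\mathbb{Z}$ is \[ \prod_{p\mid n}\Phi_m\bigl(p^{\nu_p(n)}\bigr), \] the product running over the prime divisors $p$ of $n$, where for a prime $p$ and integer $r\ge1$: if $m=2k+1$ then $\Phi_m(p^r)=p^{(r-1)(m-3)}[k]_{p^2}$; and if $m=2k$ then \[ \Phi_m(p^r)= \begin{cases} p^{(r-1)(m-3)}(p-1)\binom{k}{2}_{p} & \text{if $k$ is even and $p\ne 2$},\\[2pt] p^{(r-1)(m-3)}\Bigl((p-1)\binom{k}{2}_{p}+p^{k-1}-1\Bigr) & \text{if $k$ is even, $p=2$ and $r\ne1$},\\[2pt] p^{(r-1)(m-3)}\Bigl((p-1)\Bigl(\binom{k}{2}_{p}+[r-1]_{p^{2-k}}\Bigr)+p^{k-1}\Bigr) & \text{otherwise}. \end{cases} \]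
   Context: For a prime $p$, $\nu_p(n)$ is the exponent of $p$ in the prime factorisation of $n$. For a nonzero rational $q$ and integer $j\ge0$, $[j]_q=1+q+\dots+q^{j-1}$ (so $[j]_q=(q^j-1)/(q-1)$ for $q\ne1$ and $[j]_1=j$), and $\binom{k}{2}_{q}=\frac{(q^k-1)(q^{k-1}-1)}{(q-1)(q^2-1)}$ for an integer $q>1$. Let $R=\mathbb{Z}/n\mathbb{Z}$. A frieze of width $m$ over $R$ is a family of entries $E(u,v)\in R$ indexed by all pairs of integers $(u,v)$ with $0\le v-u\le m$ (an array of $m+1$ bi-infinite rows, entry $E(u,v)$ in row $v-u$), such that $E(u,u)=E(u,u+m)=0$ for all $u$, and for all integers $u,v$ with $1\le v-u\le m-1$, $E(u,v)E(u+1,v+1)-E(u+1,v)E(u,v+1)=1$ in $R$. It is tame if for all integers $u,v$ with $2\le v-u\le m-2$, $\det\bigl(E(u+i,v+j)\bigr)_{i,j=0,1,2}=0$ in $R$. It is regular if the second and second-last rows consist entirely of $1$'s, i.e. $E(u,u+1)=E(u,u+m-1)=1$ for all $u$. Friezes are counted as families of entries. -}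

module Defs where

open import Level using (0ℓ)
open import Data.Bool using (Bool; true; false; if_then_else_)
open import Data.Nat as ℕ using (ℕ; zero; suc; NonZero)
import Data.Nat.Properties as ℕP
open import Data.Nat.Divisibility as ℕD using ()
open import Data.Nat.Primality using (Prime; prime?)
open import Data.Integer as ℤ using (ℤ; +_; -[1+_])
import Data.Integer.Properties as ℤP
open import Data.Integer.Divisibility.Signed using (_∣_; ∣-refl; ∣m⇒∣-m; ∣m∣n⇒∣m+n)
open import Data.Rational as ℚ using (ℚ; 0ℚ; 1ℚ)
import Data.Rational.Properties as ℚP
open import Data.List using (List; []; _∷_; foldr; filter; upTo; map)
open import Data.Product using (Σ; _×_; _,_)
open import Relation.Nullary using (Dec; yes; no; does; ¬_)
open import Relation.Nullary.Decidable using (_×-dec_)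
open import Relation.Binary using (Setoid; IsEquivalence)
open import Relation.Binary.PropositionalEquality using (_≡_; refl; sym; trans; cong; subst)

-- Arithmetic in R = ℤ/nℤ, modelled by ℤ up to congruence modulo n.

_≡_[mod_] : ℤ → ℤ → ℕ → Set
a ≡ b [mod n ] = (+ n) ∣ (a ℤ.- b)

infix 4 _≡_[mod_]

≡mod-refl : ∀ {n} a → a ≡ a [mod n ]
≡mod-refl {n} a = subst ((+ n) ∣_) (sym (ℤP.+-inverseʳ a)) ∣-refl′
  where
  ∣-refl′ : (+ n) ∣ (+ 0)
  ∣-refl′ = Data.Integer.Divisibility.Signed.divides (+ 0) (sym (ℤP.*-zeroˡ (+ n)))
    where import Data.Integer.Divisibility.Signed

≡mod-sym : ∀ {n} a b → a ≡ b [mod n ] → b ≡ a [mod n ]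
≡mod-sym {n} a b p = subst ((+ n) ∣_) eq (∣m⇒∣-m p)
  where
  eq : ℤ.- (a ℤ.- b) ≡ b ℤ.- a
  eq = trans (ℤP.neg-distrib-+ a (ℤ.- b))
        (trans (cong (λ x → ℤ._+_ (ℤ.- a) x) (ℤP.neg-involutive b)) (ℤP.+-comm (ℤ.- a) b))

≡mod-trans : ∀ {n} a b c → a ≡ b [mod n ] → b ≡ c [mod n ] → a ≡ c [mod n ]
≡mod-trans {n} a b c p q = subst ((+ n) ∣_) (ℤP.+-minus-telescope a b c) (∣m∣n⇒∣m+n p q)

-- Friezes.  A family of entries E(u,v) for 0 ≤ v-u ≤ m is modelled as a
-- function E : ℤ → ℤ → ℤ; only the values on the strip 0 ≤ v-u ≤ m matter
-- (the setoid equality below only compares those), and values are taken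
-- modulo n.

Entries : Set
Entries = ℤ → ℤ → ℤ

det3 : Entries → ℤ → ℤ → ℤ
det3 E u v =
    (a 0 0 ℤ.* (a 1 1 ℤ.* a 2 2 ℤ.- a 1 2 ℤ.* a 2 1))
  ℤ.- (a 0 1 ℤ.* (a 1 0 ℤ.* a 2 2 ℤ.- a 1 2 ℤ.* a 2 0))
  ℤ.+ (a 0 2 ℤ.* (a 1 0 ℤ.* a 2 1 ℤ.- a 1 1 ℤ.* a 2 0))
  where
  a : ℕ → ℕ → ℤ
  a i j = E (u ℤ.+ + i) (v ℤ.+ + j)

record IsFrieze (n m : ℕ) (E : Entries) : Set where
  field
    bottom : ∀ u → E u u ≡ + 0 [mod n ]
    top    : ∀ u → E u (u ℤ.+ + m) ≡ + 0 [mod n ]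
    unimod : ∀ u v → + 1 ℤ.≤ v ℤ.- u → v ℤ.- u ℤ.≤ + m ℤ.- + 1 →
             E u v ℤ.* E (u ℤ.+ + 1) (v ℤ.+ + 1)
               ℤ.- E (u ℤ.+ + 1) v ℤ.* E u (v ℤ.+ + 1) ≡ + 1 [mod n ]

IsTame : (n m : ℕ) → Entries → Set
IsTame n m E = ∀ u v → + 2 ℤ.≤ v ℤ.- u → v ℤ.- u ℤ.≤ + m ℤ.- + 2 →
               det3 E u v ≡ + 0 [mod n ]

IsRegular : (n m : ℕ) → Entries → Set
IsRegular n m E = (∀ u → E u (u ℤ.+ + 1) ≡ + 1 [mod n ])
                × (∀ u → E u (u ℤ.+ (+ m ℤ.- + 1)) ≡ + 1 [mod n ])

RegularTameFrieze : ℕ → ℕ → Set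
RegularTameFrieze n m =
  Σ Entries λ E → IsFrieze n m E × IsTame n m E × IsRegular n m E

_≈F_ : ∀ {n m} → RegularTameFrieze n m → RegularTameFrieze n m → Set
_≈F_ {n} {m} (E , _) (G , _) =
  ∀ u v → + 0 ℤ.≤ v ℤ.- u → v ℤ.- u ℤ.≤ + m → E u v ≡ G u v [mod n ]

RTFriezeSetoid : ℕ → ℕ → Setoid 0ℓ 0ℓ
RTFriezeSetoid n m = record
  { Carrier = RegularTameFrieze n m
  ; _≈_ = _≈F_
  ; isEquivalence = record
    { refl  = λ {x} u v _ _ → ≡mod-refl (Data.Product.proj₁ x u v)
    ; sym   = λ {x} {y} p u v h₁ h₂ →
                ≡mod-sym (Data.Product.proj₁ x u v) (Data.Product.proj₁ y u v) (p u v h₁ h₂)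
    ; trans = λ {x} {y} {z} p q u v h₁ h₂ →
                ≡mod-trans (Data.Product.proj₁ x u v) (Data.Product.proj₁ y u v)
                           (Data.Product.proj₁ z u v) (p u v h₁ h₂) (q u v h₁ h₂)
    }
  }
  where import Data.Product

-- ν_p(n): the largest e ≤ n with p^e ∣ n (for n ≥ 1 and p ≥ 2 this is the
-- exponent of p in n, since then p^e ∣ n forces e ≤ n).
ν : ℕ → ℕ → ℕ
ν p n = go n
  where
  go : ℕ → ℕ
  go zero = zero
  go (suc e) with ℕD._∣?_ (p ℕ.^ suc e) n
  ... | yes _ = suc e
  ... | no _  = go e

primeDivisors : ℕ → List ℕ
primeDivisors n = filter (λ p → prime? p ×-dec ℕD._∣?_ p n) (upTo (suc n))

_^ℚ_ : ℚ → ℕ → ℚ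
q ^ℚ zero  = 1ℚ
q ^ℚ suc e = q ℚ.* (q ^ℚ e)

powℤ : (p : ℕ) → .{{NonZero p}} → ℤ → ℚ
powℤ p (+ e)      = (+ (p ℕ.^ e)) ℚ./ 1
powℤ p -[1+ e ]   = ℚ._/_ (+ 1) (p ℕ.^ suc e) {{ℕP.m^n≢0 p (suc e)}}

-- division in ℚ; the junk value 0 for a zero divisor is never used below
_÷ℚ_ : ℚ → ℚ → ℚ
x ÷ℚ y with y ℚP.≟ 0ℚ
... | yes _  = 0ℚ
... | no y≢0 = ℚ._÷_ x y {{ℚ.≢-nonZero y≢0}}

qint : ℕ → ℚ → ℚ
qint zero    q = 0ℚ
qint (suc j) q = qint j q ℚ.+ (q ^ℚ j)

qbinom2 : ℕ → ℚ → ℚ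
qbinom2 k q =
  ((q ^ℚ k ℚ.- 1ℚ) ℚ.* (q ^ℚ (k ℕ.∸ 1) ℚ.- 1ℚ))
    ÷ℚ ((q ℚ.- 1ℚ) ℚ.* (q ^ℚ 2 ℚ.- 1ℚ))

fromℕ : ℕ → ℚ
fromℕ a = (+ a) ℚ./ 1

isEven : ℕ → Bool
isEven a = does (a ℕ.% 2 ℕP.≟ 0)

Φ : (m p r : ℕ) → .{{NonZero p}} → ℚ
Φ m p r =
  if isEven m
  then (if isEven k
        then (if does (p ℕP.≟ 2)
              then (if does (r ℕP.≟ 1)
                    then otherwise
                    else pre ℚ.* ((pℚ ℚ.- 1ℚ) ℚ.* qbinom2 k pℚ
                                  ℚ.+ (pℚ ^ℚ (k ℕ.∸ 1) ℚ.- 1ℚ)))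
              else pre ℚ.* ((pℚ ℚ.- 1ℚ) ℚ.* qbinom2 k pℚ))
        else otherwise)
  else pre ℚ.* qint k (pℚ ^ℚ 2)
  where
  k : ℕ
  k = m ℕ./ 2
  pℚ : ℚ
  pℚ = fromℕ p
  -- p^((r-1)(m-3)), the exponent being an integer (possibly negative)
  pre : ℚ
  pre = powℤ p ((+ r ℤ.- + 1) ℤ.* (+ m ℤ.- + 3))
  p2k : ℚ
  p2k = powℤ p (+ 2 ℤ.- + k)
  otherwise : ℚ
  otherwise = pre ℚ.* ((pℚ ℚ.- 1ℚ) ℚ.* (qbinom2 k pℚ ℚ.+ qint (r ℕ.∸ 1) p2k)
                        ℚ.+ pℚ ^ℚ (k ℕ.∸ 1))

friezeCount : ℕ → ℕ → ℚ
friezeCount n m = foldr ℚ._*_ 1ℚ (map factor (primeDivisors n))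
  where
  factor : ℕ → ℚ
  factor zero    = 1ℚ   -- never occurs: 0 is not prime
  factor (suc p) = Φ m (suc p) (ν (suc p) n)

{-# OPTIONS --safe #-}
-- A regular tame frieze of width m is determined by the quiddities b_i = E(i , i + 2) for
-- 0 ≤ i < m - 2, and these can be any residues whose continuant K(b_0 , … , b_{m-3}) is 1; the
-- frieze is E(u , v) = det(v_u , v_v) for the m-antiperiodic solution v of v_{i+2} = b_i v_{i+1} - v_i.
-- So one counts the solutions of K(b) = 1 over ℤ/n.  The count is multiplicative by the
-- Chinese remainder theorem.  For n = q = p^{s+1} run the recurrence z ↦ b z - (previous value):
-- the number h_l(y) of ways to reach 1 in l steps from a unit y does not depend on the previous
-- value, and splitting the next value z into p ∤ z and p ∣ z gives
--   h_{l+2}(y) = Σ_{units z} h_{l+1}(z) + Σ_{a < q/p} Σ_{b < q} h_l(p a b - y).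
-- Summing over units gives a linear recurrence.  For odd l the functions h_l are constant; for
-- even l = 2j the only other contribution is the number of solutions of a hyperbolic equation
-- Σᵢ aᵢ bᵢ = w modulo p^s, where w = 0 for j even and 2 = p w for j odd.
module Submission where

open import Defs
open import Data.Nat as ℕ using (ℕ; zero; suc; NonZero; _≤_; _<_; z≤n; s≤s; _+_; _*_; _^_; _∸_)
import Data.Nat.Properties as ℕP
import Data.Nat.Divisibility as ℕD
open import Data.Nat.Coprimality as Coprimality using (Coprime)
open import Data.Nat.GCD using (module Bézout)
open import Data.Integer as ℤ using (ℤ; +_; -[1+_]; ∣_∣)
import Data.Integer.Properties as ℤP
import Data.Integer.DivMod as ℤDM
open import Data.Integer.Divisibility.Signed using (_∣_; divides; _∣?_; ∣-trans; ∣m∣n⇒∣m+n; ∣m∣n⇒∣m-n; ∣m⇒∣-m; ∣n⇒∣m*n; ∣ᵤ⇒∣; ∣⇒∣ᵤ; *-monoʳ-∣; *-cancelˡ-∣)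
open import Data.Integer.Tactic.RingSolver using (solve-∀)
open import Data.Fin as Fin using (Fin; toℕ; fromℕ<)
import Data.Fin.Properties as FinP
open import Data.Fin.Permutation using (Permutation; permutation)
open import Algebra.Properties.Semiring.Sum ℕP.+-*-semiring using (sum; sum-cong-≗; ∑-distrib-+; ∑-comm; sum-permute; *-distribˡ-sum; *-distribʳ-sum)
open import Data.Bool using (true; false; if_then_else_)
open import Data.Product using (Σ; ∃; _×_; _,_; proj₁; proj₂)
open import Data.Sum using (_⊎_; inj₁; inj₂)
open import Function using (_∘_)
open import Relation.Nullary using (¬_; Dec; yes; no; does; contradiction)
open import Relation.Nullary.Decidable using (dec-true; dec-false; _×-dec_)
open import Relation.Binary using (Setoid)
import Relation.Binary.Reasoning.Setoid as SetoidReasoning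
open import Relation.Binary.PropositionalEquality using (_≡_; _≢_; refl; sym; trans; cong; cong₂; subst; subst₂; setoid; module ≡-Reasoning)
open import Function.Bundles using (Inverse; _↔_; mk↔ₛ′)
open import Function.Properties.Inverse using (↔-refl; ↔-sym; ↔-trans)
open import Data.Sum.Function.Propositional using (_⊎-↔_)
open import Data.Product.Function.Dependent.Propositional using (congˡ)
open import Data.Nat.Primality using (Prime; prime⇒irreducible; prime⇒nonZero; prime⇒nonTrivial; euclidsLemma; prime?; prime[2])
import Data.Nat.Tactic.RingSolver as ℕRing
open import Data.Rational as ℚ using (ℚ; 0ℚ; 1ℚ)
import Data.Rational.Properties as ℚP
open import Data.Rational.Unnormalised.Base as ℚᵘ using (mkℚᵘ; *≡*)
import Data.Rational.Unnormalised.Properties as ℚᵘP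
open import Data.Rational.Solver using (module +-*-Solver)
import Data.Nat.DivMod as DivMod
open import Data.Nat.Primality.Factorisation using (factorise)
open import Data.Nat.ListAction using (product)
open import Data.List using (List; []; _∷_; foldr; map; upTo)
import Data.List.Relation.Unary.All as All
open import Data.List.Relation.Unary.Any using (here; there)
import Data.List.Relation.Unary.AllPairs as AllPairs
open import Data.List.Relation.Unary.Unique.Propositional using (Unique)
open import Data.List.Relation.Unary.Unique.Propositional.Properties using (filter⁺; upTo⁺)
open import Data.List.Membership.Propositional using (_∈_)
open import Data.List.Membership.Propositional.Properties using (∈-filter⁺; ∈-filter⁻; ∈-upTo⁺)
import Algebra.Properties.AbelianGroup ℤP.+-0-abelianGroup as ℤGroup

-- For a unit y the map b ↦ b y - x permutes the residues; this removes x. After a multiple p a of p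
-- comes p a b - y, again a unit, so the count closes up on units and never has to be known at a
-- multiple of p. The three branches of Φ for m = 2k reflect the start value 1. Modulo p, two steps
-- through a multiple of p are y ↦ -y, so j = k - 1 such pairs join 1 to 1 only if (-1)^j ≡ 1 modulo
-- p. For j even, 1 = p 0 + 1 and w = 0 produces the sum [r-1]. For j odd one needs 1 = p w - 1,
-- which is impossible for p odd and gives w = 1 for p = 2. This w is prime to p, unless the modulus
-- p^(r-1) is 1, where w = 1 equals w = 0; this is why r = 1 falls back to the last branch. For m =
-- 2 the exponent (r-1)(m-3) can be negative, so the even closed forms are proved after
-- multiplication by p^s, s = r - 1. On the frieze side everything reduces to determinants of
-- neighbouring vectors being 1: the diamond rule is then a Plücker relation, tameness a rank bound,
-- and the equation K(b) = 1 enters only where one antiperiod meets the next.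

-- Congruences

infix 4 _≋_⟨mod_⟩

-- The congruence of Defs as a record: _≡_[mod_] unfolds to a divisibility
-- from which unification cannot recover the two sides.
record _≋_⟨mod_⟩ (a b : ℤ) (n : ℕ) : Set where
  constructor cong-mod
  field divisible : a ≡ b [mod n ]
open _≋_⟨mod_⟩ public

modulo-by : ∀ {n a b} d → + n ∣ d → d ≡ a ℤ.- b → a ≋ b ⟨mod n ⟩
modulo-by d h refl = cong-mod h

mod-refl : ∀ {n a} → a ≋ a ⟨mod n ⟩
mod-refl {n} {a} = cong-mod (≡mod-refl {n} a)

≡⇒mod : ∀ {n a b} → a ≡ b → a ≋ b ⟨mod n ⟩
≡⇒mod refl = mod-refl

mod-sym : ∀ {n a b} → a ≋ b ⟨mod n ⟩ → b ≋ a ⟨mod n ⟩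
mod-sym {n} {a} {b} (cong-mod h) = cong-mod (≡mod-sym {n} a b h)

mod-trans : ∀ {n a b c} → a ≋ b ⟨mod n ⟩ → b ≋ c ⟨mod n ⟩ → a ≋ c ⟨mod n ⟩
mod-trans {n} {a} {b} {c} (cong-mod h) (cong-mod k) = cong-mod (≡mod-trans {n} a b c h k)

modSetoid : ℕ → Setoid _ _
modSetoid n = record
  { Carrier = ℤ ; _≈_ = λ a b → a ≋ b ⟨mod n ⟩
  ; isEquivalence = record { refl = mod-refl ; sym = mod-sym ; trans = mod-trans } }

module ≋-Reasoning (n : ℕ) = SetoidReasoning (modSetoid n)

+-mod : ∀ {n a b c d} → a ≋ b ⟨mod n ⟩ → c ≋ d ⟨mod n ⟩ → a ℤ.+ c ≋ b ℤ.+ d ⟨mod n ⟩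
+-mod {n} {a} {b} {c} {d} (cong-mod h) (cong-mod k) = modulo-by _ (∣m∣n⇒∣m+n h k) (eq a b c d)
  where
  eq : ∀ a b c d → (a ℤ.- b) ℤ.+ (c ℤ.- d) ≡ (a ℤ.+ c) ℤ.- (b ℤ.+ d)
  eq = solve-∀

neg-mod : ∀ {n a b} → a ≋ b ⟨mod n ⟩ → ℤ.- a ≋ ℤ.- b ⟨mod n ⟩
neg-mod {n} {a} {b} (cong-mod h) = modulo-by _ (∣m⇒∣-m h) (eq a b)
  where
  eq : ∀ a b → ℤ.- (a ℤ.- b) ≡ (ℤ.- a) ℤ.- (ℤ.- b)
  eq = solve-∀

-‿mod : ∀ {n a b c d} → a ≋ b ⟨mod n ⟩ → c ≋ d ⟨mod n ⟩ → a ℤ.- c ≋ b ℤ.- d ⟨mod n ⟩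
-‿mod h k = +-mod h (neg-mod k)

*-mod : ∀ {n a b c d} → a ≋ b ⟨mod n ⟩ → c ≋ d ⟨mod n ⟩ → a ℤ.* c ≋ b ℤ.* d ⟨mod n ⟩
*-mod {n} {a} {b} {c} {d} (cong-mod h) (cong-mod k) =
  modulo-by _ (∣m∣n⇒∣m+n (∣n⇒∣m*n c h) (∣n⇒∣m*n b k)) (eq a b c d)
  where
  eq : ∀ a b c d → c ℤ.* (a ℤ.- b) ℤ.+ b ℤ.* (c ℤ.- d) ≡ a ℤ.* c ℤ.- b ℤ.* d
  eq = solve-∀

+-modˡ : ∀ {n a b} c → a ≋ b ⟨mod n ⟩ → a ℤ.+ c ≋ b ℤ.+ c ⟨mod n ⟩
+-modˡ c h = +-mod h (mod-refl {a = c})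

*-modˡ : ∀ {n a b} c → a ≋ b ⟨mod n ⟩ → a ℤ.* c ≋ b ℤ.* c ⟨mod n ⟩
*-modˡ c h = *-mod h (mod-refl {a = c})

*-modʳ : ∀ {n a b} c → a ≋ b ⟨mod n ⟩ → c ℤ.* a ≋ c ℤ.* b ⟨mod n ⟩
*-modʳ c h = *-mod (mod-refl {a = c}) h

∣⇒mod0 : ∀ {n a} → + n ∣ a → a ≋ + 0 ⟨mod n ⟩
∣⇒mod0 {n} {a} h = modulo-by _ h (sym (ℤP.+-identityʳ a))

∣-mod : ∀ {n a b} → a ≋ b ⟨mod n ⟩ → + n ∣ b → + n ∣ a
∣-mod {n} {a} h d = subst (+ n ∣_) (ℤP.+-identityʳ a) (divisible (mod-trans h (∣⇒mod0 d)))

n∣n*k : ∀ n k → + n ∣ + n ℤ.* k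
n∣n*k n k = divides k (ℤP.*-comm (+ n) k)

+n*≋ : ∀ n a k → a ℤ.+ + n ℤ.* k ≋ a ⟨mod n ⟩
+n*≋ n a k = modulo-by _ (n∣n*k n k) (eq a (+ n ℤ.* k))
  where
  eq : ∀ a c → c ≡ (a ℤ.+ c) ℤ.- a
  eq = solve-∀

abstract
  residue : ∀ n .{{_ : NonZero n}} → ℤ → Fin n
  residue n a = fromℕ< (ℤDM.n%ℕd<d a n)

  residue-≋ : ∀ n .{{_ : NonZero n}} a → + toℕ (residue n a) ≋ a ⟨mod n ⟩
  residue-≋ n a = subst₂ (λ r b → + r ≋ b ⟨mod n ⟩) (sym (FinP.toℕ-fromℕ< (ℤDM.n%ℕd<d a n)))
      (sym (trans (ℤDM.a≡a%ℕn+[a/ℕn]*n a n) (cong (ℤ._+_ (+ (a ℤDM.%ℕ n))) (ℤP.*-comm (a ℤDM./ℕ n) (+ n)))))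
      (mod-sym (+n*≋ n (+ (a ℤDM.%ℕ n)) (a ℤDM./ℕ n)))

∣∧<⇒≡0 : ∀ {n a} → n ℕD.∣ a → a < n → a ≡ 0
∣∧<⇒≡0 {n} {zero}  d l = refl
∣∧<⇒≡0 {n} {suc a} d l = contradiction (ℕD.∣⇒≤ d) (ℕP.<⇒≱ l)

mod-<⇒≡ : ∀ {n a b} → a < n → b < n → + a ≋ + b ⟨mod n ⟩ → a ≡ b
mod-<⇒≡ {n} {a} {b} a<n b<n (cong-mod h) = ℤP.+-injective (ℤP.i-j≡0⇒i≡j (+ a) (+ b)
    (ℤP.∣i∣≡0⇒i≡0 (∣∧<⇒≡0 (∣⇒∣ᵤ h) bound)))
  where
  bound : ∣ + a ℤ.- + b ∣ < n
  bound = ℕP.≤-<-trans (subst (ℕ._≤ a ℕ.⊔ b) (cong ∣_∣ (sym (ℤP.m-n≡m⊖n a b))) (ℤP.∣m⊝n∣≤m⊔n a b))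
                       (ℕP.⊔-lub a<n b<n)

toℕ-mod-injective : ∀ {n} {i j : Fin n} → + toℕ i ≋ + toℕ j ⟨mod n ⟩ → i ≡ j
toℕ-mod-injective {i = i} {j} h = FinP.toℕ-injective (mod-<⇒≡ (FinP.toℕ<n i) (FinP.toℕ<n j) h)

-- Sums of periodic functions over the residues modulo n

Periodic : ℕ → (ℤ → ℕ) → Set
Periodic n f = ∀ {a b} → a ≋ b ⟨mod n ⟩ → f a ≡ f b

Σ[_] : ℕ → (ℤ → ℕ) → ℕ
Σ[ n ] f = sum {n} (λ i → f (+ toℕ i))

Σ-cong : ∀ n {f g : ℤ → ℕ} → (∀ a → f a ≡ g a) → Σ[ n ] f ≡ Σ[ n ] g
Σ-cong n h = sum-cong-≗ {n} (λ i → h (+ toℕ i))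

Σ-+ : ∀ n (f g : ℤ → ℕ) → Σ[ n ] (λ a → f a + g a) ≡ Σ[ n ] f + Σ[ n ] g
Σ-+ n f g = ∑-distrib-+ {n} (λ i → f (+ toℕ i)) (λ i → g (+ toℕ i))

Σ-*ˡ : ∀ n c (f : ℤ → ℕ) → Σ[ n ] (λ a → c * f a) ≡ c * Σ[ n ] f
Σ-*ˡ n c f = sym (*-distribˡ-sum {n} c (λ i → f (+ toℕ i)))

Σ-*ʳ : ∀ n c (f : ℤ → ℕ) → Σ[ n ] (λ a → f a * c) ≡ Σ[ n ] f * c
Σ-*ʳ n c f = sym (*-distribʳ-sum {n} c (λ i → f (+ toℕ i)))

Σ-comm : ∀ m n (f : ℤ → ℤ → ℕ) → Σ[ m ] (λ a → Σ[ n ] (f a)) ≡ Σ[ n ] (λ b → Σ[ m ] (λ a → f a b))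
Σ-comm m n f = ∑-comm {m} {n} (λ i j → f (+ toℕ i) (+ toℕ j))

sum-const : ∀ n c → sum {n} (λ _ → c) ≡ n * c
sum-const zero    c = refl
sum-const (suc n) c = cong (ℕ._+_ c) (sum-const n c)

Σ-const : ∀ n c → Σ[ n ] (λ _ → c) ≡ n * c
Σ-const = sum-const

Σ-append : ∀ m n (f : ℤ → ℕ) → Σ[ m + n ] f ≡ Σ[ m ] f + Σ[ n ] (λ a → f (+ m ℤ.+ a))
Σ-append zero    n f = Σ-cong n (λ a → cong f (sym (ℤP.+-identityˡ a)))
Σ-append (suc m) n f = begin
  f (+ 0) + Σ[ m + n ] (λ a → f (+ 1 ℤ.+ a))
    ≡⟨ cong (ℕ._+_ (f (+ 0))) (Σ-append m n (λ a → f (+ 1 ℤ.+ a))) ⟩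
  f (+ 0) + (Σ[ m ] (λ a → f (+ 1 ℤ.+ a)) + Σ[ n ] (λ a → f (+ 1 ℤ.+ (+ m ℤ.+ a))))
    ≡⟨ ℕP.+-assoc (f (+ 0)) _ _ ⟨
  Σ[ suc m ] f + Σ[ n ] (λ a → f (+ 1 ℤ.+ (+ m ℤ.+ a)))
    ≡⟨ cong (ℕ._+_ (Σ[ suc m ] f)) (Σ-cong n (λ a → cong f (sym (ℤP.+-assoc (+ 1) (+ m) a)))) ⟩
  Σ[ suc m ] f + Σ[ n ] (λ a → f (+ suc m ℤ.+ a)) ∎
  where open ≡-Reasoning

-- Each number below p q is i + p j for exactly one i < p and j < q. Cutting the range into q
-- consecutive blocks puts j outside; the two sums are then exchanged. Splitting by divisibility,
-- periodicity and the Chinese remainder theorem all start from this.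
Σ-blocks : ∀ p q (f : ℤ → ℕ) → Σ[ p * q ] f ≡ Σ[ p ] (λ i → Σ[ q ] (λ j → f (i ℤ.+ + p ℤ.* j)))
Σ-blocks p q f = begin
  Σ[ p * q ] f                                       ≡⟨ cong (λ N → Σ[ N ] f) (ℕP.*-comm p q) ⟩
  Σ[ q * p ] f                                       ≡⟨ transposed q f ⟩
  Σ[ q ] (λ j → Σ[ p ] (λ i → f (i ℤ.+ + p ℤ.* j)))   ≡⟨ Σ-comm q p (λ j i → f (i ℤ.+ + p ℤ.* j)) ⟩
  Σ[ p ] (λ i → Σ[ q ] (λ j → f (i ℤ.+ + p ℤ.* j)))   ∎
  where
  open ≡-Reasoning
  e₀ : ∀ p i → i ≡ i ℤ.+ p ℤ.* + 0
  e₀ = solve-∀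
  e₁ : ∀ p i j → p ℤ.+ (i ℤ.+ p ℤ.* j) ≡ i ℤ.+ p ℤ.* (+ 1 ℤ.+ j)
  e₁ = solve-∀
  transposed : ∀ q f → Σ[ q * p ] f ≡ Σ[ q ] (λ j → Σ[ p ] (λ i → f (i ℤ.+ + p ℤ.* j)))
  transposed zero    f = refl
  transposed (suc q) f = begin
    Σ[ p + q * p ] f
      ≡⟨ Σ-append p (q * p) f ⟩
    Σ[ p ] f + Σ[ q * p ] (λ a → f (+ p ℤ.+ a))
      ≡⟨ cong₂ _+_ (Σ-cong p (λ i → cong f (e₀ (+ p) i))) (transposed q (λ a → f (+ p ℤ.+ a))) ⟩
    Σ[ p ] (λ i → f (i ℤ.+ + p ℤ.* + 0)) + Σ[ q ] (λ j → Σ[ p ] (λ i → f (+ p ℤ.+ (i ℤ.+ + p ℤ.* j))))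
      ≡⟨ cong (ℕ._+_ (Σ[ p ] (λ i → f (i ℤ.+ + p ℤ.* + 0))))
           (Σ-cong q (λ j → Σ-cong p (λ i → cong f (e₁ (+ p) i j)))) ⟩
    Σ[ suc q ] (λ j → Σ[ p ] (λ i → f (i ℤ.+ + p ℤ.* j))) ∎

-- An affine map with invertible slope permutes the residues; its inverse is x ↦ u′ (x - c).
Σ-affine : ∀ n .{{_ : NonZero n}} {f : ℤ → ℕ} → Periodic n f → ∀ u u′ c → u′ ℤ.* u ≋ + 1 ⟨mod n ⟩ →
           Σ[ n ] (λ a → f (u ℤ.* a ℤ.+ c)) ≡ Σ[ n ] f
Σ-affine n {f} per u u′ c inv = sym (trans (sum-permute {n} {n} (λ i → f (+ toℕ i)) π)
    (sum-cong-≗ {n} (λ i → per (residue-≋ n (u ℤ.* + toℕ i ℤ.+ c)))))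
  where
  fwd bwd : Fin n → Fin n
  fwd i = residue n (u ℤ.* + toℕ i ℤ.+ c)
  bwd i = residue n (u′ ℤ.* (+ toℕ i ℤ.- c))
  e₁ : ∀ u u′ c x → u ℤ.* (u′ ℤ.* (x ℤ.- c)) ℤ.+ c ≡ (u′ ℤ.* u) ℤ.* (x ℤ.- c) ℤ.+ c
  e₁ = solve-∀
  e₁′ : ∀ c x → + 1 ℤ.* (x ℤ.- c) ℤ.+ c ≡ x
  e₁′ = solve-∀
  e₂ : ∀ u u′ c x → u′ ℤ.* (u ℤ.* x ℤ.+ c ℤ.- c) ≡ (u′ ℤ.* u) ℤ.* x
  e₂ = solve-∀
  fwd-bwd : ∀ i → fwd (bwd i) ≡ i
  fwd-bwd i = toℕ-mod-injective (begin
    + toℕ (fwd (bwd i))                                  ≈⟨ residue-≋ n (u ℤ.* + toℕ (bwd i) ℤ.+ c) ⟩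
    u ℤ.* + toℕ (bwd i) ℤ.+ c                            ≈⟨ +-modˡ c (*-modʳ u (residue-≋ n (u′ ℤ.* (+ toℕ i ℤ.- c)))) ⟩
    u ℤ.* (u′ ℤ.* (+ toℕ i ℤ.- c)) ℤ.+ c                  ≡⟨ e₁ u u′ c (+ toℕ i) ⟩
    (u′ ℤ.* u) ℤ.* (+ toℕ i ℤ.- c) ℤ.+ c                  ≈⟨ +-modˡ c (*-modˡ (+ toℕ i ℤ.- c) inv) ⟩
    + 1 ℤ.* (+ toℕ i ℤ.- c) ℤ.+ c                         ≡⟨ e₁′ c (+ toℕ i) ⟩
    + toℕ i                                              ∎)
    where open ≋-Reasoning n
  bwd-fwd : ∀ i → bwd (fwd i) ≡ i
  bwd-fwd i = toℕ-mod-injective (begin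
    + toℕ (bwd (fwd i))                                  ≈⟨ residue-≋ n (u′ ℤ.* (+ toℕ (fwd i) ℤ.- c)) ⟩
    u′ ℤ.* (+ toℕ (fwd i) ℤ.- c)                          ≈⟨ *-modʳ u′ (+-modˡ (ℤ.- c) (residue-≋ n (u ℤ.* + toℕ i ℤ.+ c))) ⟩
    u′ ℤ.* (u ℤ.* + toℕ i ℤ.+ c ℤ.- c)                    ≡⟨ e₂ u u′ c (+ toℕ i) ⟩
    (u′ ℤ.* u) ℤ.* + toℕ i                               ≈⟨ *-modˡ (+ toℕ i) inv ⟩
    + 1 ℤ.* + toℕ i                                      ≡⟨ ℤP.*-identityˡ (+ toℕ i) ⟩
    + toℕ i                                              ∎)
    where open ≋-Reasoning n
  π : Permutation n n
  π = permutation fwd bwd fwd-bwd bwd-fwd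

Σ-reflect : ∀ n .{{_ : NonZero n}} {f : ℤ → ℕ} → Periodic n f → ∀ c → Σ[ n ] (λ a → f (c ℤ.- a)) ≡ Σ[ n ] f
Σ-reflect n {f} per c = trans (Σ-cong n (λ a → cong f (e c a)))
    (Σ-affine n per (ℤ.- (+ 1)) (ℤ.- (+ 1)) c mod-refl)
  where
  e : ∀ c a → c ℤ.- a ≡ (ℤ.- (+ 1)) ℤ.* a ℤ.+ c
  e = solve-∀

Σ-periodic : ∀ p q {f : ℤ → ℕ} .{{_ : NonZero q}} → Periodic q f → Σ[ p * q ] f ≡ p * Σ[ q ] f
Σ-periodic p q {f} per = begin
  Σ[ p * q ] f                                       ≡⟨ cong (λ N → Σ[ N ] f) (ℕP.*-comm p q) ⟩
  Σ[ q * p ] f                                       ≡⟨ Σ-blocks q p f ⟩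
  Σ[ q ] (λ i → Σ[ p ] (λ j → f (i ℤ.+ + q ℤ.* j)))   ≡⟨ Σ-cong q (λ i → trans (Σ-cong p (λ j → per (+n*≋ q i j))) (Σ-const p (f i))) ⟩
  Σ[ q ] (λ i → p * f i)                             ≡⟨ Σ-*ˡ q p f ⟩
  p * Σ[ q ] f                                       ∎
  where open ≡-Reasoning

abstract
  -- The Iverson bracket, kept opaque so that the decision procedure does not unfold in goals.
  [_∣_] : ℕ → ℤ → ℕ
  [ n ∣ a ] = if does ((+ n) ∣? a) then 1 else 0

  [∣]-yes : ∀ {n a} → + n ∣ a → [ n ∣ a ] ≡ 1
  [∣]-yes {n} {a} d = cong (if_then 1 else 0) (dec-true ((+ n) ∣? a) d)

  [∣]-no : ∀ {n a} → ¬ (+ n ∣ a) → [ n ∣ a ] ≡ 0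
  [∣]-no {n} {a} ¬d = cong (if_then 1 else 0) (dec-false ((+ n) ∣? a) ¬d)

[∣]-⇔ : ∀ {n a n′ a′} → (+ n ∣ a → + n′ ∣ a′) → (+ n′ ∣ a′ → + n ∣ a) → [ n ∣ a ] ≡ [ n′ ∣ a′ ]
[∣]-⇔ {n} {a} f g with (+ n) ∣? a
... | yes d = trans ([∣]-yes d) (sym ([∣]-yes (f d)))
... | no ¬d = trans ([∣]-no ¬d) (sym ([∣]-no (¬d ∘ g)))

[∣]-periodic : ∀ n → Periodic n [ n ∣_]
[∣]-periodic n h = [∣]-⇔ (∣-mod (mod-sym h)) (∣-mod h)

Σ-zero : ∀ n {f : ℤ → ℕ} → (∀ a → f a ≡ 0) → Σ[ n ] f ≡ 0
Σ-zero n h = trans (Σ-cong n h) (trans (Σ-const n 0) (ℕP.*-zeroʳ n))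

Σ-[∣] : ∀ n .{{_ : NonZero n}} → Σ[ n ] [ n ∣_] ≡ 1
Σ-[∣] n@(suc n′) = cong₂ _+_ ([∣]-yes {n} (divides (+ 0) refl))
    (trans (sum-cong-≗ {n′} (λ i → [∣]-no {n} (λ d → contradiction (∣∧<⇒≡0 {n} (∣⇒∣ᵤ {+ n} {+ suc (toℕ i)} d) (s≤s (FinP.toℕ<n i))) λ ())))
           (trans (sum-const n′ 0) (ℕP.*-zeroʳ n′)))

-- Over ℕ the Bézout identity has two shapes: 1 + y n = x a yields the inverse x, and 1 + x a = y n
-- yields -x.
bézout : ∀ {a n} → Coprime a n → ∃ λ u → u ℤ.* + a ≋ + 1 ⟨mod n ⟩
bézout {a} {n} c with Coprimality.coprime-Bézout c
... | Bézout.+- x y eq = + x , cong-mod (divides (+ y) (trans (cong (ℤ._- + 1) (sym (trans (cong (+_) eq) (ℤP.pos-* x a))))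
        (trans (cong (ℤ._- + 1) (ℤP.pos-+ 1 (y * n))) (trans (e (+ (y * n))) (ℤP.pos-* y n)))))
  where
  e : ∀ z → (+ 1 ℤ.+ z) ℤ.- + 1 ≡ z
  e = solve-∀
... | Bézout.-+ x y eq = ℤ.- (+ x) , cong-mod (divides (ℤ.- (+ y))
        (trans (trans (e (+ x) (+ a)) (cong ℤ.-_ (trans (cong (ℤ._+_ (+ 1)) (sym (ℤP.pos-* x a))) (trans (sym (ℤP.pos-+ 1 (x * a))) (trans (cong (+_) eq) (ℤP.pos-* y n))))))
          (ℤP.neg-distribˡ-* (+ y) (+ n))))
  where
  e : ∀ x a → (ℤ.- x) ℤ.* a ℤ.- + 1 ≡ ℤ.- (+ 1 ℤ.+ x ℤ.* a)
  e = solve-∀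

-- Counting continuants

-- F n l x y counts the (b₁,…,b_l) ∈ (ℤ/n)ˡ for which the recurrence z ↦ b z - (previous)
-- started at (x , y) ends at 1.
F : ℕ → ℕ → ℤ → ℤ → ℕ
F n zero    x y = [ n ∣ y ℤ.- + 1 ]
F n (suc l) x y = Σ[ n ] (λ b → F n l y (b ℤ.* y ℤ.- x))

F-cong : ∀ n l {x x′ y y′} → x ≋ x′ ⟨mod n ⟩ → y ≋ y′ ⟨mod n ⟩ → F n l x y ≡ F n l x′ y′
F-cong n zero    hx hy = [∣]-periodic n (+-modˡ (ℤ.- (+ 1)) hy)
F-cong n (suc l) hx hy = Σ-cong n (λ b → F-cong n l hy (-‿mod (*-modʳ b hy) hx))

F-one : ∀ l x y → F 1 l x y ≡ 1
F-one zero    x y = [∣]-yes {1} (divides (y ℤ.- + 1) (sym (ℤP.*-identityʳ (y ℤ.- + 1))))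
F-one (suc l) x y = trans (ℕP.+-identityʳ _) (F-one l y _)

-- The Chinese remainder theorem as a statement on sums: with b = i + m j the factor `f` sees only
-- i, and for fixed i the map j ↦ m j + i permutes the residues modulo n because m is invertible
-- there.
Σ-× : ∀ m n .{{_ : NonZero m}} .{{_ : NonZero n}} → Coprime m n → ∀ {f g} → Periodic m f → Periodic n g →
      Σ[ m * n ] (λ b → f b * g b) ≡ Σ[ m ] f * Σ[ n ] g
Σ-× m n c {f} {g} pf pg with bézout c
... | u , inv = begin
  Σ[ m * n ] (λ b → f b * g b)
    ≡⟨ Σ-blocks m n (λ b → f b * g b) ⟩
  Σ[ m ] (λ i → Σ[ n ] (λ j → f (i ℤ.+ + m ℤ.* j) * g (i ℤ.+ + m ℤ.* j)))
    ≡⟨ Σ-cong m (λ i → Σ-cong n (λ j → cong₂ _*_ (pf (+n*≋ m i j)) (cong g (ℤP.+-comm i (+ m ℤ.* j))))) ⟩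
  Σ[ m ] (λ i → Σ[ n ] (λ j → f i * g (+ m ℤ.* j ℤ.+ i)))
    ≡⟨ Σ-cong m (λ i → trans (Σ-*ˡ n (f i) (λ j → g (+ m ℤ.* j ℤ.+ i)))
                             (cong (f i *_) (Σ-affine n pg (+ m) u i inv))) ⟩
  Σ[ m ] (λ i → f i * Σ[ n ] g)
    ≡⟨ Σ-*ʳ m (Σ[ n ] g) f ⟩
  Σ[ m ] f * Σ[ n ] g ∎
  where open ≡-Reasoning

[∣]-× : ∀ m n → Coprime m n → ∀ a → [ m * n ∣ a ] ≡ [ m ∣ a ] * [ n ∣ a ]
[∣]-× m n c a with (+ m) ∣? a | (+ n) ∣? a
... | yes d | yes e = trans ([∣]-yes (∣ᵤ⇒∣ (both (∣⇒∣ᵤ d) (∣⇒∣ᵤ e)))) (sym (cong₂ _*_ ([∣]-yes d) ([∣]-yes e)))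
  where
  both : m ℕD.∣ ∣ a ∣ → n ℕD.∣ ∣ a ∣ → m * n ℕD.∣ ∣ a ∣
  both d (ℕD.divides k eq) = subst (m * n ℕD.∣_) (sym eq)
    (ℕD.*-monoˡ-∣ n (Coprimality.coprime-divisor c (subst (m ℕD.∣_) (trans eq (ℕP.*-comm k n)) d)))
... | no ¬d | _ = trans ([∣]-no (λ h → ¬d (∣-trans (∣ᵤ⇒∣ {+ m} {+ (m * n)} (ℕD.m∣m*n n)) h)))
                        (sym (cong (_* [ n ∣ a ]) ([∣]-no ¬d)))
... | yes d | no ¬e = trans ([∣]-no (λ h → ¬e (∣-trans (∣ᵤ⇒∣ {+ n} {+ (m * n)} (ℕD.n∣m*n m)) h)))
                        (sym (trans (cong ([ m ∣ a ] *_) ([∣]-no ¬e)) (ℕP.*-zeroʳ [ m ∣ a ])))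

-- One step of the recurrence is polynomial in b, so modulo m and modulo n it depends only on the
-- respective residue of b, and `Σ-×` applies step by step.
F-× : ∀ m n .{{_ : NonZero m}} .{{_ : NonZero n}} → Coprime m n → ∀ l x y → F (m * n) l x y ≡ F m l x y * F n l x y
F-× m n c zero    x y = [∣]-× m n c (y ℤ.- + 1)
F-× m n c (suc l) x y = trans (Σ-cong (m * n) (λ b → F-× m n c l y (b ℤ.* y ℤ.- x)))
    (Σ-× m n c (λ h → F-cong m l mod-refl (step h)) (λ h → F-cong n l mod-refl (step h)))
  where
  step : ∀ {k a b} → a ≋ b ⟨mod k ⟩ → a ℤ.* y ℤ.- x ≋ b ℤ.* y ℤ.- x ⟨mod k ⟩
  step h = +-modˡ (ℤ.- x) (*-modˡ y h)

-- The solutions of the continuant equation as a finite type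

Fin-sum : ∀ {n} (f : Fin n → ℕ) → Σ (Fin n) (Fin ∘ f) ↔ Fin (sum f)
Fin-sum {zero}  f = mk↔ₛ′ (λ { (() , _) }) (λ ()) (λ ()) (λ { (() , _) })
Fin-sum {suc n} f = ↔-trans split (↔-trans (↔-refl ⊎-↔ Fin-sum (f ∘ Fin.suc)) (↔-sym FinP.+↔⊎))
  where
  split : Σ (Fin (suc n)) (Fin ∘ f) ↔ (Fin (f Fin.zero) ⊎ Σ (Fin n) (Fin ∘ f ∘ Fin.suc))
  split = mk↔ₛ′ (λ { (Fin.zero , k) → inj₁ k ; (Fin.suc i , k) → inj₂ (i , k) })
                (λ { (inj₁ k) → Fin.zero , k ; (inj₂ (i , k)) → Fin.suc i , k })
                (λ { (inj₁ _) → refl ; (inj₂ _) → refl })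
                (λ { (Fin.zero , _) → refl ; (Fin.suc _ , _) → refl })

-- The tuples counted by `F`. The final `Fin` of an Iverson bracket encodes the condition that the
-- recurrence ends at 1 and has at most one element.
Path : ℕ → ℕ → ℤ → ℤ → Set
Path n zero    x y = Fin (F n zero x y)
Path n (suc l) x y = Σ (Fin n) (λ b → Path n l y (+ toℕ b ℤ.* y ℤ.- x))

Path↔Fin : ∀ n l x y → Path n l x y ↔ Fin (F n l x y)
Path↔Fin n zero    x y = ↔-refl
Path↔Fin n (suc l) x y = ↔-trans (congˡ (λ {b} → Path↔Fin n l y (+ toℕ b ℤ.* y ℤ.- x))) (Fin-sum {n} _)

bits : ∀ {n} l {x y} → Path n l x y → ℕ → ℤ
-- A default value: only indices below the length of the path are ever compared.
bits zero    _       i       = + 0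
bits (suc l) (b , π) zero    = + toℕ b
bits (suc l) (b , π) (suc i) = bits l π i

run : ℕ → (ℕ → ℤ) → ℤ → ℤ → ℤ
run zero    e x y = y
run (suc l) e x y = run l (e ∘ suc) y (e 0 ℤ.* y ℤ.- x)

run-cong : ∀ {n} l {e e′ : ℕ → ℤ} {x x′ y y′} → (∀ i → i < l → e i ≋ e′ i ⟨mod n ⟩) →
           x ≋ x′ ⟨mod n ⟩ → y ≋ y′ ⟨mod n ⟩ → run l e x y ≋ run l e′ x′ y′ ⟨mod n ⟩
run-cong zero    he hx hy = hy
run-cong (suc l) he hx hy = run-cong l (λ i i<l → he (suc i) (s≤s i<l)) hy (-‿mod (*-mod (he 0 (s≤s z≤n)) hy) hx)

run-bits : ∀ {n} l {x y} (π : Path n l x y) → run l (bits l π) x y ≋ + 1 ⟨mod n ⟩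
run-bits {n} zero {x} {y} π with (+ n) ∣? (y ℤ.- + 1)
... | yes d = cong-mod d
... | no ¬d = contradiction (subst Fin ([∣]-no ¬d) π) λ ()
run-bits (suc l) (b , π) = run-bits l π

-- Replacing each coefficient by its least residue preserves the end value modulo n; the path
-- therefore reproduces `e` only up to congruence.
mkPath : ∀ n .{{_ : NonZero n}} l (e : ℕ → ℤ) x y → run l e x y ≋ + 1 ⟨mod n ⟩ →
         Σ (Path n l x y) λ π → ∀ i → i < l → bits l π i ≋ e i ⟨mod n ⟩
mkPath n zero    e x y (cong-mod h) = subst Fin (sym ([∣]-yes h)) Fin.zero , λ i ()
mkPath n (suc l) e x y h = (b , proj₁ rest) , λ { zero _ → residue-≋ n (e 0) ; (suc i) (s≤s i<l) → proj₂ rest i i<l }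
  where
  b : Fin n
  b = residue n (e 0)
  same : run l (e ∘ suc) y (+ toℕ b ℤ.* y ℤ.- x) ≋ run l (e ∘ suc) y (e 0 ℤ.* y ℤ.- x) ⟨mod n ⟩
  same = run-cong l (λ _ _ → mod-refl) mod-refl (+-modˡ (ℤ.- x) (*-modˡ y (residue-≋ n (e 0))))
  rest : Σ (Path n l y (+ toℕ b ℤ.* y ℤ.- x)) λ π → ∀ i → i < l → bits l π i ≋ e (suc i) ⟨mod n ⟩
  rest = mkPath n l (e ∘ suc) y (+ toℕ b ℤ.* y ℤ.- x) (mod-trans same h)

Fin-[∣]-unique : ∀ {n a} (i j : Fin [ n ∣ a ]) → i ≡ j
Fin-[∣]-unique {n} {a} i j with (+ n) ∣? a
... | no ¬d = contradiction (subst Fin ([∣]-no ¬d) i) λ ()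
... | yes d = unique ([∣]-yes d) i j
  where
  unique : ∀ {N} → N ≡ 1 → (i j : Fin N) → i ≡ j
  unique refl Fin.zero Fin.zero = refl

-- The digits are least residues, hence fixed by their congruence classes, and the last component
-- carries no information.
Path-ext : ∀ {n} l {x y} (π π′ : Path n l x y) → (∀ i → i < l → bits l π i ≋ bits l π′ i ⟨mod n ⟩) → π ≡ π′
Path-ext zero    π π′ h = Fin-[∣]-unique π π′
Path-ext (suc l) (b , π) (b′ , π′) h with toℕ-mod-injective (h 0 (s≤s z≤n))
... | refl = cong (b ,_) (Path-ext l π π′ (λ i i<l → h (suc i) (s≤s i<l)))

-- Prime powers

-- A common divisor d of a and p^(e+1) is coprime to p, since p does not divide a; hence d divides
-- p^e.
prime-coprime-^ : ∀ {p a} → Prime p → ¬ (p ℕD.∣ a) → ∀ e → Coprime a (p ^ e)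
prime-coprime-^ {p} {a} pr p∤a zero    (_ , d∣1) = ℕD.∣1⇒≡1 d∣1
prime-coprime-^ {p} {a} pr p∤a (suc e) {d} (d∣a , d∣p^e) =
  prime-coprime-^ pr p∤a e (d∣a , Coprimality.coprime-divisor d⊥p d∣p^e)
  where
  d⊥p : Coprime d p
  d⊥p {g} (g∣d , g∣p) with prime⇒irreducible pr g∣p
  ... | inj₁ g≡1 = g≡1
  ... | inj₂ refl = contradiction (ℕD.∣-trans g∣d d∣a) p∤a

-- Writing the prime as `suc p₁` lets p - 1, the number of nonzero residues modulo p, occur without
-- truncated subtraction.
module PrimePower (p₁ : ℕ) (pr : Prime (suc p₁)) where

  p : ℕ
  p = suc p₁

  Unit : ℤ → Set
  Unit y = ¬ (+ p ∣ y)

  inverse : ∀ e y → Unit y → ∃ λ u → u ℤ.* y ≋ + 1 ⟨mod p ^ e ⟩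
  inverse e (+ a)      unit = bézout (prime-coprime-^ pr (unit ∘ ∣ᵤ⇒∣) e)
  inverse e (-[1+ a ]) unit with bézout (prime-coprime-^ pr (unit ∘ ∣ᵤ⇒∣) e)
  ... | u , h = ℤ.- u , mod-trans (≡⇒mod (eq u (+ suc a))) h
    where
    eq : ∀ u a → (ℤ.- u) ℤ.* (ℤ.- a) ≡ u ℤ.* a
    eq = solve-∀

  p∤1 : Unit (+ 1)
  p∤1 d = contradiction (ℕD.∣1⇒≡1 (∣⇒∣ᵤ d)) (λ { refl → contradiction (prime⇒nonTrivial pr) λ () })

  unit-small : ∀ {i} → i < p₁ → ∀ j → Unit ((+ 1 ℤ.+ + i) ℤ.+ + p ℤ.* j)
  unit-small {i} i<p₁ j d = contradiction
    (∣∧<⇒≡0 {p} (∣⇒∣ᵤ {+ p} {+ suc i} (∣-mod (mod-sym (+n*≋ p (+ suc i) j)) d)) (s≤s i<p₁)) λ ()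

  unit-reflect : ∀ k {y} → Unit y → Unit (+ p ℤ.* k ℤ.- y)
  unit-reflect k {y} unit d = unit (subst (+ p ∣_) (eq (+ p ℤ.* k) y) (∣m∣n⇒∣m-n (n∣n*k p k) d))
    where
    eq : ∀ a y → a ℤ.- (a ℤ.- y) ≡ y
    eq = solve-∀

  scale-mod : ∀ q {a b} → a ≋ b ⟨mod q ⟩ → + p ℤ.* a ≋ + p ℤ.* b ⟨mod p * q ⟩
  scale-mod q {a} {b} (cong-mod h) = modulo-by _ (subst (_∣ + p ℤ.* (a ℤ.- b)) (sym (ℤP.pos-* p q)) (*-monoʳ-∣ (+ p) h))
    (eq (+ p) a b)
    where
    eq : ∀ p a b → p ℤ.* (a ℤ.- b) ≡ p ℤ.* a ℤ.- p ℤ.* b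
    eq = solve-∀

  -- sum over the residues modulo p q that are prime to p
  Σ× : ℕ → (ℤ → ℕ) → ℕ
  Σ× q f = Σ[ p₁ ] (λ i → Σ[ q ] (λ j → f ((+ 1 ℤ.+ i) ℤ.+ + p ℤ.* j)))

  Σ-split : ∀ q f → Σ[ p * q ] f ≡ Σ[ q ] (λ j → f (+ p ℤ.* j)) + Σ× q f
  Σ-split q f = trans (Σ-blocks p q f)
    (cong (_+ Σ× q f) (Σ-cong q (λ j → cong f (ℤP.+-identityˡ (+ p ℤ.* j)))))

  Σ×-cong : ∀ q {f g} → (∀ y → Unit y → f y ≡ g y) → Σ× q f ≡ Σ× q g
  Σ×-cong q h = sum-cong-≗ {p₁} (λ i → Σ-cong q (λ j → h _ (unit-small (FinP.toℕ<n i) j)))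

  Σ×-const : ∀ q c → Σ× q (λ _ → c) ≡ p₁ * (q * c)
  Σ×-const q c = trans (Σ-cong p₁ (λ _ → Σ-const q c)) (Σ-const p₁ (q * c))

  Σ×-+ : ∀ q f g → Σ× q (λ y → f y + g y) ≡ Σ× q f + Σ× q g
  Σ×-+ q f g = trans
    (Σ-cong p₁ (λ i → Σ-+ q (λ j → f ((+ 1 ℤ.+ i) ℤ.+ + p ℤ.* j)) (λ j → g ((+ 1 ℤ.+ i) ℤ.+ + p ℤ.* j))))
    (Σ-+ p₁ (λ i → Σ[ q ] (λ j → f ((+ 1 ℤ.+ i) ℤ.+ + p ℤ.* j))) (λ i → Σ[ q ] (λ j → g ((+ 1 ℤ.+ i) ℤ.+ + p ℤ.* j))))

  Σ×-comm : ∀ q n (f : ℤ → ℤ → ℕ) → Σ× q (λ y → Σ[ n ] (λ a → f a y)) ≡ Σ[ n ] (λ a → Σ× q (f a))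
  Σ×-comm q n f = trans (Σ-cong p₁ (λ i → Σ-comm q n (λ j a → f a ((+ 1 ℤ.+ i) ℤ.+ + p ℤ.* j))))
    (Σ-comm p₁ n (λ i a → Σ[ q ] (λ j → f a ((+ 1 ℤ.+ i) ℤ.+ + p ℤ.* j))))

  -- The reflection y ↦ p c - y permutes all residues and also permutes the multiples of p.
  -- Cancelling the sum over the multiples leaves the units.
  Σ×-reflect : ∀ q .{{_ : NonZero q}} .{{_ : NonZero (p * q)}} {f} → Periodic (p * q) f → ∀ c →
               Σ× q (λ y → f (+ p ℤ.* c ℤ.- y)) ≡ Σ× q f
  Σ×-reflect q {f} per c = ℕP.+-cancelˡ-≡ (Σ[ q ] (λ j → f (+ p ℤ.* j))) _ _ (begin
    Σ[ q ] (λ j → f (+ p ℤ.* j)) + Σ× q (λ y → f (+ p ℤ.* c ℤ.- y))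
      ≡⟨ cong (_+ Σ× q (λ y → f (+ p ℤ.* c ℤ.- y))) (sym (trans
           (Σ-cong q (λ j → cong f (eq (+ p) c j)))
           (Σ-reflect q {λ j → f (+ p ℤ.* j)} (per ∘ scale-mod q) c))) ⟩
    Σ[ q ] (λ j → f (+ p ℤ.* c ℤ.- + p ℤ.* j)) + Σ× q (λ y → f (+ p ℤ.* c ℤ.- y))
      ≡⟨ Σ-split q (λ y → f (+ p ℤ.* c ℤ.- y)) ⟨
    Σ[ p * q ] (λ y → f (+ p ℤ.* c ℤ.- y))
      ≡⟨ Σ-reflect (p * q) per (+ p ℤ.* c) ⟩
    Σ[ p * q ] f
      ≡⟨ Σ-split q f ⟩
    Σ[ q ] (λ j → f (+ p ℤ.* j)) + Σ× q f ∎)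
    where
    open ≡-Reasoning
    eq : ∀ p c j → p ℤ.* c ℤ.- p ℤ.* j ≡ p ℤ.* (c ℤ.- j)
    eq = solve-∀

  p^≢0 : ∀ e → NonZero (p ^ e)
  p^≢0 e = ℕP.m^n≢0 p e

  -- U e j w counts the solutions of Σᵢ aᵢ bᵢ ≡ ± w modulo pᵉ, where i runs from 1 to j.
  U : ℕ → ℕ → ℤ → ℕ
  U e zero    w = [ p ^ e ∣ w ]
  U e (suc j) w = Σ[ p ^ e ] (λ a → Σ[ p ^ e ] (λ b → U e j (a ℤ.* b ℤ.- w)))

  U-periodic : ∀ e j → Periodic (p ^ e) (U e j)
  U-periodic e zero    h = [∣]-periodic (p ^ e) h
  U-periodic e (suc j) h = Σ-cong (p ^ e) (λ a → Σ-cong (p ^ e) (λ b → U-periodic e j (-‿mod (mod-refl {a = a ℤ.* b}) h)))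

  -- Letting w vary removes the equation, so all tuples of j pairs are counted.
  U-total : ∀ e j → Σ[ p ^ e ] (U e j) ≡ (p ^ e * p ^ e) ^ j
  U-total e zero    = Σ-[∣] (p ^ e) {{p^≢0 e}}
  U-total e (suc j) = begin
    Σ[ q ] (λ w → Σ[ q ] (λ a → Σ[ q ] (λ b → U e j (a ℤ.* b ℤ.- w))))
      ≡⟨ Σ-comm q q (λ w a → Σ[ q ] (λ b → U e j (a ℤ.* b ℤ.- w))) ⟩
    Σ[ q ] (λ a → Σ[ q ] (λ w → Σ[ q ] (λ b → U e j (a ℤ.* b ℤ.- w))))
      ≡⟨ Σ-cong q (λ a → Σ-comm q q (λ w b → U e j (a ℤ.* b ℤ.- w))) ⟩
    Σ[ q ] (λ a → Σ[ q ] (λ b → Σ[ q ] (λ w → U e j (a ℤ.* b ℤ.- w))))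
      ≡⟨ Σ-cong q (λ a → Σ-cong q (λ b → trans (Σ-reflect q {{p^≢0 e}} (U-periodic e j) (a ℤ.* b)) (U-total e j))) ⟩
    Σ[ q ] (λ a → Σ[ q ] (λ b → (q * q) ^ j))
      ≡⟨ trans (Σ-cong q (λ a → Σ-const q ((q * q) ^ j))) (Σ-const q (q * (q * q) ^ j)) ⟩
    q * (q * (q * q) ^ j)
      ≡⟨ ℕP.*-assoc q q ((q * q) ^ j) ⟨
    q * q * (q * q) ^ j ∎
    where
    open ≡-Reasoning
    q : ℕ
    q = p ^ e

  -- The number of solutions modulo p^(t+1) in which some aᵢ is prime to p. It is the same for every
  -- right-hand side, since the corresponding bᵢ is determined by the other unknowns. In the
  -- recursion the first summand has p dividing the new a, the second has a prime to p.
  A : ℕ → ℕ → ℕ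
  A t zero    = 0
  A t (suc j) = p ^ t * (p ^ suc t * A t j) + p₁ * (p ^ t * (p ^ suc t * p ^ suc t) ^ j)

  -- Splitting the sum over a into p ∣ a and p ∤ a; in the second case a b runs over all residues.
  U-step : ∀ t j c → U (suc t) (suc j) c ≡
           Σ[ p ^ t ] (λ a → Σ[ p ^ suc t ] (λ b → U (suc t) j (+ p ℤ.* (a ℤ.* b) ℤ.- c)))
             + p₁ * (p ^ t * (p ^ suc t * p ^ suc t) ^ j)
  U-step t j c = trans (Σ-split (p ^ t) (λ a → Σ[ q ] (λ b → U (suc t) j (a ℤ.* b ℤ.- c)))) (cong₂ _+_
      (Σ-cong (p ^ t) (λ a → Σ-cong q (λ b → cong (λ z → U (suc t) j (z ℤ.- c)) (ℤP.*-assoc (+ p) a b))))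
      (trans (Σ×-cong (p ^ t) unit-case) (Σ×-const (p ^ t) ((q * q) ^ j))))
    where
    q : ℕ
    q = p ^ suc t
    unit-case : ∀ a → Unit a → Σ[ q ] (λ b → U (suc t) j (a ℤ.* b ℤ.- c)) ≡ (q * q) ^ j
    unit-case a unit = trans (Σ-affine q {{p^≢0 (suc t)}} (U-periodic (suc t) j) a (proj₁ (inverse (suc t) a unit)) (ℤ.- c)
        (proj₂ (inverse (suc t) a unit))) (U-total (suc t) j)

  -- If p divides every aᵢ it divides the sum, which a right-hand side prime to p excludes; only the
  -- solutions counted by `A` remain.
  U-unit : ∀ t j {c} → Unit c → U (suc t) j c ≡ A t j
  U-unit t zero    {c} unit = [∣]-no (λ d → unit (∣-trans (∣ᵤ⇒∣ {+ p} {+ (p * p ^ t)} (ℕD.m∣m*n (p ^ t))) d))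
  U-unit t (suc j) {c} unit = trans (U-step t j c) (cong (_+ p₁ * (p ^ t * (p ^ suc t * p ^ suc t) ^ j))
    (trans (Σ-cong (p ^ t) (λ a → trans (Σ-cong (p ^ suc t) (λ b → U-unit t j (unit-reflect (a ℤ.* b) unit)))
                                        (Σ-const (p ^ suc t) (A t j))))
           (Σ-const (p ^ t) (p ^ suc t * A t j))))

  -- The term besides `A` counts the solutions with every aᵢ divisible by p: after division by p the
  -- equation holds modulo p^t, and each of the j residues bᵢ modulo p^t has p lifts modulo p^(t+1).
  U-multiple : ∀ t j w → U (suc t) j (+ p ℤ.* w) ≡ A t j + p ^ j * U t j w
  U-multiple t zero    w = trans ([∣]-⇔ {p * p ^ t} {+ p ℤ.* w} {p ^ t} {w}
      (λ d → *-cancelˡ-∣ (+ p) (subst (_∣ + p ℤ.* w) (ℤP.pos-* p (p ^ t)) d))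
      (λ d → subst (_∣ + p ℤ.* w) (sym (ℤP.pos-* p (p ^ t))) (*-monoʳ-∣ (+ p) d)))
      (sym (ℕP.*-identityˡ [ p ^ t ∣ w ]))
  U-multiple t (suc j) w = begin
    U (suc t) (suc j) (+ p ℤ.* w)
      ≡⟨ U-step t j (+ p ℤ.* w) ⟩
    Σ[ q′ ] (λ a → Σ[ q ] (λ b → U (suc t) j (+ p ℤ.* (a ℤ.* b) ℤ.- + p ℤ.* w))) + B
      ≡⟨ cong (_+ B) (Σ-cong q′ inner) ⟩
    Σ[ q′ ] (λ a → q * A t j + p ^ suc j * Σ[ q′ ] (λ b → U t j (a ℤ.* b ℤ.- w))) + B
      ≡⟨ cong (_+ B) (trans (Σ-+ q′ (λ _ → q * A t j) (λ a → p ^ suc j * Σ[ q′ ] (λ b → U t j (a ℤ.* b ℤ.- w))))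
           (cong₂ _+_ (Σ-const q′ (q * A t j)) (Σ-*ˡ q′ (p ^ suc j) (λ a → Σ[ q′ ] (λ b → U t j (a ℤ.* b ℤ.- w)))))) ⟩
    q′ * (q * A t j) + p ^ suc j * U t (suc j) w + B
      ≡⟨ rearrange (q′ * (q * A t j)) (p ^ suc j * U t (suc j) w) B ⟩
    A t (suc j) + p ^ suc j * U t (suc j) w ∎
    where
    open ≡-Reasoning
    q′ q B : ℕ
    q′ = p ^ t
    q = p ^ suc t
    B = p₁ * (p ^ t * (p ^ suc t * p ^ suc t) ^ j)
    rearrange : ∀ x y z → x + y + z ≡ x + z + y
    rearrange = ℕRing.solve-∀
    swap : ∀ x y z → x * (y * z) ≡ y * x * z
    swap = ℕRing.solve-∀
    eq : ∀ p k w → p ℤ.* k ℤ.- p ℤ.* w ≡ p ℤ.* (k ℤ.- w)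
    eq = solve-∀
    inner : ∀ a → Σ[ q ] (λ b → U (suc t) j (+ p ℤ.* (a ℤ.* b) ℤ.- + p ℤ.* w)) ≡
                  q * A t j + p ^ suc j * Σ[ q′ ] (λ b → U t j (a ℤ.* b ℤ.- w))
    inner a = begin
      Σ[ q ] (λ b → U (suc t) j (+ p ℤ.* (a ℤ.* b) ℤ.- + p ℤ.* w))
        ≡⟨ Σ-cong q (λ b → trans (cong (U (suc t) j) (eq (+ p) (a ℤ.* b) w)) (U-multiple t j (a ℤ.* b ℤ.- w))) ⟩
      Σ[ q ] (λ b → A t j + p ^ j * U t j (a ℤ.* b ℤ.- w))
        ≡⟨ Σ-+ q (λ _ → A t j) (λ b → p ^ j * U t j (a ℤ.* b ℤ.- w)) ⟩
      Σ[ q ] (λ b → A t j) + Σ[ q ] (λ b → p ^ j * U t j (a ℤ.* b ℤ.- w))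
        ≡⟨ cong₂ _+_ (Σ-const q (A t j)) (Σ-*ˡ q (p ^ j) (λ b → U t j (a ℤ.* b ℤ.- w))) ⟩
      q * A t j + p ^ j * Σ[ p * q′ ] (λ b → U t j (a ℤ.* b ℤ.- w))
        ≡⟨ cong (λ z → q * A t j + p ^ j * z)
             (Σ-periodic p q′ {{p^≢0 t}} (λ h → U-periodic t j (+-modˡ (ℤ.- w) (*-modʳ a h)))) ⟩
      q * A t j + p ^ j * (p * Σ[ q′ ] (λ b → U t j (a ℤ.* b ℤ.- w)))
        ≡⟨ cong (ℕ._+_ (q * A t j)) (swap (p ^ j) p _) ⟩
      q * A t j + p ^ suc j * Σ[ q′ ] (λ b → U t j (a ℤ.* b ℤ.- w)) ∎

-- Unlike `2 * j`, this exposes two successors by computation, matching two steps of the recurrence.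
double : ℕ → ℕ
double zero    = zero
double (suc j) = suc (suc (double j))

-- The recurrence modulo q = p^(s+1)

module Level (p₁ : ℕ) (pr : Prime (suc p₁)) (s : ℕ) where
  open PrimePower p₁ pr

  q′ q : ℕ
  q′ = p ^ s
  q  = p ^ suc s

  q≢0 : NonZero q
  q≢0 = p^≢0 (suc s)

  p∣q : + p ∣ + q
  p∣q = ∣ᵤ⇒∣ {+ p} {+ q} (ℕD.m∣m*n q′)

  -- The previous value 0 is an arbitrary choice: by `F-indep` it does not matter at units.
  h : ℕ → ℤ → ℕ
  h l y = F q l (+ 0) y

  h-periodic : ∀ l → Periodic q (h l)
  h-periodic l = F-cong q l mod-refl

  -- For a unit y the next value b y - x runs once through all residues, whatever x is.
  F-unit : ∀ l x {y} → Unit y → F q (suc l) x y ≡ Σ[ q ] (F q l y)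
  F-unit l x {y} unit = trans
    (Σ-cong q (λ b → cong (λ z → F q l y (z ℤ.- x)) (ℤP.*-comm b y)))
    (Σ-affine q {{q≢0}} (F-cong q l mod-refl) y (proj₁ (inverse (suc s) y unit)) (ℤ.- x) (proj₂ (inverse (suc s) y unit)))

  F-indep : ∀ l x {y} → Unit y → F q l x y ≡ h l y
  F-indep zero    x unit = refl
  F-indep (suc l) x unit = trans (F-unit l x unit) (sym (F-unit l (+ 0) unit))

  -- the sum over the pairs (z , b) with p ∣ z that occur in two steps of the recurrence
  Q : (ℤ → ℕ) → ℤ → ℕ
  Q f y = Σ[ q′ ] (λ a → Σ[ q ] (λ b → f (+ p ℤ.* (a ℤ.* b) ℤ.- y)))

  Q-cong : ∀ f g y → (∀ k → f (+ p ℤ.* k ℤ.- y) ≡ g (+ p ℤ.* k ℤ.- y)) → Q f y ≡ Q g y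
  Q-cong f g y e = Σ-cong q′ (λ a → Σ-cong q (λ b → e (a ℤ.* b)))

  Q-const : ∀ c y → Q (λ _ → c) y ≡ q′ * (q * c)
  Q-const c y = trans (Σ-cong q′ (λ _ → Σ-const q c)) (Σ-const q′ (q * c))

  Q-+ : ∀ f g y → Q (λ z → f z + g z) y ≡ Q f y + Q g y
  Q-+ f g y = trans
    (Σ-cong q′ (λ a → Σ-+ q (λ b → f (+ p ℤ.* (a ℤ.* b) ℤ.- y)) (λ b → g (+ p ℤ.* (a ℤ.* b) ℤ.- y))))
    (Σ-+ q′ (λ a → Σ[ q ] (λ b → f (+ p ℤ.* (a ℤ.* b) ℤ.- y))) (λ a → Σ[ q ] (λ b → g (+ p ℤ.* (a ℤ.* b) ℤ.- y))))

  -- For fixed a and b the map y ↦ p a b - y permutes the units, so each of the q′ q pairs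
  -- contributes the same sum.
  Σ×-Q : ∀ {f} → Periodic q f → Σ× q′ (Q f) ≡ q′ * (q * Σ× q′ f)
  Σ×-Q {f} per = begin
    Σ× q′ (λ y → Σ[ q′ ] (λ a → Σ[ q ] (λ b → f (+ p ℤ.* (a ℤ.* b) ℤ.- y))))
      ≡⟨ Σ×-comm q′ q′ (λ a y → Σ[ q ] (λ b → f (+ p ℤ.* (a ℤ.* b) ℤ.- y))) ⟩
    Σ[ q′ ] (λ a → Σ× q′ (λ y → Σ[ q ] (λ b → f (+ p ℤ.* (a ℤ.* b) ℤ.- y))))
      ≡⟨ Σ-cong q′ (λ a → Σ×-comm q′ q (λ b y → f (+ p ℤ.* (a ℤ.* b) ℤ.- y))) ⟩
    Σ[ q′ ] (λ a → Σ[ q ] (λ b → Σ× q′ (λ y → f (+ p ℤ.* (a ℤ.* b) ℤ.- y))))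
      ≡⟨ Σ-cong q′ (λ a → Σ-cong q (λ b → Σ×-reflect q′ {{p^≢0 s}} {{q≢0}} per (a ℤ.* b))) ⟩
    Q (λ _ → Σ× q′ f) (+ 0)
      ≡⟨ Q-const (Σ× q′ f) (+ 0) ⟩
    q′ * (q * Σ× q′ f) ∎
    where open ≡-Reasoning

  H : ℕ → ℕ
  H l = Σ× q′ (h l)

  h-suc-suc : ∀ l {y} → Unit y → h (suc (suc l)) y ≡ H (suc l) + Q (h l) y
  h-suc-suc l {y} unit = begin
    h (suc (suc l)) y
      ≡⟨ F-unit (suc l) (+ 0) unit ⟩
    Σ[ q ] (F q (suc l) y)
      ≡⟨ Σ-split q′ (F q (suc l) y) ⟩
    Σ[ q′ ] (λ a → F q (suc l) y (+ p ℤ.* a)) + Σ× q′ (F q (suc l) y)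
      -- In both parts the previous value can be reset to 0: z is a unit in the second, and in the
      -- first the value p a b - y reached after p a is one.
      ≡⟨ cong₂ _+_ (Σ-cong q′ (λ a → Σ-cong q (λ b → two-steps a b))) (Σ×-cong q′ (λ z → F-indep (suc l) y)) ⟩
    Q (h l) y + H (suc l)
      ≡⟨ ℕP.+-comm (Q (h l) y) (H (suc l)) ⟩
    H (suc l) + Q (h l) y ∎
    where
    open ≡-Reasoning
    eq : ∀ p a b y → b ℤ.* (p ℤ.* a) ℤ.- y ≡ p ℤ.* (a ℤ.* b) ℤ.- y
    eq = solve-∀
    two-steps : ∀ a b → F q l (+ p ℤ.* a) (b ℤ.* (+ p ℤ.* a) ℤ.- y) ≡ h l (+ p ℤ.* (a ℤ.* b) ℤ.- y)
    two-steps a b = trans (cong (F q l (+ p ℤ.* a)) (eq (+ p) a b y)) (F-indep l (+ p ℤ.* a) (unit-reflect (a ℤ.* b) unit))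

  Σ-h₀ : Σ[ q ] (h 0) ≡ 1
  Σ-h₀ = trans (Σ-cong q (λ z → cong (λ w → [ q ∣ w ℤ.- + 1 ]) (sym (ℤP.*-identityˡ z))))
    (trans (Σ-affine q {{q≢0}} ([∣]-periodic q) (+ 1) (+ 1) (ℤ.- (+ 1)) mod-refl) (Σ-[∣] q {{q≢0}}))

  h-one : ∀ {y} → Unit y → h 1 y ≡ 1
  h-one unit = trans (F-unit 0 (+ 0) unit) Σ-h₀

  -- `h 0` is the indicator of the residue 1, which is not a multiple of p, so the units carry the
  -- whole sum.
  H-zero : H 0 ≡ 1
  H-zero = trans (sym (trans (Σ-split q′ (h 0)) (cong (_+ H 0) (Σ-zero q′ multiple)))) Σ-h₀
    where
    eq : ∀ a → a ℤ.- (a ℤ.- + 1) ≡ + 1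
    eq = solve-∀
    multiple : ∀ j → h 0 (+ p ℤ.* j) ≡ 0
    multiple j = [∣]-no (λ d → p∤1 (subst (+ p ∣_) (eq (+ p ℤ.* j)) (∣m∣n⇒∣m-n (n∣n*k p j) (∣-trans p∣q d))))

  H-one : H 1 ≡ p₁ * q′
  H-one = trans (Σ×-cong q′ (λ y → h-one)) (trans (Σ×-const q′ 1) (cong (p₁ *_) (ℕP.*-identityʳ q′)))

  -- `h-suc-suc` summed over the (p - 1) q′ units. Although `h` itself satisfies no closed scalar
  -- recurrence, the sums do, because `Σ×-Q` averages the dependence on y away.
  H-suc-suc : ∀ l → H (suc (suc l)) ≡ p₁ * (q′ * H (suc l)) + q′ * (q * H l)
  H-suc-suc l = trans (Σ×-cong q′ (λ y → h-suc-suc l)) (trans (Σ×-+ q′ (λ _ → H (suc l)) (Q (h l)))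
    (cong₂ _+_ (Σ×-const q′ (H (suc l))) (Σ×-Q (h-periodic l))))

  odd-value : ℕ → ℕ
  odd-value zero    = 1
  odd-value (suc j) = H (suc (suc (double j))) + q′ * (q * odd-value j)

  -- Constancy on units passes from `h 1` upwards, as `Q` evaluates its argument only at the units p
  -- a b - y.
  h-odd : ∀ j {y} → Unit y → h (suc (double j)) y ≡ odd-value j
  h-odd zero    unit = h-one unit
  h-odd (suc j) {y} unit = trans (h-suc-suc (suc (double j)) unit) (cong (ℕ._+_ (H (suc (suc (double j)))))
    (trans (Q-cong (h (suc (double j))) (λ _ → odd-value j) y (λ k → h-odd j (unit-reflect k unit))) (Q-const (odd-value j) y)))

  -- For even l the recursion `h-suc-suc` is affine in `h`. `X` is its solution with source `H` and
  -- initial value 0, independent of y; `P` is the solution without source that starts at the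
  -- indicator of 1.
  X : ℕ → ℕ
  X zero    = 0
  X (suc j) = H (suc (double j)) + q′ * (q * X j)

  -- The contribution of those runs in which every second value, beginning with the first one after
  -- y, is a multiple of p.
  P : ℕ → ℤ → ℕ
  P zero    y = [ q ∣ y ℤ.- + 1 ]
  P (suc j) y = Q (P j) y

  h-even : ∀ j {y} → Unit y → h (double j) y ≡ X j + P j y
  h-even zero    unit = refl
  h-even (suc j) {y} unit = trans (h-suc-suc (double j) unit) (trans (cong (ℕ._+_ (H (suc (double j))))
    (trans (Q-cong (h (double j)) (λ z → X j + P j z) y (λ k → h-even j (unit-reflect k unit)))
      (trans (Q-+ (λ _ → X j) (P j) y) (cong (_+ Q (P j) y) (Q-const (X j) y)))))
    (sym (ℕP.+-assoc (H (suc (double j))) (q′ * (q * X j)) (Q (P j) y))))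

  -- Modulo p two steps through a multiple of p negate the value, so a run counted by `P j` can end
  -- at 1 only if it starts at (-1)^j modulo p.
  ε : ℕ → ℤ
  ε zero    = + 1
  ε (suc j) = ℤ.- ε j

  -- Two steps lead from p w - ε j to p (a b - w) + ε j, so w follows the recursion of `U`. Only b
  -- modulo p^s matters while b runs modulo p^(s+1), which yields a factor p for each of the j
  -- pairs.
  P-value : ∀ j w → P j (+ p ℤ.* w ℤ.+ ε j) ≡ p ^ j * U s j w
  P-value zero w = trans ([∣]-⇔ {q} {+ p ℤ.* w ℤ.+ + 1 ℤ.- + 1} {q′} {w}
      (λ d → *-cancelˡ-∣ (+ p) (subst₂ _∣_ (ℤP.pos-* p q′) (eq (+ p ℤ.* w)) d))
      (λ d → subst₂ _∣_ (sym (ℤP.pos-* p q′)) (sym (eq (+ p ℤ.* w))) (*-monoʳ-∣ (+ p) d)))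
      (sym (ℕP.*-identityˡ [ q′ ∣ w ]))
    where
    eq : ∀ a → a ℤ.+ + 1 ℤ.- + 1 ≡ a
    eq = solve-∀
  P-value (suc j) w = begin
    Q (P j) (+ p ℤ.* w ℤ.- ε j)
      ≡⟨ Σ-cong q′ (λ a → Σ-cong q (λ b → trans (cong (P j) (eq (+ p) (a ℤ.* b) w (ε j))) (P-value j (a ℤ.* b ℤ.- w)))) ⟩
    Σ[ q′ ] (λ a → Σ[ p * q′ ] (λ b → p ^ j * U s j (a ℤ.* b ℤ.- w)))
      ≡⟨ Σ-cong q′ (λ a → trans (Σ-*ˡ (p * q′) (p ^ j) (λ b → U s j (a ℤ.* b ℤ.- w)))
           (cong (p ^ j *_) (Σ-periodic p q′ {{p^≢0 s}} (λ e → U-periodic s j (+-modˡ (ℤ.- w) (*-modʳ a e)))))) ⟩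
    Σ[ q′ ] (λ a → p ^ j * (p * Σ[ q′ ] (λ b → U s j (a ℤ.* b ℤ.- w))))
      ≡⟨ Σ-cong q′ (λ a → swap (p ^ j) p (Σ[ q′ ] (λ b → U s j (a ℤ.* b ℤ.- w)))) ⟩
    Σ[ q′ ] (λ a → p ^ suc j * Σ[ q′ ] (λ b → U s j (a ℤ.* b ℤ.- w)))
      ≡⟨ Σ-*ˡ q′ (p ^ suc j) (λ a → Σ[ q′ ] (λ b → U s j (a ℤ.* b ℤ.- w))) ⟩
    p ^ suc j * U s (suc j) w ∎
    where
    open ≡-Reasoning
    eq : ∀ p k w e → p ℤ.* k ℤ.- (p ℤ.* w ℤ.- e) ≡ p ℤ.* (k ℤ.- w) ℤ.+ e
    eq = solve-∀
    swap : ∀ x y z → x * (y * z) ≡ y * x * z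
    swap = ℕRing.solve-∀

  P-vanish : ∀ j {y} → Unit (y ℤ.- ε j) → P j y ≡ 0
  P-vanish zero    unit = [∣]-no (λ d → unit (∣-trans p∣q d))
  P-vanish (suc j) {y} unit = trans
    (Q-cong (P j) (λ _ → 0) y (λ k → P-vanish j (λ d → unit-reflect k unit (subst (+ p ∣_) (eq (+ p ℤ.* k) y (ε j)) d))))
    (trans (Q-const 0 y) (trans (cong (q′ *_) (ℕP.*-zeroʳ q)) (ℕP.*-zeroʳ q′)))
    where
    eq : ∀ a y e → a ℤ.- y ℤ.- e ≡ a ℤ.- (y ℤ.- (ℤ.- e))
    eq = solve-∀

-- Rational arithmetic

fromℕ-injective : ∀ {a b} → fromℕ a ≡ fromℕ b → a ≡ b
fromℕ-injective {a} {b} e with ℚP.fromℚᵘ-injective {mkℚᵘ (+ a) 0} {mkℚᵘ (+ b) 0} e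
... | *≡* h = ℤP.+-injective (trans (sym (ℤP.*-identityʳ (+ a))) (trans h (ℤP.*-identityʳ (+ b))))

toℚᵘ-fromℕ : ∀ a → ℚ.toℚᵘ (fromℕ a) ℚᵘ.≃ mkℚᵘ (+ a) 0
toℚᵘ-fromℕ a = ℚP.toℚᵘ-fromℚᵘ (mkℚᵘ (+ a) 0)

fromℕ-* : ∀ a b → fromℕ (a * b) ≡ fromℕ a ℚ.* fromℕ b
fromℕ-* a b = ℚP.toℚᵘ-injective (begin
  ℚ.toℚᵘ (fromℕ (a * b))                          ≈⟨ toℚᵘ-fromℕ (a * b) ⟩
  mkℚᵘ (+ (a * b)) 0                              ≈⟨ *≡* (cong (ℤ._* + 1) (ℤP.pos-* a b)) ⟩
  mkℚᵘ (+ a) 0 ℚᵘ.* mkℚᵘ (+ b) 0                  ≈⟨ ℚᵘP.*-cong (toℚᵘ-fromℕ a) (toℚᵘ-fromℕ b) ⟨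
  ℚ.toℚᵘ (fromℕ a) ℚᵘ.* ℚ.toℚᵘ (fromℕ b)          ≈⟨ ℚP.toℚᵘ-homo-* (fromℕ a) (fromℕ b) ⟨
  ℚ.toℚᵘ (fromℕ a ℚ.* fromℕ b)                    ∎)
  where open SetoidReasoning ℚᵘP.≃-setoid

fromℕ-+ : ∀ a b → fromℕ (a + b) ≡ fromℕ a ℚ.+ fromℕ b
fromℕ-+ a b = ℚP.toℚᵘ-injective (begin
  ℚ.toℚᵘ (fromℕ (a + b))                          ≈⟨ toℚᵘ-fromℕ (a + b) ⟩
  mkℚᵘ (+ (a + b)) 0                              ≈⟨ *≡* (cong (ℤ._* + 1) (sym (cong₂ ℤ._+_ (ℤP.*-identityʳ (+ a)) (ℤP.*-identityʳ (+ b))))) ⟩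
  mkℚᵘ (+ a) 0 ℚᵘ.+ mkℚᵘ (+ b) 0                  ≈⟨ ℚᵘP.+-cong (toℚᵘ-fromℕ a) (toℚᵘ-fromℕ b) ⟨
  ℚ.toℚᵘ (fromℕ a) ℚᵘ.+ ℚ.toℚᵘ (fromℕ b)          ≈⟨ ℚP.toℚᵘ-homo-+ (fromℕ a) (fromℕ b) ⟨
  ℚ.toℚᵘ (fromℕ a ℚ.+ fromℕ b)                    ∎)
  where open SetoidReasoning ℚᵘP.≃-setoid

fromℕ-*-1/ : ∀ n .{{_ : NonZero n}} → fromℕ n ℚ.* (+ 1 ℚ./ n) ≡ 1ℚ
fromℕ-*-1/ n@(suc d) = ℚP.toℚᵘ-injective (begin
  ℚ.toℚᵘ (fromℕ n ℚ.* (+ 1 ℚ./ n))                ≈⟨ ℚP.toℚᵘ-homo-* (fromℕ n) (+ 1 ℚ./ n) ⟩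
  ℚ.toℚᵘ (fromℕ n) ℚᵘ.* ℚ.toℚᵘ (+ 1 ℚ./ n)        ≈⟨ ℚᵘP.*-cong (toℚᵘ-fromℕ n) (ℚP.toℚᵘ-fromℚᵘ (mkℚᵘ (+ 1) d)) ⟩
  mkℚᵘ (+ n) 0 ℚᵘ.* mkℚᵘ (+ 1) d                  ≈⟨ *≡* (trans (ℤP.*-identityʳ (+ n ℤ.* + 1)) (trans (ℤP.*-comm (+ n) (+ 1)) (cong (λ z → + 1 ℤ.* + z) (sym (ℕP.+-identityʳ n))))) ⟩
  ℚᵘ.1ℚᵘ                                          ∎)
  where open SetoidReasoning ℚᵘP.≃-setoid

-- Abstract copies of fromℕ and powℤ: conversion checking would otherwise unfold the
-- normalised fractions behind them.
abstract
  ι : ℕ → ℚ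
  ι = fromℕ

  pw : (p : ℕ) .{{_ : NonZero p}} → ℤ → ℚ
  pw = powℤ

  ι≡fromℕ : ∀ n → ι n ≡ fromℕ n
  ι≡fromℕ n = refl

  pw≡powℤ : ∀ p .{{_ : NonZero p}} e → pw p e ≡ powℤ p e
  pw≡powℤ p e = refl

  ι-0 : ι 0 ≡ 0ℚ
  ι-0 = refl

  ι-1 : ι 1 ≡ 1ℚ
  ι-1 = refl

  ι-+ : ∀ a b → ι (a + b) ≡ ι a ℚ.+ ι b
  ι-+ = fromℕ-+

  ι-* : ∀ a b → ι (a * b) ≡ ι a ℚ.* ι b
  ι-* = fromℕ-*

  ι-injective : ∀ {a b} → ι a ≡ ι b → a ≡ b
  ι-injective = fromℕ-injective

  pw-pos : ∀ p .{{_ : NonZero p}} e → pw p (+ e) ≡ ι (p ^ e)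
  pw-pos p e = refl

  ι-*-pw : ∀ p .{{_ : NonZero p}} e → ι (p ^ e) ℚ.* pw p (ℤ.- (+ e)) ≡ 1ℚ
  ι-*-pw p zero    = refl
  ι-*-pw p (suc e) = fromℕ-*-1/ (p ^ suc e) {{ℕP.m^n≢0 p (suc e)}}

ι-^ : ∀ a e → ι (a ^ e) ≡ ι a ^ℚ e
ι-^ a zero    = ι-1
ι-^ a (suc e) = trans (ι-* a (a ^ e)) (cong (ι a ℚ.*_) (ι-^ a e))

ι-≢0 : ∀ n .{{_ : NonZero n}} → ι n ≢ 0ℚ
ι-≢0 (suc n) e = contradiction (ι-injective {suc n} {0} (trans e (sym ι-0))) λ ()

ℚ-cancelˡ : ∀ {c a b} → c ≢ 0ℚ → c ℚ.* a ≡ c ℚ.* b → a ≡ b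
ℚ-cancelˡ {c} {a} {b} c≢0 e = trans (sym (lemma a)) (trans (cong ((ℚ.1/ c) ℚ.*_) e) (lemma b))
  where
  instance
    nz : ℚ.NonZero c
    nz = ℚ.≢-nonZero c≢0
  lemma : ∀ x → (ℚ.1/ c) ℚ.* (c ℚ.* x) ≡ x
  lemma x = trans (sym (ℚP.*-assoc (ℚ.1/ c) c x)) (trans (cong (ℚ._* x) (ℚP.*-inverseˡ c)) (ℚP.*-identityˡ x))

ℚ-≢0-* : ∀ {a b} → a ≢ 0ℚ → b ≢ 0ℚ → a ℚ.* b ≢ 0ℚ
ℚ-≢0-* {a} {b} a≢0 b≢0 e = b≢0 (ℚ-cancelˡ a≢0 (trans e (sym (ℚP.*-zeroʳ a))))

÷ℚ-* : ∀ x {y} → y ≢ 0ℚ → y ℚ.* (x ÷ℚ y) ≡ x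
÷ℚ-* x {y} y≢0 with y ℚP.≟ 0ℚ
... | yes y≡0 = contradiction y≡0 y≢0
... | no  y≢0′ = trans (sym (ℚP.*-assoc y x (ℚ.1/ y))) (trans (cong (ℚ._* ℚ.1/ y) (ℚP.*-comm y x))
      (trans (ℚP.*-assoc x y (ℚ.1/ y)) (trans (cong (x ℚ.*_) (ℚP.*-inverseʳ y)) (ℚP.*-identityʳ x))))
  where
  instance
    nz : ℚ.NonZero y
    nz = ℚ.≢-nonZero y≢0′

module _ where
  open +-*-Solver

  ^ℚ-double : ∀ a j → a ^ℚ double j ≡ (a ^ℚ j) ℚ.* (a ^ℚ j)
  ^ℚ-double a zero    = refl
  ^ℚ-double a (suc j) = trans (cong (λ z → a ℚ.* (a ℚ.* z)) (^ℚ-double a j))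
    (solve 2 (λ a z → a :* (a :* (z :* z)) := (a :* z) :* (a :* z)) refl a (a ^ℚ j))

  ^ℚ-distrib-* : ∀ a b n → (a ℚ.* b) ^ℚ n ≡ (a ^ℚ n) ℚ.* (b ^ℚ n)
  ^ℚ-distrib-* a b zero    = refl
  ^ℚ-distrib-* a b (suc n) = trans (cong ((a ℚ.* b) ℚ.*_) (^ℚ-distrib-* a b n))
    (solve 4 (λ a b x y → (a :* b) :* (x :* y) := (a :* x) :* (b :* y)) refl a b (a ^ℚ n) (b ^ℚ n))

  1^ℚ : ∀ n → 1ℚ ^ℚ n ≡ 1ℚ
  1^ℚ zero    = refl
  1^ℚ (suc n) = trans (ℚP.*-identityˡ (1ℚ ^ℚ n)) (1^ℚ n)

  ^ℚ-square : ∀ a j → (a ^ℚ 2) ^ℚ j ≡ a ^ℚ double j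
  ^ℚ-square a zero    = refl
  ^ℚ-square a (suc j) = trans (cong ((a ^ℚ 2) ℚ.*_) (^ℚ-square a j))
    (solve 2 (λ a z → (a :* (a :* con 1ℚ)) :* z := a :* (a :* z)) refl a (a ^ℚ double j))

  qint-geometric : ∀ j q → (q ℚ.- 1ℚ) ℚ.* qint j q ≡ (q ^ℚ j) ℚ.- 1ℚ
  qint-geometric zero    q = solve 1 (λ q → (q :- con 1ℚ) :* con 0ℚ := con 1ℚ :- con 1ℚ) refl q
  qint-geometric (suc j) q = trans (ℚP.*-distribˡ-+ (q ℚ.- 1ℚ) (qint j q) (q ^ℚ j))
    (trans (cong (ℚ._+ (q ℚ.- 1ℚ) ℚ.* (q ^ℚ j)) (qint-geometric j q))
      (solve 2 (λ q z → (z :- con 1ℚ) :+ (q :- con 1ℚ) :* z := q :* z :- con 1ℚ) refl q (q ^ℚ j)))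

  -- `qint` adds its terms at the top; the induction in `U-closed` instead multiplies the sum by q
  -- and adds 1.
  qint-unfoldˡ : ∀ j q → qint (suc j) q ≡ 1ℚ ℚ.+ q ℚ.* qint j q
  qint-unfoldˡ zero    q = solve 1 (λ q → con 0ℚ :+ con 1ℚ := con 1ℚ :+ q :* con 0ℚ) refl q
  qint-unfoldˡ (suc j) q = trans (cong (ℚ._+ (q ℚ.* (q ^ℚ j))) (qint-unfoldˡ j q))
    (solve 3 (λ q a z → (con 1ℚ :+ q :* a) :+ q :* z := con 1ℚ :+ q :* (a :+ z)) refl q (qint j q) (q ^ℚ j))

pw-neg : ∀ p .{{_ : NonZero p}} e → (ι p ^ℚ e) ℚ.* pw p (ℤ.- (+ e)) ≡ 1ℚ
pw-neg p e = trans (cong (ℚ._* pw p (ℤ.- (+ e))) (sym (ι-^ p e))) (ι-*-pw p e)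

-- p^(s(m-3)) is only specified after multiplication by pˢ, which makes the exponent nonnegative for m = 2.
pw-prefactor : ∀ p .{{_ : NonZero p}} s j →
  ι (p ^ s) ℚ.* pw p (+ s ℤ.* (+ suc (suc (double j)) ℤ.- + 3)) ≡ ι (p ^ s) ^ℚ double j
pw-prefactor p s zero = trans (cong₂ ℚ._*_ (ι-^ p s) (cong (pw p) (eq (+ s)))) (pw-neg p s)
  where
  eq : ∀ s → s ℤ.* (ℤ.- (+ 1)) ≡ ℤ.- s
  eq = solve-∀
pw-prefactor p s (suc j) = cong (ι (p ^ s) ℚ.*_) (begin
  pw p (+ s ℤ.* + suc (double j))      ≡⟨ cong (pw p) (sym (ℤP.pos-* s (suc (double j)))) ⟩
  pw p (+ (s * suc (double j)))          ≡⟨ pw-pos p (s * suc (double j)) ⟩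
  ι (p ^ (s * suc (double j)))           ≡⟨ cong ι (sym (ℕP.^-*-assoc p s (suc (double j)))) ⟩
  ι ((p ^ s) ^ suc (double j))       ≡⟨ ι-^ (p ^ s) (suc (double j)) ⟩
  ι (p ^ s) ^ℚ suc (double j)        ∎)
  where open ≡-Reasoning

-- Here k = j + 1, so this is p^(2-k) p^(k-1) = p: the only property of p^(2-k) that `U-closed`
-- requires.
pw-2-k : ∀ p .{{_ : NonZero p}} j → pw p (+ 2 ℤ.- + suc j) ℚ.* (ι p ^ℚ j) ≡ ι p
pw-2-k p zero    = trans (ℚP.*-identityʳ (pw p (+ 1))) (trans (pw-pos p 1) (cong ι (ℕP.^-identityʳ p)))
pw-2-k p (suc j) = begin
  pw p (+ 2 ℤ.- + suc (suc j)) ℚ.* (ι p ℚ.* (ι p ^ℚ j))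
    ≡⟨ cong (λ e → pw p e ℚ.* (ι p ℚ.* (ι p ^ℚ j))) (eq (+ j)) ⟩
  pw p (ℤ.- (+ j)) ℚ.* (ι p ℚ.* (ι p ^ℚ j))
    ≡⟨ rearrange (pw p (ℤ.- (+ j))) (ι p) (ι p ^ℚ j) ⟩
  ι p ℚ.* ((ι p ^ℚ j) ℚ.* pw p (ℤ.- (+ j)))
    ≡⟨ trans (cong (ι p ℚ.*_) (pw-neg p j)) (ℚP.*-identityʳ (ι p)) ⟩
  ι p ∎
  where
  open ≡-Reasoning
  open +-*-Solver
  eq : ∀ j → + 2 ℤ.- (+ 2 ℤ.+ j) ≡ ℤ.- j
  eq = solve-∀
  rearrange : ∀ x p z → x ℚ.* (p ℚ.* z) ≡ p ℚ.* (z ℚ.* x)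
  rearrange = solve 3 (λ x p z → x :* (p :* z) := p :* (z :* x)) refl

-- Closed forms of the recursions

module ClosedForm (p₁ : ℕ) (pr : Prime (suc p₁)) where
  open PrimePower p₁ pr
  open +-*-Solver

  π : ℚ
  π = ι p

  ι-p₁ : ι p₁ ≡ π ℚ.- 1ℚ
  ι-p₁ = trans (solve 1 (λ a → a := (con 1ℚ :+ a) :- con 1ℚ) refl (ι p₁)) (cong (ℚ._- 1ℚ) (sym (trans (ι-+ 1 p₁) (cong (ℚ._+ ι p₁) ι-1))))

  π+1≢0 : π ℚ.+ 1ℚ ≢ 0ℚ
  π+1≢0 e = ι-≢0 (p + 1) (trans (ι-+ p 1) (trans (cong (π ℚ.+_) ι-1) e))

  π-1≢0 : π ℚ.- 1ℚ ≢ 0ℚ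
  π-1≢0 e = contradiction (ι-injective {p₁} {0} (trans ι-p₁ (trans e (sym ι-0)))) (λ { refl → contradiction (prime⇒nonTrivial pr) λ () })

  π²-1 : (π ℚ.- 1ℚ) ℚ.* (π ℚ.+ 1ℚ) ≡ (π ^ℚ 2) ℚ.- 1ℚ
  π²-1 = solve 1 (λ a → (a :- con 1ℚ) :* (a :+ con 1ℚ) := a :* (a :* con 1ℚ) :- con 1ℚ) refl π

  π²-1≢0 : (π ^ℚ 2) ℚ.- 1ℚ ≢ 0ℚ
  π²-1≢0 e = ℚ-≢0-* π-1≢0 π+1≢0 (trans π²-1 e)

  -- With q = p^(t+1) there are q^j - (q/p)^j vectors (aᵢ) not all divisible by p, and q^(j-1)
  -- vectors (bᵢ) for each. The identity is this product cleared of denominators.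
  A-closed : ∀ t j → (π ^ℚ j) ℚ.* (ι (p ^ suc t) ℚ.* ι (A t j)) ≡
                     (ι (p ^ suc t) ^ℚ double j) ℚ.* ((π ^ℚ j) ℚ.- 1ℚ)
  A-closed t zero    = trans (cong (λ a → 1ℚ ℚ.* (ι (p ^ suc t) ℚ.* a)) ι-0)
    (solve 1 (λ y → con 1ℚ :* (y :* con 0ℚ) := con 1ℚ :* (con 1ℚ :- con 1ℚ)) refl (ι (p ^ suc t)))
  A-closed t (suc j) = begin
    (π ℚ.* z) ℚ.* (Y ℚ.* ι (A t (suc j)))
      ≡⟨ cong (λ w → (π ℚ.* z) ℚ.* (Y ℚ.* w)) unfold ⟩
    (π ℚ.* z) ℚ.* (Y ℚ.* (y ℚ.* (Y ℚ.* a) ℚ.+ (π ℚ.- 1ℚ) ℚ.* (y ℚ.* W)))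
      ≡⟨ solve 6 (λ π z y Y a W → (π :* z) :* (Y :* (y :* (Y :* a) :+ (π :- con 1ℚ) :* (y :* W)))
           := (π :* y) :* (Y :* (z :* (Y :* a)) :+ z :* Y :* (π :- con 1ℚ) :* W)) refl π z y Y a W ⟩
    (π ℚ.* y) ℚ.* (Y ℚ.* (z ℚ.* (Y ℚ.* a)) ℚ.+ z ℚ.* Y ℚ.* (π ℚ.- 1ℚ) ℚ.* W)
      ≡⟨ cong₂ (λ b c → b ℚ.* (Y ℚ.* c ℚ.+ z ℚ.* Y ℚ.* (π ℚ.- 1ℚ) ℚ.* W)) (sym (ι-* p (p ^ t))) (A-closed t j) ⟩
    Y ℚ.* (Y ℚ.* (W ℚ.* (z ℚ.- 1ℚ)) ℚ.+ z ℚ.* Y ℚ.* (π ℚ.- 1ℚ) ℚ.* W)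
      ≡⟨ solve 4 (λ π z Y W → Y :* (Y :* (W :* (z :- con 1ℚ)) :+ z :* Y :* (π :- con 1ℚ) :* W)
           := (Y :* (Y :* W)) :* (π :* z :- con 1ℚ)) refl π z Y W ⟩
    (Y ℚ.* (Y ℚ.* W)) ℚ.* (π ℚ.* z ℚ.- 1ℚ) ∎
    where
    open ≡-Reasoning
    z y Y a W : ℚ
    z = π ^ℚ j
    y = ι (p ^ t)
    Y = ι (p ^ suc t)
    a = ι (A t j)
    W = Y ^ℚ double j
    unfold : ι (A t (suc j)) ≡ y ℚ.* (Y ℚ.* a) ℚ.+ (π ℚ.- 1ℚ) ℚ.* (y ℚ.* W)
    unfold = trans (ι-+ (p ^ t * (p ^ suc t * A t j)) _) (cong₂ ℚ._+_
      (trans (ι-* (p ^ t) _) (cong (y ℚ.*_) (ι-* (p ^ suc t) (A t j))))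
      (trans (ι-* p₁ _) (cong₂ ℚ._*_ ι-p₁ (trans (ι-* (p ^ t) _) (cong (y ℚ.*_)
        (trans (ι-^ (p ^ suc t * p ^ suc t) j) (trans (cong (_^ℚ j) (ι-* (p ^ suc t) (p ^ suc t)))
          (trans (^ℚ-distrib-* Y Y j) (sym (^ℚ-double Y j))))))))))

  U-zero-level : ∀ j w → U 0 j w ≡ 1
  U-zero-level zero    w = [∣]-yes {1} (divides w (sym (ℤP.*-identityʳ w)))
  U-zero-level (suc j) w = trans (ℕP.+-identityʳ _) (trans (ℕP.+-identityʳ _) (U-zero-level j _))

  -- The variable x stands for p^(1-j), specified without negative powers. `U-multiple` at w = 0
  -- shows that each further power of p multiplies the geometric sum by x and adds 1, so s powers
  -- give [s] at x.
  U-closed : ∀ s j x → x ℚ.* (π ^ℚ j) ≡ π →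
             ι (p ^ s) ℚ.* ((π ^ℚ j) ℚ.* ι (U s j (+ 0))) ≡
             (ι (p ^ s) ^ℚ double j) ℚ.* ((π ℚ.- 1ℚ) ℚ.* qint s x ℚ.+ (π ^ℚ j))
  U-closed zero    j x hx = trans (cong₂ (λ a u → a ℚ.* ((π ^ℚ j) ℚ.* u)) ι-1 (trans (cong ι (U-zero-level j (+ 0))) ι-1))
    (trans (solve 2 (λ π z → con 1ℚ :* (z :* con 1ℚ) := con 1ℚ :* ((π :- con 1ℚ) :* con 0ℚ :+ z)) refl π (π ^ℚ j))
      (cong (ℚ._* ((π ℚ.- 1ℚ) ℚ.* 0ℚ ℚ.+ (π ^ℚ j))) (sym (trans (cong (_^ℚ double j) ι-1) (1^ℚ (double j))))))
  U-closed (suc t) j x hx = begin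
    Y ℚ.* (z ℚ.* ι (U (suc t) j (+ 0)))
      ≡⟨ cong (λ w → Y ℚ.* (z ℚ.* w)) unfold ⟩
    Y ℚ.* (z ℚ.* (a ℚ.+ z ℚ.* u))
      ≡⟨ solve 4 (λ Y z a u → Y :* (z :* (a :+ z :* u)) := z :* (Y :* a) :+ Y :* z :* (z :* u)) refl Y z a u ⟩
    z ℚ.* (Y ℚ.* a) ℚ.+ Y ℚ.* z ℚ.* (z ℚ.* u)
      ≡⟨ cong₂ (λ b c → b ℚ.+ c ℚ.* z ℚ.* (z ℚ.* u)) (A-closed t j) (ι-* p (p ^ t)) ⟩
    W ℚ.* (z ℚ.- 1ℚ) ℚ.+ (π ℚ.* y) ℚ.* z ℚ.* (z ℚ.* u)
      ≡⟨ solve 6 (λ W π y z u o → W :* (z :- o) :+ (π :* y) :* z :* (z :* u)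
            := W :* (z :- o) :+ π :* z :* (y :* (z :* u))) refl W π y z u 1ℚ ⟩
    W ℚ.* (z ℚ.- 1ℚ) ℚ.+ π ℚ.* z ℚ.* (y ℚ.* (z ℚ.* u))
      ≡⟨ cong₂ (λ b c → b ℚ.* (z ℚ.- 1ℚ) ℚ.+ π ℚ.* z ℚ.* c) W≡ (U-closed t j x hx) ⟩
    (z ℚ.* z ℚ.* w) ℚ.* (z ℚ.- 1ℚ) ℚ.+ π ℚ.* z ℚ.* (w ℚ.* ((π ℚ.- 1ℚ) ℚ.* g ℚ.+ z))
      ≡⟨ solve 4 (λ π z w g → (z :* z :* w) :* (z :- con 1ℚ) :+ π :* z :* (w :* ((π :- con 1ℚ) :* g :+ z))
           := (z :* z :* w) :* ((π :- con 1ℚ) :+ z) :+ z :* w :* (π :- con 1ℚ) :* (g :* π)) refl π z w g ⟩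
    (z ℚ.* z ℚ.* w) ℚ.* ((π ℚ.- 1ℚ) ℚ.+ z) ℚ.+ z ℚ.* w ℚ.* (π ℚ.- 1ℚ) ℚ.* (g ℚ.* π)
      -- Rewriting p as x p^j produces the factor x in front of the sum already obtained.
      ≡⟨ cong (λ b → (z ℚ.* z ℚ.* w) ℚ.* ((π ℚ.- 1ℚ) ℚ.+ z) ℚ.+ z ℚ.* w ℚ.* (π ℚ.- 1ℚ) ℚ.* (g ℚ.* b)) (sym hx) ⟩
    (z ℚ.* z ℚ.* w) ℚ.* ((π ℚ.- 1ℚ) ℚ.+ z) ℚ.+ z ℚ.* w ℚ.* (π ℚ.- 1ℚ) ℚ.* (g ℚ.* (x ℚ.* z))
      ≡⟨ solve 5 (λ π z w g x → (z :* z :* w) :* ((π :- con 1ℚ) :+ z) :+ z :* w :* (π :- con 1ℚ) :* (g :* (x :* z))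
           := (z :* z :* w) :* ((π :- con 1ℚ) :* (con 1ℚ :+ x :* g) :+ z)) refl π z w g x ⟩
    (z ℚ.* z ℚ.* w) ℚ.* ((π ℚ.- 1ℚ) ℚ.* (1ℚ ℚ.+ x ℚ.* g) ℚ.+ z)
      ≡⟨ cong₂ (λ b c → b ℚ.* ((π ℚ.- 1ℚ) ℚ.* c ℚ.+ z)) (sym W≡) (sym (qint-unfoldˡ t x)) ⟩
    W ℚ.* ((π ℚ.- 1ℚ) ℚ.* qint (suc t) x ℚ.+ z) ∎
    where
    open ≡-Reasoning
    z y Y a u w W g : ℚ
    z = π ^ℚ j
    y = ι (p ^ t)
    Y = ι (p ^ suc t)
    a = ι (A t j)
    u = ι (U t j (+ 0))
    w = y ^ℚ double j
    W = Y ^ℚ double j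
    g = qint t x
    W≡ : W ≡ z ℚ.* z ℚ.* w
    W≡ = trans (cong (_^ℚ double j) (ι-* p (p ^ t))) (trans (^ℚ-distrib-* π y (double j)) (cong (ℚ._* w) (^ℚ-double π j)))
    unfold : ι (U (suc t) j (+ 0)) ≡ a ℚ.+ z ℚ.* u
    unfold = trans (cong ι (trans (cong (U (suc t) j) (sym (ℤP.*-zeroʳ (+ p)))) (U-multiple t j (+ 0))))
      (trans (ι-+ (A t j) _) (cong (a ℚ.+_) (trans (ι-* (p ^ j) _) (cong (ℚ._* u) (ι-^ p j)))))

  module _ (s : ℕ) where
    open Level p₁ pr s

    y : ℚ
    y = ι q′

    y≢0 : y ≢ 0ℚ
    y≢0 = ι-≢0 q′ {{p^≢0 s}}

    σ : ℕ → ℚ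
    σ zero    = 1ℚ
    σ (suc l) = ℚ.- σ l

    σ-double : ∀ j → σ (double j) ≡ 1ℚ
    σ-double zero    = refl
    σ-double (suc j) = trans (solve 1 (λ a → :- (:- a) := a) refl (σ (double j))) (σ-double j)

    ι-q′q* : ∀ a → ι (q′ * (q * a)) ≡ y ℚ.* ((π ℚ.* y) ℚ.* ι a)
    ι-q′q* a = trans (ι-* q′ (q * a)) (cong (y ℚ.*_) (trans (ι-* q a) (cong (ℚ._* ι a) (ι-* p q′))))

    -- The characteristic roots of `H-suc-suc` are p q′ and -q′; the values at 0 and 1 give them the
    -- coefficients p/(p+1) and 1/(p+1).
    H-closed : ∀ l → (π ℚ.+ 1ℚ) ℚ.* ι (H l) ≡ (y ^ℚ l) ℚ.* (π ℚ.* (π ^ℚ l) ℚ.+ σ l)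
    H-closed zero = trans (cong ((π ℚ.+ 1ℚ) ℚ.*_) (trans (cong ι H-zero) ι-1))
      (solve 1 (λ π → (π :+ con 1ℚ) :* con 1ℚ := con 1ℚ :* (π :* con 1ℚ :+ con 1ℚ)) refl π)
    H-closed (suc zero) = trans (cong ((π ℚ.+ 1ℚ) ℚ.*_) (trans (cong ι H-one) (trans (ι-* p₁ q′) (cong (ℚ._* y) ι-p₁))))
      (solve 2 (λ π y → (π :+ con 1ℚ) :* ((π :- con 1ℚ) :* y) := (y :* con 1ℚ) :* (π :* (π :* con 1ℚ) :+ (:- con 1ℚ))) refl π y)
    H-closed (suc (suc l)) = begin
      (π ℚ.+ 1ℚ) ℚ.* ι (H (suc (suc l)))
        ≡⟨ cong ((π ℚ.+ 1ℚ) ℚ.*_) unfold ⟩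
      (π ℚ.+ 1ℚ) ℚ.* ((π ℚ.- 1ℚ) ℚ.* (y ℚ.* h₁) ℚ.+ y ℚ.* ((π ℚ.* y) ℚ.* h₀))
        ≡⟨ solve 4 (λ π y h₁ h₀ → (π :+ con 1ℚ) :* ((π :- con 1ℚ) :* (y :* h₁) :+ y :* ((π :* y) :* h₀))
             := (π :- con 1ℚ) :* (y :* ((π :+ con 1ℚ) :* h₁)) :+ y :* ((π :* y) :* ((π :+ con 1ℚ) :* h₀))) refl π y h₁ h₀ ⟩
      (π ℚ.- 1ℚ) ℚ.* (y ℚ.* ((π ℚ.+ 1ℚ) ℚ.* h₁)) ℚ.+ y ℚ.* ((π ℚ.* y) ℚ.* ((π ℚ.+ 1ℚ) ℚ.* h₀))
        ≡⟨ cong₂ (λ b c → (π ℚ.- 1ℚ) ℚ.* (y ℚ.* b) ℚ.+ y ℚ.* ((π ℚ.* y) ℚ.* c)) (H-closed (suc l)) (H-closed l) ⟩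
      (π ℚ.- 1ℚ) ℚ.* (y ℚ.* ((y ℚ.* w) ℚ.* (π ℚ.* (π ℚ.* z) ℚ.+ ℚ.- σ l))) ℚ.+ y ℚ.* ((π ℚ.* y) ℚ.* (w ℚ.* (π ℚ.* z ℚ.+ σ l)))
        ≡⟨ solve 5 (λ π y w z e → (π :- con 1ℚ) :* (y :* ((y :* w) :* (π :* (π :* z) :+ :- e))) :+ y :* ((π :* y) :* (w :* (π :* z :+ e)))
             := (y :* (y :* w)) :* (π :* (π :* (π :* z)) :+ :- (:- e))) refl π y w z (σ l) ⟩
      (y ℚ.* (y ℚ.* w)) ℚ.* (π ℚ.* (π ℚ.* (π ℚ.* z)) ℚ.+ ℚ.- (ℚ.- σ l)) ∎
      where
      open ≡-Reasoning
      h₀ h₁ w z : ℚ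
      h₀ = ι (H l)
      h₁ = ι (H (suc l))
      w = y ^ℚ l
      z = π ^ℚ l
      unfold : ι (H (suc (suc l))) ≡ (π ℚ.- 1ℚ) ℚ.* (y ℚ.* h₁) ℚ.+ y ℚ.* ((π ℚ.* y) ℚ.* h₀)
      unfold = trans (cong ι (H-suc-suc l)) (trans (ι-+ (p₁ * (q′ * H (suc l))) _) (cong₂ ℚ._+_
        (trans (ι-* p₁ _) (cong₂ ℚ._*_ ι-p₁ (ι-* q′ (H (suc l)))))
        (ι-q′q* (H l))))

    odd-closed : ∀ j → ι (odd-value j) ≡ (y ^ℚ double j) ℚ.* qint (suc j) (π ^ℚ 2)
    odd-closed zero    = ι-1
    odd-closed (suc j) = ℚ-cancelˡ π+1≢0 (begin
      (π ℚ.+ 1ℚ) ℚ.* ι (odd-value (suc j))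
        ≡⟨ cong ((π ℚ.+ 1ℚ) ℚ.*_) (trans (ι-+ (H (suc (suc (double j)))) _) (cong (ι (H (suc (suc (double j)))) ℚ.+_)
             (trans (ι-q′q* (odd-value j)) (cong (λ b → y ℚ.* ((π ℚ.* y) ℚ.* b)) (odd-closed j))))) ⟩
      (π ℚ.+ 1ℚ) ℚ.* (ι (H (suc (suc (double j)))) ℚ.+ y ℚ.* ((π ℚ.* y) ℚ.* (w ℚ.* g)))
        ≡⟨ trans (ℚP.*-distribˡ-+ (π ℚ.+ 1ℚ) (ι (H (suc (suc (double j))))) _)
             (cong (ℚ._+ (π ℚ.+ 1ℚ) ℚ.* (y ℚ.* ((π ℚ.* y) ℚ.* (w ℚ.* g)))) (H-closed (suc (suc (double j))))) ⟩
      (y ℚ.* (y ℚ.* w)) ℚ.* (π ℚ.* (π ^ℚ suc (suc (double j))) ℚ.+ σ (double (suc j))) ℚ.+ (π ℚ.+ 1ℚ) ℚ.* (y ℚ.* ((π ℚ.* y) ℚ.* (w ℚ.* g)))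
        ≡⟨ cong₂ (λ b c → (y ℚ.* (y ℚ.* w)) ℚ.* (π ℚ.* b ℚ.+ c) ℚ.+ (π ℚ.+ 1ℚ) ℚ.* (y ℚ.* ((π ℚ.* y) ℚ.* (w ℚ.* g))))
             (sym (^ℚ-square π (suc j))) (σ-double (suc j)) ⟩
      (y ℚ.* (y ℚ.* w)) ℚ.* (π ℚ.* z ℚ.+ 1ℚ) ℚ.+ (π ℚ.+ 1ℚ) ℚ.* (y ℚ.* ((π ℚ.* y) ℚ.* (w ℚ.* g)))
        -- The part in the inner bracket vanishes by the geometric series; splitting it off leaves a
        -- multiple of p + 1.
        ≡⟨ solve 5 (λ π y w z g → (y :* (y :* w)) :* (π :* z :+ con 1ℚ) :+ (π :+ con 1ℚ) :* (y :* ((π :* y) :* (w :* g)))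
             := (y :* (y :* w)) :* ((π :+ con 1ℚ) :* (g :+ z) :+ ((π :* (π :* con 1ℚ) :- con 1ℚ) :* g :- (z :- con 1ℚ)))) refl π y w z g ⟩
      (y ℚ.* (y ℚ.* w)) ℚ.* ((π ℚ.+ 1ℚ) ℚ.* (g ℚ.+ z) ℚ.+ (((π ^ℚ 2) ℚ.- 1ℚ) ℚ.* g ℚ.- (z ℚ.- 1ℚ)))
        ≡⟨ cong (λ b → (y ℚ.* (y ℚ.* w)) ℚ.* ((π ℚ.+ 1ℚ) ℚ.* (g ℚ.+ z) ℚ.+ (b ℚ.- (z ℚ.- 1ℚ)))) (qint-geometric (suc j) (π ^ℚ 2)) ⟩
      (y ℚ.* (y ℚ.* w)) ℚ.* ((π ℚ.+ 1ℚ) ℚ.* (g ℚ.+ z) ℚ.+ ((z ℚ.- 1ℚ) ℚ.- (z ℚ.- 1ℚ)))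
        ≡⟨ solve 4 (λ π v z g → v :* ((π :+ con 1ℚ) :* (g :+ z) :+ ((z :- con 1ℚ) :- (z :- con 1ℚ)))
             := (π :+ con 1ℚ) :* (v :* (g :+ z))) refl π (y ℚ.* (y ℚ.* w)) z g ⟩
      (π ℚ.+ 1ℚ) ℚ.* ((y ℚ.* (y ℚ.* w)) ℚ.* (g ℚ.+ z)) ∎)
      where
      open ≡-Reasoning
      w z g : ℚ
      w = y ^ℚ double j
      z = (π ^ℚ 2) ^ℚ suc j
      g = qint (suc j) (π ^ℚ 2)

    -- After division by p^2 - 1 the right-hand factor is p - 1 times the Gaussian binomial (k over
    -- 2) at p, with k = j + 1. The factor y = p^s on the left keeps the exponent s(m-3) = s(2j-1)
    -- out of the negative range at j = 0.
    X-closed : ∀ j → ((π ^ℚ 2) ℚ.- 1ℚ) ℚ.* (y ℚ.* ι (X j)) ≡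
                     (y ^ℚ double j) ℚ.* (((π ^ℚ suc j) ℚ.- 1ℚ) ℚ.* ((π ^ℚ j) ℚ.- 1ℚ))
    X-closed zero    = trans (cong (λ x → ((π ^ℚ 2) ℚ.- 1ℚ) ℚ.* (y ℚ.* x)) ι-0) (solve 2 (λ π y → (π :* (π :* con 1ℚ) :- con 1ℚ) :* (y :* con 0ℚ)
                         := con 1ℚ :* ((π :* con 1ℚ :- con 1ℚ) :* (con 1ℚ :- con 1ℚ))) refl π y)
    X-closed (suc j) = begin
      ((π ^ℚ 2) ℚ.- 1ℚ) ℚ.* (y ℚ.* ι (X (suc j)))
        ≡⟨ cong (λ b → ((π ^ℚ 2) ℚ.- 1ℚ) ℚ.* (y ℚ.* b)) (trans (ι-+ (H (suc (double j))) _) (cong (h₁ ℚ.+_) (ι-q′q* (X j)))) ⟩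
      ((π ^ℚ 2) ℚ.- 1ℚ) ℚ.* (y ℚ.* (h₁ ℚ.+ y ℚ.* ((π ℚ.* y) ℚ.* x)))
        ≡⟨ solve 4 (λ π y h₁ x → (π :* (π :* con 1ℚ) :- con 1ℚ) :* (y :* (h₁ :+ y :* ((π :* y) :* x)))
             := y :* (π :- con 1ℚ) :* ((π :+ con 1ℚ) :* h₁) :+ y :* (y :* π) :* ((π :* (π :* con 1ℚ) :- con 1ℚ) :* (y :* x))) refl π y h₁ x ⟩
      y ℚ.* (π ℚ.- 1ℚ) ℚ.* ((π ℚ.+ 1ℚ) ℚ.* h₁) ℚ.+ y ℚ.* (y ℚ.* π) ℚ.* (((π ^ℚ 2) ℚ.- 1ℚ) ℚ.* (y ℚ.* x))
        ≡⟨ cong₂ (λ b c → y ℚ.* (π ℚ.- 1ℚ) ℚ.* b ℚ.+ y ℚ.* (y ℚ.* π) ℚ.* c) (H-closed (suc (double j))) (X-closed j) ⟩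
      y ℚ.* (π ℚ.- 1ℚ) ℚ.* ((y ℚ.* w) ℚ.* (π ℚ.* (π ℚ.* (π ^ℚ double j)) ℚ.+ ℚ.- σ (double j)))
        ℚ.+ y ℚ.* (y ℚ.* π) ℚ.* (w ℚ.* ((π ℚ.* z ℚ.- 1ℚ) ℚ.* (z ℚ.- 1ℚ)))
        ≡⟨ cong₂ (λ b c → y ℚ.* (π ℚ.- 1ℚ) ℚ.* ((y ℚ.* w) ℚ.* (π ℚ.* (π ℚ.* b) ℚ.+ ℚ.- c))
             ℚ.+ y ℚ.* (y ℚ.* π) ℚ.* (w ℚ.* ((π ℚ.* z ℚ.- 1ℚ) ℚ.* (z ℚ.- 1ℚ)))) (^ℚ-double π j) (σ-double j) ⟩
      y ℚ.* (π ℚ.- 1ℚ) ℚ.* ((y ℚ.* w) ℚ.* (π ℚ.* (π ℚ.* (z ℚ.* z)) ℚ.+ ℚ.- 1ℚ))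
        ℚ.+ y ℚ.* (y ℚ.* π) ℚ.* (w ℚ.* ((π ℚ.* z ℚ.- 1ℚ) ℚ.* (z ℚ.- 1ℚ)))
        ≡⟨ solve 4 (λ π y w z → y :* (π :- con 1ℚ) :* ((y :* w) :* (π :* (π :* (z :* z)) :+ :- con 1ℚ))
               :+ y :* (y :* π) :* (w :* ((π :* z :- con 1ℚ) :* (z :- con 1ℚ)))
             := (y :* (y :* w)) :* ((π :* (π :* z) :- con 1ℚ) :* (π :* z :- con 1ℚ))) refl π y w z ⟩
      (y ℚ.* (y ℚ.* w)) ℚ.* ((π ℚ.* (π ℚ.* z) ℚ.- 1ℚ) ℚ.* (π ℚ.* z ℚ.- 1ℚ)) ∎
      where
      open ≡-Reasoning
      h₁ x w z : ℚ
      h₁ = ι (H (suc (double j)))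
      x = ι (X j)
      w = y ^ℚ double j
      z = π ^ℚ j

-- The count modulo a prime power

parity : ∀ l → Σ ℕ λ j → (l ≡ double j) ⊎ (l ≡ suc (double j))
parity zero = 0 , inj₁ refl
parity (suc l) with parity l
... | j , inj₁ refl = j , inj₂ refl
... | j , inj₂ refl = suc j , inj₁ refl

double≡*2 : ∀ k → double k ≡ k * 2
double≡*2 zero    = refl
double≡*2 (suc k) = cong (λ z → suc (suc z)) (double≡*2 k)

double/2 : ∀ k → double k ℕ./ 2 ≡ k
double/2 k = trans (cong (ℕ._/ 2) (double≡*2 k)) (DivMod.m*n/n≡m k 2)

[1+double]/2 : ∀ k → suc (double k) ℕ./ 2 ≡ k
[1+double]/2 k = trans (cong (λ z → suc z ℕ./ 2) (double≡*2 k))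
  (trans (DivMod.+-distrib-/-∣ʳ 1 {k * 2} {2} (ℕD.divides k refl)) (DivMod.m*n/n≡m k 2))

isEven-double : ∀ k → isEven (double k) ≡ true
isEven-double k = dec-true (double k ℕ.% 2 ℕP.≟ 0) (trans (cong (ℕ._% 2) (double≡*2 k)) (DivMod.m*n%n≡0 k 2))

isEven-1+double : ∀ k → isEven (suc (double k)) ≡ false
isEven-1+double k = dec-false (suc (double k) ℕ.% 2 ℕP.≟ 0) (λ e → contradiction
  (trans (sym (DivMod.[m+kn]%n≡m%n 1 k 2)) (trans (cong (λ z → suc z ℕ.% 2) (sym (double≡*2 k))) e)) λ ())

if-true : ∀ {b} {x y : ℚ} → b ≡ true → (if b then x else y) ≡ x
if-true refl = refl

if-false : ∀ {b} {x y : ℚ} → b ≡ false → (if b then x else y) ≡ y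
if-false refl = refl

-- The branches of Φ with prefactor and prime as variables, so that the opaque `pw` and `ι` can be
-- put in their place.
oddForm : (pre π : ℚ) → ℕ → ℚ
oddForm pre π k = pre ℚ.* qint k (π ^ℚ 2)

evenForm : (pre π : ℚ) → ℕ → ℚ
evenForm pre π k = pre ℚ.* ((π ℚ.- 1ℚ) ℚ.* qbinom2 k π)

evenForm₂ : (pre π : ℚ) → ℕ → ℚ
evenForm₂ pre π k = pre ℚ.* ((π ℚ.- 1ℚ) ℚ.* qbinom2 k π ℚ.+ ((π ^ℚ (k ∸ 1)) ℚ.- 1ℚ))

otherwiseForm : ℕ → (pre π x : ℚ) → ℕ → ℚ
otherwiseForm s pre π x k = pre ℚ.* ((π ℚ.- 1ℚ) ℚ.* (qbinom2 k π ℚ.+ qint s x) ℚ.+ (π ^ℚ (k ∸ 1)))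

abstract
  Φ′ : (m p r : ℕ) .{{_ : NonZero p}} → ℚ
  Φ′ = Φ

  Φ′≡Φ : ∀ m p r .{{_ : NonZero p}} → Φ′ m p r ≡ Φ m p r
  Φ′≡Φ m p r = refl

module _ (m p s k : ℕ) .{{_ : NonZero p}} (m/2≡k : m ℕ./ 2 ≡ k) where

  prefactor : ℚ
  prefactor = pw p (+ s ℤ.* (+ m ℤ.- + 3))

  private
    isEven-m/2 : ∀ {b} → isEven k ≡ b → isEven (m ℕ./ 2) ≡ b
    isEven-m/2 e = trans (cong isEven m/2≡k) e

    form≡ : (f : ℚ → ℚ → ℕ → ℚ) → f (powℤ p (+ s ℤ.* (+ m ℤ.- + 3))) (fromℕ p) (m ℕ./ 2) ≡ f prefactor (ι p) k
    form≡ f = trans (cong (f _ _) m/2≡k)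
      (cong₂ (λ a b → f a b k) (sym (pw≡powℤ p (+ s ℤ.* (+ m ℤ.- + 3)))) (sym (ι≡fromℕ p)))

    otherwise≡ : otherwiseForm s (powℤ p (+ s ℤ.* (+ m ℤ.- + 3))) (fromℕ p) (powℤ p (+ 2 ℤ.- + (m ℕ./ 2))) (m ℕ./ 2) ≡
                 otherwiseForm s prefactor (ι p) (pw p (+ 2 ℤ.- + k)) k
    otherwise≡ = trans (cong (λ x → otherwiseForm s (powℤ p (+ s ℤ.* (+ m ℤ.- + 3))) (fromℕ p) x (m ℕ./ 2))
        (trans (sym (pw≡powℤ p (+ 2 ℤ.- + (m ℕ./ 2)))) (cong (λ k → pw p (+ 2 ℤ.- + k)) m/2≡k)))
      (form≡ (λ a b → otherwiseForm s a b (pw p (+ 2 ℤ.- + k))))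

  Φ-odd : isEven m ≡ false → Φ′ m p (suc s) ≡ oddForm prefactor (ι p) k
  Φ-odd e = trans (Φ′≡Φ m p (suc s)) (trans (if-false e) (form≡ oddForm))

  Φ-even-odd : isEven m ≡ true → isEven k ≡ false →
    Φ′ m p (suc s) ≡ otherwiseForm s prefactor (ι p) (pw p (+ 2 ℤ.- + k)) k
  Φ-even-odd e e′ = trans (Φ′≡Φ m p (suc s)) (trans (if-true e) (trans (if-false (isEven-m/2 e′)) otherwise≡))

  Φ-even-even : isEven m ≡ true → isEven k ≡ true → p ≢ 2 → Φ′ m p (suc s) ≡ evenForm prefactor (ι p) k
  Φ-even-even e e′ p≢2 = trans (Φ′≡Φ m p (suc s)) (trans (if-true e) (trans (if-true (isEven-m/2 e′))
    (trans (if-false (dec-false (p ℕP.≟ 2) p≢2)) (form≡ evenForm))))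

  Φ-even-even-2-1 : isEven m ≡ true → isEven k ≡ true → p ≡ 2 → s ≡ 0 →
    Φ′ m p (suc s) ≡ otherwiseForm s prefactor (ι p) (pw p (+ 2 ℤ.- + k)) k
  Φ-even-even-2-1 e e′ p≡2 s≡0 = trans (Φ′≡Φ m p (suc s)) (trans (if-true e) (trans (if-true (isEven-m/2 e′))
    (trans (if-true (dec-true (p ℕP.≟ 2) p≡2)) (trans (if-true (dec-true (suc s ℕP.≟ 1) (cong suc s≡0))) otherwise≡))))

  Φ-even-even-2 : isEven m ≡ true → isEven k ≡ true → p ≡ 2 → s ≢ 0 → Φ′ m p (suc s) ≡ evenForm₂ prefactor (ι p) k
  Φ-even-even-2 e e′ p≡2 s≢0 = trans (Φ′≡Φ m p (suc s)) (trans (if-true e) (trans (if-true (isEven-m/2 e′))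
    (trans (if-true (dec-true (p ℕP.≟ 2) p≡2))
      (trans (if-false (dec-false (suc s ℕP.≟ 1) (s≢0 ∘ ℕP.suc-injective))) (form≡ evenForm₂)))))

module PrimePowerCount (p₁ : ℕ) (pr : Prime (suc p₁)) (s : ℕ) where
  open PrimePower p₁ pr
  open Level p₁ pr s
  open ClosedForm p₁ pr hiding (y; y≢0; X-closed; odd-closed)
  open +-*-Solver

  private
    y : ℚ
    y = ClosedForm.y p₁ pr s

  module Even (j : ℕ) where

    pre : ℚ
    pre = pw p (+ s ℤ.* (+ suc (suc (double j)) ℤ.- + 3))

    -- Cancels the factor p^s that the closed forms carry and so brings in the possibly fractional
    -- prefactor of Φ.
    prefactored : ∀ {N R} → y ℚ.* ι N ≡ (y ^ℚ double j) ℚ.* R → ι N ≡ pre ℚ.* R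
    prefactored {N} {R} e = ℚ-cancelˡ (ClosedForm.y≢0 p₁ pr s)
      (trans e (trans (cong (ℚ._* R) (sym (pw-prefactor p s j))) (ℚP.*-assoc y pre R)))

    X-value : ι (X j) ≡ pre ℚ.* ((π ℚ.- 1ℚ) ℚ.* qbinom2 (suc j) π)
    X-value = prefactored {X j} (ℚ-cancelˡ π²-1≢0 (begin
      ((π ^ℚ 2) ℚ.- 1ℚ) ℚ.* (y ℚ.* ι (X j))
        ≡⟨ ClosedForm.X-closed p₁ pr s j ⟩
      w ℚ.* (((π ^ℚ suc j) ℚ.- 1ℚ) ℚ.* ((π ^ℚ j) ℚ.- 1ℚ))
        ≡⟨ cong (w ℚ.*_) (sym (÷ℚ-* (((π ^ℚ suc j) ℚ.- 1ℚ) ℚ.* ((π ^ℚ j) ℚ.- 1ℚ)) (ℚ-≢0-* π-1≢0 π²-1≢0))) ⟩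
      w ℚ.* (((π ℚ.- 1ℚ) ℚ.* ((π ^ℚ 2) ℚ.- 1ℚ)) ℚ.* b)
        ≡⟨ solve 4 (λ w a c b → w :* ((a :* c) :* b) := c :* (w :* (a :* b))) refl w (π ℚ.- 1ℚ) ((π ^ℚ 2) ℚ.- 1ℚ) b ⟩
      ((π ^ℚ 2) ℚ.- 1ℚ) ℚ.* (w ℚ.* ((π ℚ.- 1ℚ) ℚ.* b)) ∎))
      where
      open ≡-Reasoning
      w b : ℚ
      w = y ^ℚ double j
      b = qbinom2 (suc j) π

    even-value : ∀ {R} → y ℚ.* ι (P j (+ 1)) ≡ (y ^ℚ double j) ℚ.* R →
                 ι (h (double j) (+ 1)) ≡ pre ℚ.* ((π ℚ.- 1ℚ) ℚ.* qbinom2 (suc j) π ℚ.+ R)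
    even-value {R} e = begin
      ι (h (double j) (+ 1))                                     ≡⟨ cong ι (h-even j p∤1) ⟩
      ι (X j + P j (+ 1))                                        ≡⟨ ι-+ (X j) (P j (+ 1)) ⟩
      ι (X j) ℚ.+ ι (P j (+ 1))                              ≡⟨ cong₂ ℚ._+_ X-value (prefactored {P j (+ 1)} e) ⟩
      pre ℚ.* ((π ℚ.- 1ℚ) ℚ.* qbinom2 (suc j) π) ℚ.+ pre ℚ.* R        ≡⟨ ℚP.*-distribˡ-+ pre _ R ⟨
      pre ℚ.* ((π ℚ.- 1ℚ) ℚ.* qbinom2 (suc j) π ℚ.+ R)                ∎
      where open ≡-Reasoning

    ι-P : ∀ {u} → P j (+ 1) ≡ p ^ j * u → y ℚ.* ι (P j (+ 1)) ≡ y ℚ.* ((π ^ℚ j) ℚ.* ι u)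
    ι-P {u} e = cong (y ℚ.*_) (trans (cong ι e) (trans (ι-* (p ^ j) u) (cong (ℚ._* ι u) (ι-^ p j))))

    m/2 : suc (suc (double j)) ℕ./ 2 ≡ suc j
    m/2 = double/2 (suc j)

    otherwise-value : P j (+ 1) ≡ p ^ j * U s j (+ 0) →
                      ι (h (double j) (+ 1)) ≡ otherwiseForm s pre π (pw p (+ 2 ℤ.- + suc j)) (suc j)
    otherwise-value e = trans (even-value (trans (ι-P e) (U-closed s j x (pw-2-k p j))))
      (cong (pre ℚ.*_) (solve 4 (λ a b c d → a :* b :+ (a :* c :+ d) := a :* (b :+ c) :+ d) refl
        (π ℚ.- 1ℚ) (qbinom2 (suc j) π) (qint s x) (π ^ℚ j)))
      where
      x : ℚ
      x = pw p (+ 2 ℤ.- + suc j)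

  ε-double : ∀ i → ε (double i) ≡ + 1
  ε-double zero    = refl
  ε-double (suc i) = trans (ℤP.neg-involutive (ε (double i))) (ε-double i)

  p∤2 : p ≢ 2 → Unit (+ 2)
  p∤2 p≢2 d with prime⇒irreducible prime[2] (∣⇒∣ᵤ d)
  ... | inj₁ p≡1 = contradiction (prime⇒nonTrivial (subst Prime p≡1 pr)) λ ()
  ... | inj₂ p≡2 = p≢2 p≡2

  -- For j odd the sign is -1, and 1 = 2 w - 1 has the solution w = 1.
  2-unit-value : ∀ i → p ≡ 2 → + p ℤ.* + 1 ℤ.+ ε (suc (double i)) ≡ + 1
  2-unit-value i p≡2 = cong₂ (λ a b → + a ℤ.* + 1 ℤ.+ ℤ.- b) p≡2 (ε-double i)

  -- The copy `s′` with its equation permits a case distinction on the module parameter `s`. For s =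
  -- 0 the equation of `U` is modulo 1, so w = 1 may be replaced by 0; for s > 0 the value w = 1 is
  -- prime to p and `U-unit` applies.
  s-cases : ∀ i → p ≡ 2 → (s′ : ℕ) → s ≡ s′ →
            ι (h (double (suc (double i))) (+ 1)) ≡ Φ′ (suc (suc (double (suc (double i))))) p (suc s)
  s-cases i p≡2 zero s≡0 = trans
    (Even.otherwise-value j (trans (cong (P j) (sym (2-unit-value i p≡2))) (trans (P-value j (+ 1))
      (cong (p ^ j *_) (subst (λ e → U e j (+ 1) ≡ U e j (+ 0)) (sym s≡0)
        (trans (U-zero-level j (+ 1)) (sym (U-zero-level j (+ 0)))))))))
    (sym (Φ-even-even-2-1 (suc (suc (double j))) p s (suc j) (Even.m/2 j)
      (isEven-double (suc j)) (isEven-double (suc i)) p≡2 s≡0))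
    where
    j = suc (double i)
  s-cases i p≡2 (suc t) s≡ = trans
    (Even.even-value j (trans (Even.ι-P j (trans (cong (P j) (sym (2-unit-value i p≡2))) (trans (P-value j (+ 1))
      (cong (p ^ j *_) (subst (λ e → U e j (+ 1) ≡ A t j) (sym s≡) (U-unit t j p∤1))))))
      (subst (λ e → ι (p ^ e) ℚ.* ((π ^ℚ j) ℚ.* ι (A t j)) ≡ (ι (p ^ e) ^ℚ double j) ℚ.* ((π ^ℚ j) ℚ.- 1ℚ))
        (sym s≡) (trans (solve 3 (λ a b c → a :* (b :* c) := b :* (a :* c)) refl (ι (p ^ suc t)) (π ^ℚ j) (ι (A t j)))
          (A-closed t j)))))
    (sym (Φ-even-even-2 (suc (suc (double j))) p s (suc j) (Even.m/2 j)
      (isEven-double (suc j)) (isEven-double (suc i)) p≡2 (λ s≡0 → contradiction (trans (sym s≡) s≡0) λ ())))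
    where
    j = suc (double i)

  even-case : ∀ j → ι (h (double j) (+ 1)) ≡ Φ′ (suc (suc (double j))) p (suc s)
  even-case j with parity j
  ... | i , inj₁ refl = trans
    (Even.otherwise-value j (trans (cong (P j) (sym (cong₂ ℤ._+_ (ℤP.*-zeroʳ (+ p)) (ε-double i)))) (P-value j (+ 0))))
    (sym (Φ-even-odd (suc (suc (double j))) p s (suc j) (Even.m/2 j) (isEven-double (suc j)) (isEven-1+double i)))
  ... | i , inj₂ refl with p ℕP.≟ 2
  ...   | yes p≡2 = s-cases i p≡2 s refl
  ...   | no p≢2 = trans
    -- For j odd, 1 - ε j = 2 is prime to p, so no run contributes to `P j` at 1.
    (Even.even-value j {0ℚ} (trans (cong (λ u → y ℚ.* ι u) (P-vanish j (λ d → p∤2 p≢2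
        (subst (λ e → + p ∣ + 1 ℤ.- (ℤ.- e)) (ε-double i) d))))
      (trans (cong (y ℚ.*_) ι-0) (trans (ℚP.*-zeroʳ y) (sym (ℚP.*-zeroʳ (y ^ℚ double j)))))))
    (trans (cong (Even.pre j ℚ.*_) (ℚP.+-identityʳ ((π ℚ.- 1ℚ) ℚ.* qbinom2 (suc j) π)))
      (sym (Φ-even-even (suc (suc (double j))) p s (suc j) (Even.m/2 j)
        (isEven-double (suc j)) (isEven-double (suc i)) p≢2)))

  odd-case : ∀ j → ι (h (suc (double j)) (+ 1)) ≡ Φ′ (suc (suc (suc (double j)))) p (suc s)
  odd-case j = begin
    ι (h (suc (double j)) (+ 1))                                       ≡⟨ cong ι (h-odd j p∤1) ⟩
    ι (odd-value j)                                                    ≡⟨ ClosedForm.odd-closed p₁ pr s j ⟩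
    (y ^ℚ double j) ℚ.* qint (suc j) (π ^ℚ 2)                              ≡⟨ cong (ℚ._* qint (suc j) (π ^ℚ 2)) pre ⟨
    pw p (+ s ℤ.* + double j) ℚ.* qint (suc j) (π ^ℚ 2)                  ≡⟨ Φ-odd (suc (double (suc j))) p s (suc j)
                                                                                ([1+double]/2 (suc j)) (isEven-1+double (suc j)) ⟨
    Φ′ (suc (suc (suc (double j)))) p (suc s)                               ∎
    where
    open ≡-Reasoning
    pre : pw p (+ s ℤ.* + double j) ≡ y ^ℚ double j
    pre = trans (cong (pw p) (sym (ℤP.pos-* s (double j))))
      (trans (trans (pw-pos p (s * double j)) (cong ι (sym (ℕP.^-*-assoc p s (double j))))) (ι-^ (p ^ s) (double j)))

  prime-power-count : ∀ l → ι (F (p ^ suc s) l (+ 0) (+ 1)) ≡ Φ′ (suc (suc l)) p (suc s)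
  prime-power-count l with parity l
  ... | j , inj₁ refl = even-case j
  ... | j , inj₂ refl = odd-case j

-- Factorisation of the modulus

mutual
  -- The search inside ν, which has no name outside Defs: unification finds it from ν-no.
  goν : ℕ → ℕ → ℕ → ℕ
  goν = _

  ν-no : ∀ p n → ¬ (p ^ suc n ℕD.∣ suc n) → ν p (suc n) ≡ goν p (suc n) n
  ν-no p n ¬d with suc n | p ^ suc n ℕD.∣? suc n
  ... | N | yes d = contradiction d ¬d
  ... | N | no _  = refl

goν-∣ : ∀ p n e → p ^ goν p n e ℕD.∣ n
goν-∣ p n zero = ℕD.1∣ n
goν-∣ p n (suc e) with p ^ suc e ℕD.∣? n
... | yes d = d
... | no _  = goν-∣ p n e

goν-maximal : ∀ p n e d → d ≤ e → p ^ d ℕD.∣ n → d ≤ goν p n e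
goν-maximal p n zero    d d≤e p^d∣n = d≤e
goν-maximal p n (suc e) d d≤e p^d∣n with p ^ suc e ℕD.∣? n
... | yes _ = d≤e
... | no ¬p with ℕP.m≤n⇒m<n∨m≡n d≤e
...   | inj₁ (s≤s d≤e′) = goν-maximal p n e d d≤e′ p^d∣n
...   | inj₂ refl = contradiction p^d∣n ¬p

n<p^n : ∀ p n → 2 ≤ p → n < p ^ n
n<p^n p zero    2≤p = s≤s z≤n
n<p^n p (suc n) 2≤p = ℕP.≤-<-trans (n<p^n p n 2≤p) (ℕP.^-monoʳ-< p 2≤p (ℕP.n<1+n n))

p^d∣n⇒d<n : ∀ p n d .{{_ : NonZero n}} → 2 ≤ p → p ^ d ℕD.∣ n → d < n
p^d∣n⇒d<n p n d 2≤p h = ℕP.<-≤-trans (n<p^n p d 2≤p) (ℕD.∣⇒≤ h)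

-- The search opens with the exponent n itself. As n < p^n this candidate is rejected, and the
-- remaining search is the function on which the inductions run.
ν≡goν : ∀ p n .{{_ : NonZero n}} → 2 ≤ p → ∃ λ n′ → suc n′ ≡ n × ν p n ≡ goν p n n′
ν≡goν p (suc n) 2≤p = n , refl , ν-no p n (λ d → ℕP.<-irrefl refl (p^d∣n⇒d<n p (suc n) (suc n) 2≤p d))

ν-∣ : ∀ p n .{{_ : NonZero n}} → 2 ≤ p → p ^ ν p n ℕD.∣ n
ν-∣ p n 2≤p with ν≡goν p n 2≤p
... | n′ , _ , e = subst (λ v → p ^ v ℕD.∣ n) (sym e) (goν-∣ p n n′)

ν-maximal : ∀ p n d .{{_ : NonZero n}} → 2 ≤ p → p ^ d ℕD.∣ n → d ≤ ν p n
ν-maximal p n d 2≤p h with ν≡goν p n 2≤p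
... | n′ , refl , e = subst (d ≤_) (sym e) (goν-maximal p n n′ d (ℕP.≤-pred (p^d∣n⇒d<n p n d 2≤p h)) h)

prime⇒2≤ : ∀ {p} → Prime p → 2 ≤ p
prime⇒2≤ {p} pr = ℕ.nonTrivial⇒n>1 p {{prime⇒nonTrivial pr}}

prime∣prime⇒≡ : ∀ {p q} → Prime p → Prime q → p ℕD.∣ q → p ≡ q
prime∣prime⇒≡ {p} {q} pp pq d with prime⇒irreducible pq d
... | inj₁ refl = contradiction (prime⇒2≤ pp) λ { (s≤s ()) }
... | inj₂ e = e

prime∣^⇒∣ : ∀ {p} → Prime p → ∀ a e → p ℕD.∣ a ^ e → p ℕD.∣ a
prime∣^⇒∣ pp a zero    d = contradiction (subst (2 ≤_) (ℕD.∣1⇒≡1 d) (prime⇒2≤ pp)) λ { (s≤s ()) }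
prime∣^⇒∣ pp a (suc e) d with euclidsLemma a (a ^ e) pp d
... | inj₁ d′ = d′
... | inj₂ d′ = prime∣^⇒∣ pp a e d′

prime-power-factor : ∀ {p} m s l .{{_ : NonZero p}} → Prime p → m ≡ suc (suc l) →
                     fromℕ (F (p ^ suc s) l (+ 0) (+ 1)) ≡ Φ m p (suc s)
prime-power-factor {suc p₁} m s l pr refl = trans (sym (ι≡fromℕ (F (suc p₁ ^ suc s) l (+ 0) (+ 1))))
  (trans (PrimePowerCount.prime-power-count p₁ pr s l) (Φ′≡Φ m (suc p₁) (suc s)))

module Factorise (n l : ℕ) .{{n≢0 : NonZero n}} (f : ℕ → ℚ)
                 (f-suc : ∀ p → f (suc p) ≡ Φ (suc (suc l)) (suc p) (ν (suc p) n)) where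

  count : ℕ → ℚ
  count N = fromℕ (F N l (+ 0) (+ 1))

  f-prime : ∀ {p} → Prime p → p ℕD.∣ n → f p ≡ count (p ^ ν p n)
  f-prime {suc p₁} pr p∣n = trans (f-suc p₁) (case (ν (suc p₁) n) refl)
    where
    case : ∀ v → ν (suc p₁) n ≡ v → Φ (suc (suc l)) (suc p₁) (ν (suc p₁) n) ≡ count (suc p₁ ^ ν (suc p₁) n)
    case zero    e = contradiction (subst (1 ≤_) e
      (ν-maximal (suc p₁) n 1 (prime⇒2≤ pr) (subst (ℕD._∣ n) (sym (ℕP.*-identityʳ (suc p₁))) p∣n))) λ ()
    case (suc s) e = subst (λ v → Φ (suc (suc l)) (suc p₁) v ≡ count (suc p₁ ^ v)) (sym e)
      (sym (prime-power-factor (suc (suc l)) s l pr refl))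

  -- The prime powers of the primes in ps have been split off from n, leaving the cofactor.
  record Split (ps : List ℕ) : Set where
    field
      smooth cofactor : ℕ
      factored     : n ≡ smooth * cofactor
      coprime      : ∀ {p} → p ∈ ps → ¬ (p ℕD.∣ cofactor)
      only         : ∀ {q} → Prime q → q ℕD.∣ smooth → q ∈ ps
      count-split  : count n ≡ foldr ℚ._*_ 1ℚ (map f ps) ℚ.* count cofactor

  -- The primes dividing the smooth part lie in ps, and p is not repeated, so p is prime to that
  -- part and its full power p^ν divides the cofactor. By maximality of ν nothing of p is left, and
  -- the two factors are coprime.
  split : ∀ ps → Unique ps → (∀ {p} → p ∈ ps → Prime p × p ℕD.∣ n) → Split ps
  split [] _ _ = record
    { smooth = 1 ; cofactor = n ; factored = sym (ℕP.*-identityˡ n)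
    ; coprime = λ ()
    ; only = λ pq d → contradiction (subst (2 ≤_) (ℕD.∣1⇒≡1 d) (prime⇒2≤ pq)) λ { (s≤s ()) }
    ; count-split = sym (ℚP.*-identityˡ (count n)) }
  split (p ∷ ps) (p∉ AllPairs.∷ unique) good = record
    { smooth = smooth * p ^ ν p n ; cofactor = cofactor′
    ; factored = trans factored (trans (cong (smooth *_) cofactor≡) (sym (ℕP.*-assoc smooth (p ^ ν p n) cofactor′)))
    ; coprime = λ { (here refl) → p∤cofactor′ ; (there q∈) d → coprime q∈
        (subst (_ ℕD.∣_) (sym cofactor≡) (ℕD.∣n⇒∣m*n (p ^ ν p n) d)) }
    ; only = only′
    ; count-split = begin
        count n
          ≡⟨ count-split ⟩
        g ℚ.* count cofactor
          ≡⟨ cong (g ℚ.*_) (trans (cong count cofactor≡) (trans (cong fromℕ (F-× (p ^ ν p n) cofactor′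
               {{ℕP.m^n≢0 p (ν p n) {{p≢0}}}} {{cofactor′≢0}}
               (Coprimality.sym (prime-coprime-^ pr p∤cofactor′ (ν p n))) l (+ 0) (+ 1)))
               (fromℕ-* (F (p ^ ν p n) l (+ 0) (+ 1)) (F cofactor′ l (+ 0) (+ 1))))) ⟩
        g ℚ.* (count (p ^ ν p n) ℚ.* count cofactor′)
          ≡⟨ rearrange g (count (p ^ ν p n)) (count cofactor′) ⟩
        (count (p ^ ν p n) ℚ.* g) ℚ.* count cofactor′
          ≡⟨ cong (λ a → (a ℚ.* g) ℚ.* count cofactor′) (sym (f-prime pr (proj₂ (good (here refl))))) ⟩
        (f p ℚ.* g) ℚ.* count cofactor′ ∎ }
    where
    open ≡-Reasoning
    open Split (split ps unique (good ∘ there))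
    pr : Prime p
    pr = proj₁ (good (here refl))
    p≢0 : NonZero p
    p≢0 = prime⇒nonZero pr
    g : ℚ
    g = foldr ℚ._*_ 1ℚ (map f ps)
    rearrange : ∀ a b c → a ℚ.* (b ℚ.* c) ≡ (b ℚ.* a) ℚ.* c
    rearrange a b c = trans (sym (ℚP.*-assoc a b c)) (cong (ℚ._* c) (ℚP.*-comm a b))
    p∤smooth : ¬ (p ℕD.∣ smooth)
    p∤smooth d = All.lookup p∉ (only pr d) refl
    p^ν∣cofactor : p ^ ν p n ℕD.∣ cofactor
    p^ν∣cofactor = Coprimality.coprime-divisor (Coprimality.sym (prime-coprime-^ pr p∤smooth (ν p n)))
      (subst (p ^ ν p n ℕD.∣_) factored (ν-∣ p n (prime⇒2≤ pr)))
    cofactor′ : ℕ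
    cofactor′ = ℕD.quotient p^ν∣cofactor
    cofactor≡ : cofactor ≡ p ^ ν p n * cofactor′
    cofactor≡ = trans (ℕD._∣_.equality p^ν∣cofactor) (ℕP.*-comm cofactor′ (p ^ ν p n))
    p∤cofactor′ : ¬ (p ℕD.∣ cofactor′)
    p∤cofactor′ d = ℕP.<-irrefl refl (ν-maximal p n (suc (ν p n)) (prime⇒2≤ pr)
      (subst (p ^ suc (ν p n) ℕD.∣_) (sym (trans factored (cong (smooth *_) cofactor≡)))
        (ℕD.∣n⇒∣m*n smooth (subst (ℕD._∣ p ^ ν p n * cofactor′) (ℕP.*-comm (p ^ ν p n) p) (ℕD.*-monoʳ-∣ (p ^ ν p n) d)))))
    cofactor′≢0 : NonZero cofactor′
    cofactor′≢0 = ℕ.≢-nonZero (λ e → p∤cofactor′ (subst (p ℕD.∣_) (sym e) (p ℕD.∣0)))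
    only′ : ∀ {q} → Prime q → q ℕD.∣ smooth * p ^ ν p n → q ∈ p ∷ ps
    only′ pq d with euclidsLemma smooth (p ^ ν p n) pq d
    ... | inj₁ d′ = there (only pq d′)
    ... | inj₂ d′ = here (prime∣prime⇒≡ pq pr (prime∣^⇒∣ pq p (ν p n) d′))

  private
    isPrimeDivisor? : ∀ p → Dec (Prime p × p ℕD.∣ n)
    isPrimeDivisor? p = prime? p ×-dec (p ℕD.∣? n)

  ∈-primeDivisors⁺ : ∀ {p} → Prime p → p ℕD.∣ n → p ∈ primeDivisors n
  ∈-primeDivisors⁺ pr d = ∈-filter⁺ isPrimeDivisor? (∈-upTo⁺ (s≤s (ℕD.∣⇒≤ d))) (pr , d)

  no-prime-divisor⇒1 : ∀ c .{{_ : NonZero c}} → (∀ {p} → Prime p → ¬ (p ℕD.∣ c)) → c ≡ 1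
  no-prime-divisor⇒1 c h with factorise c
  ... | record { factors = [] ; isFactorisation = e } = e
  ... | record { factors = p ∷ ps ; isFactorisation = e ; factorsPrime = pr All.∷ _ } =
    contradiction (subst (p ℕD.∣_) (sym e) (ℕD.m∣m*n (product ps))) (h pr)

  count-product : count n ≡ foldr ℚ._*_ 1ℚ (map f (primeDivisors n))
  count-product = begin
    count n               ≡⟨ count-split ⟩
    g ℚ.* count cofactor  ≡⟨ cong (λ c → g ℚ.* count c) (no-prime-divisor⇒1 cofactor {{cofactor≢0}} no-prime) ⟩
    g ℚ.* count 1         ≡⟨ cong (λ c → g ℚ.* fromℕ c) (F-one l (+ 0) (+ 1)) ⟩
    g ℚ.* 1ℚ              ≡⟨ ℚP.*-identityʳ g ⟩
    g                     ∎
    where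
    open ≡-Reasoning
    g : ℚ
    g = foldr ℚ._*_ 1ℚ (map f (primeDivisors n))
    open Split (split (primeDivisors n) (filter⁺ isPrimeDivisor? (upTo⁺ (suc n)))
                 (λ p∈ → proj₂ (∈-filter⁻ isPrimeDivisor? {xs = upTo (suc n)} p∈)))
    cofactor≢0 : NonZero cofactor
    cofactor≢0 = ℕP.m*n≢0⇒n≢0 smooth {{subst NonZero factored n≢0}}
    no-prime : ∀ {p} → Prime p → ¬ (p ℕD.∣ cofactor)
    no-prime pr d = coprime (∈-primeDivisors⁺ pr (subst (_ ℕD.∣_) (sym factored) (ℕD.∣n⇒∣m*n smooth d))) d

count≡friezeCount : ∀ n l .{{_ : NonZero n}} → fromℕ (F n l (+ 0) (+ 1)) ≡ friezeCount n (suc (suc l))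
-- The placeholder is the local function `factor` of `friezeCount`, recovered by unification.
count≡friezeCount n l = Factorise.count-product n l _ (λ p → refl)

-- Friezes and their quiddity sequences

row : Entries → ℤ → ℕ → ℤ
row E u i = E u (u ℤ.+ + i)

quiddity : Entries → ℤ → ℤ
quiddity E u = row E u 2

diff-≤ : ∀ u {a b} → a ≤ b → (u ℤ.+ + a) ℤ.- u ℤ.≤ + b
diff-≤ u {a} {b} h = subst (ℤ._≤ + b) (sym (eq u (+ a))) (ℤ.+≤+ h)
  where
  eq : ∀ u a → (u ℤ.+ a) ℤ.- u ≡ a
  eq = solve-∀

diff-≥ : ∀ u {a b} → b ≤ a → + b ℤ.≤ (u ℤ.+ + a) ℤ.- u
diff-≥ u {a} {b} h = subst (+ b ℤ.≤_) (sym (eq u (+ a))) (ℤ.+≤+ h)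
  where
  eq : ∀ u a → (u ℤ.+ a) ℤ.- u ≡ a
  eq = solve-∀

det : (a b c d e f g h i : ℤ) → ℤ
det a b c d e f g h i =
  a ℤ.* (e ℤ.* i ℤ.- f ℤ.* h) ℤ.- b ℤ.* (d ℤ.* i ℤ.- f ℤ.* g) ℤ.+ c ℤ.* (d ℤ.* h ℤ.- e ℤ.* g)

det-cong : ∀ {a b c d e f g h i a′ b′ c′ d′ e′ f′ g′ h′ i′} →
  a ≡ a′ → b ≡ b′ → c ≡ c′ → d ≡ d′ → e ≡ e′ → f ≡ f′ → g ≡ g′ → h ≡ h′ → i ≡ i′ →
  det a b c d e f g h i ≡ det a′ b′ c′ d′ e′ f′ g′ h′ i′
det-cong refl refl refl refl refl refl refl refl refl = refl

det3≡det : ∀ (E : Entries) u v → det3 E u v ≡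
  det (E (u ℤ.+ + 0) (v ℤ.+ + 0)) (E (u ℤ.+ + 0) (v ℤ.+ + 1)) (E (u ℤ.+ + 0) (v ℤ.+ + 2))
      (E (u ℤ.+ + 1) (v ℤ.+ + 0)) (E (u ℤ.+ + 1) (v ℤ.+ + 1)) (E (u ℤ.+ + 1) (v ℤ.+ + 2))
      (E (u ℤ.+ + 2) (v ℤ.+ + 0)) (E (u ℤ.+ + 2) (v ℤ.+ + 1)) (E (u ℤ.+ + 2) (v ℤ.+ + 2))
det3≡det E u v = refl

-- Expanding the determinant of a 3×3 matrix whose lower two rows satisfy the recurrence
-- gives (defect of the top row) × (lower left 2×2 minor), and that minor is 1.
recurrence-up : ∀ {n} a b c d e f g h i t → det a b c d e f g h i ≋ + 0 ⟨mod n ⟩ →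
  d ℤ.* h ℤ.- g ℤ.* e ≋ + 1 ⟨mod n ⟩ → f ≋ t ℤ.* e ℤ.- d ⟨mod n ⟩ → i ≋ t ℤ.* h ℤ.- g ⟨mod n ⟩ →
  c ≋ t ℤ.* b ℤ.- a ⟨mod n ⟩
recurrence-up a b c d e f g h i t (cong-mod D) (cong-mod M) (cong-mod r₁) (cong-mod r₂) = modulo-by _
  (∣m∣n⇒∣m+n (∣m∣n⇒∣m+n D (∣n⇒∣m*n (ℤ.- (c ℤ.- (t ℤ.* b ℤ.- a))) M))
    (∣m∣n⇒∣m+n (∣n⇒∣m*n (b ℤ.* d ℤ.- a ℤ.* e) r₂) (∣n⇒∣m*n (a ℤ.* h ℤ.- b ℤ.* g) r₁)))
  (eq a b c d e f g h i t)
  where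
  eq : ∀ a b c d e f g h i t →
    ((a ℤ.* (e ℤ.* i ℤ.- f ℤ.* h) ℤ.- b ℤ.* (d ℤ.* i ℤ.- f ℤ.* g) ℤ.+ c ℤ.* (d ℤ.* h ℤ.- e ℤ.* g)) ℤ.- + 0
      ℤ.+ (ℤ.- (c ℤ.- (t ℤ.* b ℤ.- a))) ℤ.* (d ℤ.* h ℤ.- g ℤ.* e ℤ.- + 1))
      ℤ.+ ((b ℤ.* d ℤ.- a ℤ.* e) ℤ.* (i ℤ.- (t ℤ.* h ℤ.- g)) ℤ.+ (a ℤ.* h ℤ.- b ℤ.* g) ℤ.* (f ℤ.- (t ℤ.* e ℤ.- d)))
      ≡ c ℤ.- (t ℤ.* b ℤ.- a)
  eq = solve-∀

two-step : (P : ℕ → Set) → P 0 → P 1 → (∀ d → P d → P (suc d) → P (suc (suc d))) → ∀ d → P d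
two-step P p₀ p₁ step zero          = p₀
two-step P p₀ p₁ step (suc zero)    = p₁
two-step P p₀ p₁ step (suc (suc d)) = step d (two-step P p₀ p₁ step d) (two-step P p₀ p₁ step (suc d))

module FriezeRecurrence {n l : ℕ} (E : Entries) (frieze : IsFrieze n (suc (suc l)) E)
                        (tame : IsTame n (suc (suc l)) E) (regular : IsRegular n (suc (suc l)) E) where
  open IsFrieze frieze

  R : ℤ → ℕ → ℤ
  R = row E

  row-0 : ∀ u → R u 0 ≋ + 0 ⟨mod n ⟩
  row-0 u = cong-mod (subst (λ v → E u v ≡ + 0 [mod n ]) (sym (ℤP.+-identityʳ u)) (bottom u))

  row-m : ∀ u → R u (suc (suc l)) ≋ + 0 ⟨mod n ⟩
  row-m u = cong-mod (top u)

  row-1 : ∀ u → R u 1 ≋ + 1 ⟨mod n ⟩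
  row-1 u = cong-mod (proj₁ regular u)

  row-last : ∀ u → R u (suc l) ≋ + 1 ⟨mod n ⟩
  row-last u = cong-mod (proj₂ regular u)

  row-unimod : ∀ u i → i ≤ l →
    R u (suc i) ℤ.* R (u ℤ.+ + 1) (suc i) ℤ.- R (u ℤ.+ + 1) i ℤ.* R u (suc (suc i)) ≋ + 1 ⟨mod n ⟩
  row-unimod u i i≤l = mod-trans
    (≡⇒mod (cong₂ ℤ._-_ (cong (λ v → R u (suc i) ℤ.* E (u ℤ.+ + 1) v) (eq₁ u (+ i)))
      (cong₂ (λ v w → E (u ℤ.+ + 1) v ℤ.* E u w) (eq₂ u (+ i)) (eq₃ u (+ i)))))
    (cong-mod (unimod u (u ℤ.+ + suc i) (diff-≥ u (s≤s z≤n)) (diff-≤ u (s≤s i≤l))))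
    where
    eq₁ : ∀ u i → (u ℤ.+ + 1) ℤ.+ (+ 1 ℤ.+ i) ≡ (u ℤ.+ (+ 1 ℤ.+ i)) ℤ.+ + 1
    eq₁ = solve-∀
    eq₂ : ∀ u i → (u ℤ.+ + 1) ℤ.+ i ≡ u ℤ.+ (+ 1 ℤ.+ i)
    eq₂ = solve-∀
    eq₃ : ∀ u i → u ℤ.+ (+ 2 ℤ.+ i) ≡ (u ℤ.+ (+ 1 ℤ.+ i)) ℤ.+ + 1
    eq₃ = solve-∀

  Recurrence : ℤ → ℕ → Set
  Recurrence u d = R u (suc (suc d)) ≋ quiddity E (u ℤ.+ + d) ℤ.* R u (suc d) ℤ.- R u d ⟨mod n ⟩

  recurrence-0 : ∀ u → Recurrence u 0
  recurrence-0 u = mod-sym (begin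
    quiddity E (u ℤ.+ + 0) ℤ.* R u 1 ℤ.- R u 0  ≈⟨ -‿mod (*-modʳ (quiddity E (u ℤ.+ + 0)) (row-1 u)) (row-0 u) ⟩
    quiddity E (u ℤ.+ + 0) ℤ.* + 1 ℤ.- + 0      ≡⟨ eq (quiddity E (u ℤ.+ + 0)) ⟩
    quiddity E (u ℤ.+ + 0)                      ≡⟨ cong (quiddity E) (ℤP.+-identityʳ u) ⟩
    R u 2                                       ∎)
    where
    open ≋-Reasoning n
    eq : ∀ a → a ℤ.* + 1 ℤ.- + 0 ≡ a
    eq = solve-∀

  -- Tameness constrains only windows with v - u ≥ 2, so this case comes from the diamond rule
  -- beside the row of ones.
  recurrence-1 : 1 ≤ l → ∀ u → Recurrence u 1
  recurrence-1 d≤l u = begin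
    R u 3
      ≡⟨ eq₁ (R u 3) ⟩
    + 1 ℤ.* R u 3
      ≈⟨ *-modˡ (R u 3) (mod-sym (row-1 (u ℤ.+ + 1))) ⟩
    R (u ℤ.+ + 1) 1 ℤ.* R u 3
      ≡⟨ eq₂ (R u 2) (R (u ℤ.+ + 1) 2) (R (u ℤ.+ + 1) 1 ℤ.* R u 3) ⟩
    R (u ℤ.+ + 1) 2 ℤ.* R u 2 ℤ.- (R u 2 ℤ.* R (u ℤ.+ + 1) 2 ℤ.- R (u ℤ.+ + 1) 1 ℤ.* R u 3)
      ≈⟨ -‿mod (mod-refl {a = R (u ℤ.+ + 1) 2 ℤ.* R u 2}) (mod-trans (row-unimod u 1 d≤l) (mod-sym (row-1 u))) ⟩
    R (u ℤ.+ + 1) 2 ℤ.* R u 2 ℤ.- R u 1 ∎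
    where
    open ≋-Reasoning n
    eq₁ : ∀ a → a ≡ + 1 ℤ.* a
    eq₁ = solve-∀
    eq₂ : ∀ a b c → c ≡ b ℤ.* a ℤ.- (a ℤ.* b ℤ.- c)
    eq₂ = solve-∀

  -- In the 3×3 window at (u , u + d + 2) the lower two rows lie nearer to the diagonal, so they
  -- already satisfy the recurrence, with the same coefficient because it depends only on the
  -- column.
  recurrence-2+ : ∀ d u → suc (suc d) ≤ l → Recurrence (u ℤ.+ + 1) (suc d) → Recurrence (u ℤ.+ + 2) d →
                  Recurrence u (suc (suc d))
  recurrence-2+ d u d≤l rec₁ rec₂ = recurrence-up
    (R u (2 + d)) (R u (3 + d)) (R u (4 + d))
    (R u₁ (1 + d)) (R u₁ (2 + d)) (R u₁ (3 + d))
    (R u₂ d) (R u₂ (1 + d)) (R u₂ (2 + d)) t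
    (mod-trans (≡⇒mod det≡) (cong-mod (tame u v (diff-≥ u (s≤s (s≤s z≤n))) (diff-≤ u d≤l))))
    (mod-trans (≡⇒mod minor≡) (row-unimod u₁ d (ℕP.≤-trans (ℕP.m≤n+m d 2) d≤l)))
    (mod-trans rec₁
      (≡⇒mod (cong (λ w → quiddity E w ℤ.* R u₁ (2 + d) ℤ.- R u₁ (1 + d)) (w₁ u (+ d)))))
    (mod-trans rec₂
      (≡⇒mod (cong (λ w → quiddity E w ℤ.* R u₂ (1 + d) ℤ.- R u₂ d) (w₂ u (+ d)))))
    where
    u₁ u₂ v t : ℤ
    u₁ = u ℤ.+ + 1
    u₂ = u ℤ.+ + 2
    v = u ℤ.+ + suc (suc d)
    t = quiddity E v
    w₁ : ∀ u d → (u ℤ.+ + 1) ℤ.+ (+ 1 ℤ.+ d) ≡ u ℤ.+ (+ 2 ℤ.+ d)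
    w₁ = solve-∀
    w₂ : ∀ u d → (u ℤ.+ + 2) ℤ.+ d ≡ u ℤ.+ (+ 2 ℤ.+ d)
    w₂ = solve-∀
    u₁+1 : u₁ ℤ.+ + 1 ≡ u₂
    u₁+1 = ℤP.+-assoc u (+ 1) (+ 1)
    minor≡ : R u₁ (1 + d) ℤ.* R u₂ (1 + d) ℤ.- R u₂ d ℤ.* R u₁ (2 + d)
           ≡ R u₁ (1 + d) ℤ.* R (u₁ ℤ.+ + 1) (1 + d) ℤ.- R (u₁ ℤ.+ + 1) d ℤ.* R u₁ (2 + d)
    minor≡ = cong (λ w → R u₁ (1 + d) ℤ.* R w (1 + d) ℤ.- R w d ℤ.* R u₁ (2 + d)) (sym u₁+1)
    entry : ℕ → ℕ → ℤ
    entry i j = E (u ℤ.+ + i) (v ℤ.+ + j)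
    c : ∀ j → u ℤ.+ + (2 + d + j) ≡ v ℤ.+ + j
    c j = sym (ℤP.+-assoc u (+ (2 + d)) (+ j))
    shift : ∀ i j k → i + k ≡ 2 + d + j → R (u ℤ.+ + i) k ≡ entry i j
    shift i j k h = cong (E (u ℤ.+ + i)) (trans (ℤP.+-assoc u (+ i) (+ k)) (trans (cong (λ z → u ℤ.+ + z) h) (c j)))
    shift₀ : ∀ j k → k ≡ 2 + d + j → R u k ≡ entry 0 j
    shift₀ j k h = trans (cong (λ w → R w k) (sym (ℤP.+-identityʳ u))) (shift 0 j k h)
    at : ∀ j → j + (2 + d) ≡ 2 + d + j
    at j = ℕP.+-comm j (2 + d)
    det≡ : det (R u (2 + d)) (R u (3 + d)) (R u (4 + d)) (R u₁ (1 + d)) (R u₁ (2 + d)) (R u₁ (3 + d))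
               (R u₂ d) (R u₂ (1 + d)) (R u₂ (2 + d)) ≡ det3 E u v
    det≡ = trans (det-cong
        (shift₀ 0 (2 + d) (at 0)) (shift₀ 1 (3 + d) (at 1)) (shift₀ 2 (4 + d) (at 2))
        (shift 1 0 (1 + d) (at 0)) (shift 1 1 (2 + d) (at 1)) (shift 1 2 (3 + d) (at 2))
        (shift 2 0 d (at 0)) (shift 2 1 (1 + d) (at 1)) (shift 2 2 (2 + d) (at 2)))
      (sym (det3≡det E u v))

  recurrence : ∀ d → d ≤ l → ∀ u → Recurrence u d
  recurrence = two-step (λ d → d ≤ l → ∀ u → Recurrence u d) (λ _ → recurrence-0) recurrence-1
    (λ d rec₀ rec₁ d≤l u → recurrence-2+ d u d≤l
      (rec₁ (ℕP.≤-trans (ℕP.n≤1+n (suc d)) d≤l) (u ℤ.+ + 1)) (rec₀ (ℕP.≤-trans (ℕP.m≤n+m d 2) d≤l) (u ℤ.+ + 2)))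

-- A window of m - 2 consecutive quiddities determines its neighbours on both sides.
module FriezeUnique {n l : ℕ} (E G : Entries)
    (frieze₁ : IsFrieze n (suc (suc l)) E) (tame₁ : IsTame n (suc (suc l)) E) (regular₁ : IsRegular n (suc (suc l)) E)
    (frieze₂ : IsFrieze n (suc (suc l)) G) (tame₂ : IsTame n (suc (suc l)) G) (regular₂ : IsRegular n (suc (suc l)) G) where

  private
    module E = FriezeRecurrence E frieze₁ tame₁ regular₁
    module G = FriezeRecurrence G frieze₂ tame₂ regular₂

  Window : ℤ → Set
  Window u = ∀ i → i < l → quiddity E (u ℤ.+ + i) ≋ quiddity G (u ℤ.+ + i) ⟨mod n ⟩

  both : ∀ {a b c} → a ≋ c ⟨mod n ⟩ → b ≋ c ⟨mod n ⟩ → a ≋ b ⟨mod n ⟩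
  both h k = mod-trans h (mod-sym k)

  row-agree : ∀ u → Window u → ∀ d → d ≤ suc l → row E u d ≋ row G u d ⟨mod n ⟩
  row-agree u W zero          d≤ = both (E.row-0 u) (G.row-0 u)
  row-agree u W (suc zero)    d≤ = both (E.row-1 u) (G.row-1 u)
  row-agree u W (suc (suc d)) (s≤s d<l) = mod-trans (E.recurrence d (ℕP.<⇒≤ d<l) u) (mod-trans
    (-‿mod (*-mod (W d d<l) (row-agree u W (suc d) (s≤s (ℕP.<⇒≤ d<l)))) (row-agree u W d (ℕP.m≤n⇒m≤1+n (ℕP.<⇒≤ d<l))))
    (mod-sym (G.recurrence d (ℕP.<⇒≤ d<l) u)))

  row-agree-m : ∀ u → Window u → ∀ d → d ≤ suc (suc l) → row E u d ≋ row G u d ⟨mod n ⟩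
  row-agree-m u W d d≤ with ℕP.m≤n⇒m<n∨m≡n d≤
  ... | inj₁ (s≤s d≤′) = row-agree u W d d≤′
  ... | inj₂ refl = both (E.row-m u) (G.row-m u)

  -- At d = l the recurrence meets the boundary values 1 and 0 and reads 0 = b 1 - E(u , u + l).
  next-quiddity : ∀ {F} (frieze : IsFrieze n (suc (suc l)) F) (tame : IsTame n (suc (suc l)) F)
    (regular : IsRegular n (suc (suc l)) F) u → quiddity F (u ℤ.+ + l) ≋ row F u l ⟨mod n ⟩
  next-quiddity {F} frieze tame regular u = begin
    t                                   ≡⟨ eq t (row F u l) ⟩
    t ℤ.* + 1 ℤ.- row F u l ℤ.+ row F u l
      ≈⟨ +-modˡ (row F u l) (+-modˡ (ℤ.- row F u l) (*-modʳ t (mod-sym (row-last u)))) ⟩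
    t ℤ.* row F u (suc l) ℤ.- row F u l ℤ.+ row F u l
      ≈⟨ +-modˡ (row F u l) (mod-trans (mod-sym (recurrence l ℕP.≤-refl u)) (row-m u)) ⟩
    + 0 ℤ.+ row F u l                   ≡⟨ ℤP.+-identityˡ (row F u l) ⟩
    row F u l                           ∎
    where
    open ≋-Reasoning n
    open FriezeRecurrence F frieze tame regular
    t : ℤ
    t = quiddity F (u ℤ.+ + l)
    eq : ∀ t r → t ≡ t ℤ.* + 1 ℤ.- r ℤ.+ r
    eq = solve-∀

  window-suc : ∀ u → Window u → Window (u ℤ.+ + 1)
  window-suc u W i i<l = subst (λ w → quiddity E w ≋ quiddity G w ⟨mod n ⟩) (sym (ℤP.+-assoc u (+ 1) (+ i))) next
    where
    next : quiddity E (u ℤ.+ + suc i) ≋ quiddity G (u ℤ.+ + suc i) ⟨mod n ⟩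
    next with ℕP.m≤n⇒m<n∨m≡n i<l
    ... | inj₁ 1+i<l = W (suc i) 1+i<l
    ... | inj₂ refl = mod-trans (next-quiddity frieze₁ tame₁ regular₁ u) (mod-trans
            (row-agree u W l (ℕP.n≤1+n l)) (mod-sym (next-quiddity frieze₂ tame₂ regular₂ u)))

  backward : ∀ {F} (frieze : IsFrieze n (suc (suc l)) F) (tame : IsTame n (suc (suc l)) F)
    (regular : IsRegular n (suc (suc l)) F) u d → d ≤ l →
    row F u d ≋ quiddity F (u ℤ.+ + d) ℤ.* row F u (suc d) ℤ.- row F u (suc (suc d)) ⟨mod n ⟩
  backward {F} frieze tame regular u d d≤l = begin
    row F u d        ≡⟨ eq (row F u d) t ⟩
    t ℤ.- (t ℤ.- row F u d) ≈⟨ -‿mod (mod-refl {a = t}) (mod-sym (recurrence d d≤l u)) ⟩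
    t ℤ.- row F u (suc (suc d)) ∎
    where
    open ≋-Reasoning n
    open FriezeRecurrence F frieze tame regular
    t : ℤ
    t = quiddity F (u ℤ.+ + d) ℤ.* row F u (suc d)
    eq : ∀ r t → r ≡ t ℤ.- (t ℤ.- r)
    eq = solve-∀

  -- Starts from the boundary values 0 and 1 at the top and runs the recurrence backwards; k is the
  -- distance to the top. The coefficients used sit at u + 1 and beyond, inside the window at u + 1,
  -- and at distance 2 the missing quiddity at u appears.
  row-agree-down : ∀ u → Window (u ℤ.+ + 1) → ∀ k d → suc d + k ≡ suc (suc l) → row E u (suc d) ≋ row G u (suc d) ⟨mod n ⟩
  row-agree-down u W zero d e rewrite trans (sym (ℕP.+-identityʳ (suc d))) e = both (E.row-m u) (G.row-m u)
  row-agree-down u W (suc zero) d e rewrite ℕP.suc-injective (trans (sym (ℕP.+-comm (suc d) 1)) e) =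
    both (E.row-last u) (G.row-last u)
  row-agree-down u W (suc (suc k)) d e = mod-trans (backward frieze₁ tame₁ regular₁ u (suc d) 1+d≤l) (mod-trans
    (-‿mod (*-mod shifted (row-agree-down u W (suc k) (suc d) (trans (sym (ℕP.+-suc (suc d) (suc k))) e)))
      (row-agree-down u W k (suc (suc d)) (trans (cong suc (trans (cong suc (sym (ℕP.+-suc d k))) (sym (ℕP.+-suc d (suc k))))) e)))
    (mod-sym (backward frieze₂ tame₂ regular₂ u (suc d) 1+d≤l)))
    where
    1+d≤l : suc d ≤ l
    1+d≤l = ℕP.≤-pred (ℕP.≤-pred (subst (suc (suc (suc d)) ≤_) e
      (subst (ℕ._≤ suc d + suc (suc k)) (ℕP.+-comm (suc d) 2) (ℕP.+-monoʳ-≤ (suc d) (s≤s (s≤s z≤n))))))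
    shifted : quiddity E (u ℤ.+ + suc d) ≋ quiddity G (u ℤ.+ + suc d) ⟨mod n ⟩
    shifted = subst (λ w → quiddity E w ≋ quiddity G w ⟨mod n ⟩) (ℤP.+-assoc u (+ 1) (+ d)) (W d 1+d≤l)

  window-pred : ∀ u → Window (u ℤ.+ + 1) → Window u
  window-pred u W zero i<l = subst (λ w → quiddity E w ≋ quiddity G w ⟨mod n ⟩) (sym (ℤP.+-identityʳ u))
    (row-agree-down u W l 1 refl)
  window-pred u W (suc i) i<l = subst (λ w → quiddity E w ≋ quiddity G w ⟨mod n ⟩) (ℤP.+-assoc u (+ 1) (+ i))
    (W i (ℕP.<⇒≤ i<l))

  window-all : Window (+ 0) → ∀ u → Window u
  window-all W (+ zero)       = W
  window-all W (+ suc k)      = subst Window (cong (+_) (ℕP.+-comm k 1)) (window-suc (+ k) (window-all W (+ k)))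
  window-all W (-[1+ zero ])  = window-pred -[1+ 0 ] W
  window-all W (-[1+ suc k ]) = window-pred -[1+ suc k ] (window-all W -[1+ k ])

  agree : Window (+ 0) → ∀ u v → + 0 ℤ.≤ v ℤ.- u → v ℤ.- u ℤ.≤ + suc (suc l) → E u v ≡ G u v [mod n ]
  agree W u v lo hi with v ℤ.- u in eq | lo | hi
  ... | + d | _ | ℤ.+≤+ d≤m = subst (λ w → E u w ≡ G u w [mod n ]) (trans (cong (ℤ._+_ u) (sym eq)) (cancel u v))
      (divisible (row-agree-m u (window-all W u) d d≤m))
    where
    cancel : ∀ u v → u ℤ.+ (v ℤ.- u) ≡ v
    cancel = solve-∀

-- Friezes from quiddity sequences

solution : (ℕ → ℤ) → ℤ → ℤ → ℕ → ℤ
solution e x y zero          = x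
solution e x y (suc zero)    = y
solution e x y (suc (suc i)) = e i ℤ.* solution e x y (suc i) ℤ.- solution e x y i

solution-shift : ∀ e x y i → solution e x y (suc i) ≡ solution (e ∘ suc) y (e 0 ℤ.* y ℤ.- x) i
solution-shift e x y = two-step (λ i → solution e x y (suc i) ≡ solution (e ∘ suc) y (e 0 ℤ.* y ℤ.- x) i) refl refl
  (λ i h₀ h₁ → cong₂ (λ a b → e (suc i) ℤ.* a ℤ.- b) h₁ h₀)

run≡solution : ∀ l e x y → run l e x y ≡ solution e x y (suc l)
run≡solution zero    e x y = refl
run≡solution (suc l) e x y = trans (run≡solution l (e ∘ suc) y (e 0 ℤ.* y ℤ.- x)) (sym (solution-shift e x y (suc l)))

÷%-unique : ∀ m .{{_ : NonZero m}} j r q → r < m → j ≡ + r ℤ.+ q ℤ.* + m → (j ℤDM.%ℕ m ≡ r) × (j ℤDM./ℕ m ≡ q)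
÷%-unique m j r q r<m e = r≡ , ℤP.*-cancelʳ-≡ (j ℤDM./ℕ m) q (+ m) (ℤGroup.∙-cancelˡ (+ r) _ _ (begin
    + r ℤ.+ (j ℤDM./ℕ m) ℤ.* + m                ≡⟨ cong (λ z → + z ℤ.+ (j ℤDM./ℕ m) ℤ.* + m) (sym r≡) ⟩
    + (j ℤDM.%ℕ m) ℤ.+ (j ℤDM./ℕ m) ℤ.* + m     ≡⟨ sym (ℤDM.a≡a%ℕn+[a/ℕn]*n j m) ⟩
    j                                           ≡⟨ e ⟩
    + r ℤ.+ q ℤ.* + m                           ∎))
  where
  open ≡-Reasoning
  to-residue : ∀ s k → j ≡ + s ℤ.+ k ℤ.* + m → j ≋ + s ⟨mod m ⟩
  to-residue s k h = mod-trans (≡⇒mod (trans h (cong (ℤ._+_ (+ s)) (ℤP.*-comm k (+ m))))) (+n*≋ m (+ s) k)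
  r≡ : j ℤDM.%ℕ m ≡ r
  r≡ = mod-<⇒≡ (ℤDM.n%ℕd<d j m) r<m
    (mod-trans (mod-sym (to-residue (j ℤDM.%ℕ m) (j ℤDM./ℕ m) (ℤDM.a≡a%ℕn+[a/ℕn]*n j m))) (to-residue r q e))

sgn : ℤ → ℤ
sgn (+ zero)      = + 1
sgn (+ suc k)     = ℤ.- sgn (+ k)
sgn (-[1+ zero ]) = ℤ.- (+ 1)
sgn (-[1+ suc k ]) = ℤ.- sgn -[1+ k ]

sgn-suc : ∀ q → sgn (q ℤ.+ + 1) ≡ ℤ.- sgn q
sgn-suc (+ k)          = cong (sgn ∘ +_) (ℕP.+-comm k 1)
sgn-suc (-[1+ zero ])  = refl
sgn-suc (-[1+ suc k ]) = sym (ℤP.neg-involutive (sgn -[1+ k ]))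

sgn²≡1 : ∀ q → sgn q ℤ.* sgn q ≡ + 1
sgn²≡1 (+ zero)       = refl
sgn²≡1 (+ suc k)      = trans (eq (sgn (+ k))) (sgn²≡1 (+ k))
  where
  eq : ∀ a → (ℤ.- a) ℤ.* (ℤ.- a) ≡ a ℤ.* a
  eq = solve-∀
sgn²≡1 (-[1+ zero ])  = refl
sgn²≡1 (-[1+ suc k ]) = trans (eq (sgn -[1+ k ])) (sgn²≡1 -[1+ k ])
  where
  eq : ∀ a → (ℤ.- a) ℤ.* (ℤ.- a) ≡ a ℤ.* a
  eq = solve-∀

abstract
  -- The values `s 0`, ..., `s (m-1)` continued to all integers with the sign (-1)^q in the q-th
  -- period. This sign turns E(u-1 , u) = 1 into E(u , u+m-1) = 1.
  antiperiodic : ∀ m .{{_ : NonZero m}} → (ℕ → ℤ) → ℤ → ℤ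
  antiperiodic m s j = sgn (j ℤDM./ℕ m) ℤ.* s (j ℤDM.%ℕ m)

  antiperiodic-at : ∀ m .{{_ : NonZero m}} s j r q → r < m → j ≡ + r ℤ.+ q ℤ.* + m → antiperiodic m s j ≡ sgn q ℤ.* s r
  antiperiodic-at m s j r q r<m e = cong₂ (λ a b → sgn a ℤ.* s b) (proj₂ (÷%-unique m j r q r<m e)) (proj₁ (÷%-unique m j r q r<m e))

antiperiodic-< : ∀ m .{{_ : NonZero m}} s r → r < m → antiperiodic m s (+ r) ≡ s r
antiperiodic-< m s r r<m = trans (antiperiodic-at m s (+ r) r (+ 0) r<m (sym (ℤP.+-identityʳ (+ r)))) (ℤP.*-identityˡ (s r))

antiperiodic-+m : ∀ m .{{_ : NonZero m}} s j → antiperiodic m s (j ℤ.+ + m) ≡ ℤ.- antiperiodic m s j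
antiperiodic-+m m s j = begin
  antiperiodic m s (j ℤ.+ + m)  ≡⟨ antiperiodic-at m s (j ℤ.+ + m) r (q ℤ.+ + 1) r<m (trans (cong (ℤ._+ + m) j≡) (eq (+ r) q (+ m))) ⟩
  sgn (q ℤ.+ + 1) ℤ.* s r       ≡⟨ cong (ℤ._* s r) (sgn-suc q) ⟩
  (ℤ.- sgn q) ℤ.* s r           ≡⟨ sym (ℤP.neg-distribˡ-* (sgn q) (s r)) ⟩
  ℤ.- (sgn q ℤ.* s r)           ≡⟨ cong ℤ.-_ (sym (antiperiodic-at m s j r q r<m j≡)) ⟩
  ℤ.- antiperiodic m s j        ∎
  where
  open ≡-Reasoning
  r = j ℤDM.%ℕ m
  q = j ℤDM./ℕ m
  r<m : r < m
  r<m = ℤDM.n%ℕd<d j m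
  j≡ : j ≡ + r ℤ.+ q ℤ.* + m
  j≡ = ℤDM.a≡a%ℕn+[a/ℕn]*n j m
  eq : ∀ r q m → (r ℤ.+ q ℤ.* m) ℤ.+ m ≡ r ℤ.+ (q ℤ.+ + 1) ℤ.* m
  eq = solve-∀

-- The Plücker relation for four vectors in the plane: it reduces the diamond rule to the
-- determinants of two pairs of neighbours.
plücker : ∀ a b a′ b′ c d c′ d′ →
  (a ℤ.* d ℤ.- b ℤ.* c) ℤ.* (a′ ℤ.* d′ ℤ.- b′ ℤ.* c′) ℤ.- (a′ ℤ.* d ℤ.- b′ ℤ.* c) ℤ.* (a ℤ.* d′ ℤ.- b ℤ.* c′)
    ≡ (a ℤ.* b′ ℤ.- b ℤ.* a′) ℤ.* (c ℤ.* d′ ℤ.- d ℤ.* c′)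
plücker = solve-∀

-- A matrix of determinants of plane vectors is a product of a 3×2 and a 2×3 matrix, so it is
-- singular; this gives tameness. The local `eq` spells the determinant out for the ring solver.
det-rank-2 : ∀ x₀ y₀ x₁ y₁ x₂ y₂ z₀ w₀ z₁ w₁ z₂ w₂ →
  det (x₀ ℤ.* w₀ ℤ.- y₀ ℤ.* z₀) (x₀ ℤ.* w₁ ℤ.- y₀ ℤ.* z₁) (x₀ ℤ.* w₂ ℤ.- y₀ ℤ.* z₂)
      (x₁ ℤ.* w₀ ℤ.- y₁ ℤ.* z₀) (x₁ ℤ.* w₁ ℤ.- y₁ ℤ.* z₁) (x₁ ℤ.* w₂ ℤ.- y₁ ℤ.* z₂)
      (x₂ ℤ.* w₀ ℤ.- y₂ ℤ.* z₀) (x₂ ℤ.* w₁ ℤ.- y₂ ℤ.* z₁) (x₂ ℤ.* w₂ ℤ.- y₂ ℤ.* z₂) ≡ + 0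
det-rank-2 x₀ y₀ x₁ y₁ x₂ y₂ z₀ w₀ z₁ w₁ z₂ w₂ = eq x₀ y₀ x₁ y₁ x₂ y₂ z₀ w₀ z₁ w₁ z₂ w₂
  where
  eq : ∀ x₀ y₀ x₁ y₁ x₂ y₂ z₀ w₀ z₁ w₁ z₂ w₂ →
    (x₀ ℤ.* w₀ ℤ.- y₀ ℤ.* z₀) ℤ.* ((x₁ ℤ.* w₁ ℤ.- y₁ ℤ.* z₁) ℤ.* (x₂ ℤ.* w₂ ℤ.- y₂ ℤ.* z₂) ℤ.- (x₁ ℤ.* w₂ ℤ.- y₁ ℤ.* z₂) ℤ.* (x₂ ℤ.* w₁ ℤ.- y₂ ℤ.* z₁))
    ℤ.- (x₀ ℤ.* w₁ ℤ.- y₀ ℤ.* z₁) ℤ.* ((x₁ ℤ.* w₀ ℤ.- y₁ ℤ.* z₀) ℤ.* (x₂ ℤ.* w₂ ℤ.- y₂ ℤ.* z₂) ℤ.- (x₁ ℤ.* w₂ ℤ.- y₁ ℤ.* z₂) ℤ.* (x₂ ℤ.* w₀ ℤ.- y₂ ℤ.* z₀))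
    ℤ.+ (x₀ ℤ.* w₂ ℤ.- y₀ ℤ.* z₂) ℤ.* ((x₁ ℤ.* w₀ ℤ.- y₁ ℤ.* z₀) ℤ.* (x₂ ℤ.* w₁ ℤ.- y₂ ℤ.* z₁) ℤ.- (x₁ ℤ.* w₁ ℤ.- y₁ ℤ.* z₁) ℤ.* (x₂ ℤ.* w₀ ℤ.- y₂ ℤ.* z₀))
    ≡ + 0
  eq = solve-∀

module FriezeOfSolution {n l : ℕ} (e : ℕ → ℤ) (closes : run l e (+ 0) (+ 1) ≋ + 1 ⟨mod n ⟩) where

  m : ℕ
  m = suc (suc l)

  -- The coordinates of v, normalised by v_0 = (1 , 0) and v_1 = (0 , 1), so that E(0 , i) is `ys i`
  -- for i < m.
  xs ys : ℕ → ℤ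
  xs = solution e (+ 1) (+ 0)
  ys = solution e (+ 0) (+ 1)

  wronskian : ∀ i → xs i ℤ.* ys (suc i) ℤ.- ys i ℤ.* xs (suc i) ≡ + 1
  wronskian zero    = refl
  wronskian (suc i) = trans (eq (e i) (xs i) (xs (suc i)) (ys i) (ys (suc i))) (wronskian i)
    where
    eq : ∀ t x x′ y y′ → x′ ℤ.* (t ℤ.* y′ ℤ.- y) ℤ.- y′ ℤ.* (t ℤ.* x′ ℤ.- x) ≡ x ℤ.* y′ ℤ.- y ℤ.* x′
    eq = solve-∀

  vx vy : ℤ → ℤ
  vx = antiperiodic m xs
  vy = antiperiodic m ys

  frieze : Entries
  frieze u v = vx u ℤ.* vy v ℤ.- vy u ℤ.* vx v

  consecutive : ∀ j → frieze j (j ℤ.+ + 1) ≋ + 1 ⟨mod n ⟩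
  consecutive j with ℕP.m≤n⇒m<n∨m≡n (ℤDM.n%ℕd<d j m)
  ... | inj₁ 1+r<m = ≡⇒mod (begin
    vx j ℤ.* vy (j ℤ.+ + 1) ℤ.- vy j ℤ.* vx (j ℤ.+ + 1)
      ≡⟨ cong₂ ℤ._-_ (cong₂ ℤ._*_ (at xs) (at⁺ ys)) (cong₂ ℤ._*_ (at ys) (at⁺ xs)) ⟩
    (sgn q ℤ.* xs r) ℤ.* (sgn q ℤ.* ys (suc r)) ℤ.- (sgn q ℤ.* ys r) ℤ.* (sgn q ℤ.* xs (suc r))
      ≡⟨ eq (sgn q) (xs r) (ys (suc r)) (ys r) (xs (suc r)) ⟩
    (sgn q ℤ.* sgn q) ℤ.* (xs r ℤ.* ys (suc r) ℤ.- ys r ℤ.* xs (suc r))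
      ≡⟨ cong₂ ℤ._*_ (sgn²≡1 q) (wronskian r) ⟩
    + 1 ∎)
    where
    open ≡-Reasoning
    r : ℕ
    r = j ℤDM.%ℕ m
    q : ℤ
    q = j ℤDM./ℕ m
    j≡ : j ≡ + r ℤ.+ q ℤ.* + m
    j≡ = ℤDM.a≡a%ℕn+[a/ℕn]*n j m
    next : ∀ r q m → (r ℤ.+ q ℤ.* m) ℤ.+ + 1 ≡ (+ 1 ℤ.+ r) ℤ.+ q ℤ.* m
    next = solve-∀
    at : ∀ s → antiperiodic m s j ≡ sgn q ℤ.* s r
    at s = antiperiodic-at m s j r q (ℤDM.n%ℕd<d j m) j≡
    at⁺ : ∀ s → antiperiodic m s (j ℤ.+ + 1) ≡ sgn q ℤ.* s (suc r)
    at⁺ s = antiperiodic-at m s (j ℤ.+ + 1) (suc r) q 1+r<m (trans (cong (ℤ._+ + 1) j≡) (next (+ r) q (+ m)))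
    eq : ∀ σ a b c d → (σ ℤ.* a) ℤ.* (σ ℤ.* b) ℤ.- (σ ℤ.* c) ℤ.* (σ ℤ.* d) ≡ (σ ℤ.* σ) ℤ.* (a ℤ.* b ℤ.- c ℤ.* d)
    eq = solve-∀
  -- Where two periods meet, the next vector is -v_0 = (-1 , 0) up to the sign of the period, and
  -- the determinant becomes `ys (m-1)`, the continuant. This is the only use of `closes`.
  ... | inj₂ 1+r≡m = mod-trans (≡⇒mod (begin
    vx j ℤ.* vy (j ℤ.+ + 1) ℤ.- vy j ℤ.* vx (j ℤ.+ + 1)
      ≡⟨ cong₂ ℤ._-_ (cong₂ ℤ._*_ (at xs) (at⁺ ys)) (cong₂ ℤ._*_ (at ys) (at⁺ xs)) ⟩
    (sgn q ℤ.* xs (suc l)) ℤ.* ((ℤ.- sgn q) ℤ.* + 0) ℤ.- (sgn q ℤ.* ys (suc l)) ℤ.* ((ℤ.- sgn q) ℤ.* + 1)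
      ≡⟨ eq (sgn q) (xs (suc l)) (ys (suc l)) ⟩
    (sgn q ℤ.* sgn q) ℤ.* ys (suc l)
      ≡⟨ cong (ℤ._* ys (suc l)) (sgn²≡1 q) ⟩
    + 1 ℤ.* ys (suc l)
      ≡⟨ ℤP.*-identityˡ (ys (suc l)) ⟩
    ys (suc l)
      ≡⟨ sym (run≡solution l e (+ 0) (+ 1)) ⟩
    run l e (+ 0) (+ 1) ∎)) closes
    where
    open ≡-Reasoning
    q : ℤ
    q = j ℤDM./ℕ m
    r≡ : j ℤDM.%ℕ m ≡ suc l
    r≡ = ℕP.suc-injective 1+r≡m
    j≡ : j ≡ + suc l ℤ.+ q ℤ.* + m
    j≡ = trans (ℤDM.a≡a%ℕn+[a/ℕn]*n j m) (cong (λ r → + r ℤ.+ q ℤ.* + m) r≡)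
    next : ∀ l q → ((+ 1 ℤ.+ l) ℤ.+ q ℤ.* (+ 2 ℤ.+ l)) ℤ.+ + 1 ≡ + 0 ℤ.+ (q ℤ.+ + 1) ℤ.* (+ 2 ℤ.+ l)
    next = solve-∀
    at : ∀ s → antiperiodic m s j ≡ sgn q ℤ.* s (suc l)
    at s = antiperiodic-at m s j (suc l) q ℕP.≤-refl j≡
    at⁺ : ∀ s → antiperiodic m s (j ℤ.+ + 1) ≡ (ℤ.- sgn q) ℤ.* s 0
    at⁺ s = trans (antiperiodic-at m s (j ℤ.+ + 1) 0 (q ℤ.+ + 1) (s≤s z≤n) (trans (cong (ℤ._+ + 1) j≡) (next (+ l) q)))
      (cong (ℤ._* s 0) (sgn-suc q))
    eq : ∀ σ a b → (σ ℤ.* a) ℤ.* ((ℤ.- σ) ℤ.* + 0) ℤ.- (σ ℤ.* b) ℤ.* ((ℤ.- σ) ℤ.* + 1) ≡ (σ ℤ.* σ) ℤ.* b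
    eq = solve-∀

  frieze-+m : ∀ u v → frieze u (v ℤ.+ + m) ≡ ℤ.- frieze u v
  frieze-+m u v = trans (cong₂ (λ a b → vx u ℤ.* a ℤ.- vy u ℤ.* b) (antiperiodic-+m m ys v) (antiperiodic-+m m xs v))
    (eq (vx u) (vy v) (vy u) (vx v))
    where
    eq : ∀ a b c d → a ℤ.* (ℤ.- b) ℤ.- c ℤ.* (ℤ.- d) ≡ ℤ.- (a ℤ.* b ℤ.- c ℤ.* d)
    eq = solve-∀

  frieze-diagonal : ∀ u → frieze u u ≡ + 0
  frieze-diagonal u = eq (vx u) (vy u)
    where
    eq : ∀ a b → a ℤ.* b ℤ.- b ℤ.* a ≡ + 0
    eq = solve-∀

  frieze-swap : ∀ u v → ℤ.- frieze u v ≡ frieze v u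
  frieze-swap u v = eq (vx u) (vy v) (vy u) (vx v)
    where
    eq : ∀ a b c d → ℤ.- (a ℤ.* b ℤ.- c ℤ.* d) ≡ d ℤ.* c ℤ.- b ℤ.* a
    eq = solve-∀

  isFrieze : IsFrieze n m frieze
  isFrieze = record
    { bottom = λ u → divisible {b = + 0} (≡⇒mod (frieze-diagonal u))
    ; top = λ u → divisible {b = + 0} (≡⇒mod (trans (frieze-+m u u) (cong ℤ.-_ (frieze-diagonal u))))
    ; unimod = λ u v _ _ → divisible (mod-trans
        (≡⇒mod (plücker (vx u) (vy u) (vx (u ℤ.+ + 1)) (vy (u ℤ.+ + 1)) (vx v) (vy v) (vx (v ℤ.+ + 1)) (vy (v ℤ.+ + 1))))
        (*-mod (consecutive u) (consecutive v)))
    }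

  isTame : IsTame n m frieze
  isTame u v _ _ = divisible {b = + 0} (≡⇒mod (trans (det3≡det frieze u v)
    (det-rank-2 (vx (u ℤ.+ + 0)) (vy (u ℤ.+ + 0)) (vx (u ℤ.+ + 1)) (vy (u ℤ.+ + 1)) (vx (u ℤ.+ + 2)) (vy (u ℤ.+ + 2))
                (vx (v ℤ.+ + 0)) (vy (v ℤ.+ + 0)) (vx (v ℤ.+ + 1)) (vy (v ℤ.+ + 1)) (vx (v ℤ.+ + 2)) (vy (v ℤ.+ + 2)))))

  isRegular : IsRegular n m frieze
  isRegular = (λ u → divisible (consecutive u)) , λ u → divisible (last u)
    where
    last : ∀ u → frieze u (u ℤ.+ + suc l) ≋ + 1 ⟨mod n ⟩
    -- E(u , u+m-1) = -E(u , u-1) = E(u-1 , u), a determinant of neighbours.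
    last u = mod-trans (≡⇒mod (trans (cong (frieze u) (eq u (+ l))) (trans (frieze-+m u u⁻)
        (trans (frieze-swap u u⁻) (cong (frieze u⁻) (eq′ u))))))
      (consecutive u⁻)
      where
      u⁻ : ℤ
      u⁻ = u ℤ.- + 1
      eq : ∀ u l → u ℤ.+ (+ 1 ℤ.+ l) ≡ (u ℤ.- + 1) ℤ.+ (+ 2 ℤ.+ l)
      eq = solve-∀
      eq′ : ∀ u → u ≡ (u ℤ.- + 1) ℤ.+ + 1
      eq′ = solve-∀

  regularTameFrieze : RegularTameFrieze n m
  regularTameFrieze = frieze , isFrieze , isTame , isRegular

  -- det(v_i , b v_{i+1} - v_i) is b times the Wronskian. The bound i < l keeps i + 2 below m,
  -- inside one period.
  quiddity-frieze : ∀ i → i < l → quiddity frieze (+ i) ≡ e i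
  quiddity-frieze i i<l = begin
    vx (+ i) ℤ.* vy (+ (i + 2)) ℤ.- vy (+ i) ℤ.* vx (+ (i + 2))
      ≡⟨ cong₂ ℤ._-_ (cong₂ ℤ._*_ (at xs i i<m) (at₂ ys)) (cong₂ ℤ._*_ (at ys i i<m) (at₂ xs)) ⟩
    xs i ℤ.* (e i ℤ.* ys (suc i) ℤ.- ys i) ℤ.- ys i ℤ.* (e i ℤ.* xs (suc i) ℤ.- xs i)
      ≡⟨ eq (e i) (xs i) (xs (suc i)) (ys i) (ys (suc i)) ⟩
    e i ℤ.* (xs i ℤ.* ys (suc i) ℤ.- ys i ℤ.* xs (suc i))
      ≡⟨ trans (cong (e i ℤ.*_) (wronskian i)) (ℤP.*-identityʳ (e i)) ⟩
    e i ∎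
    where
    open ≡-Reasoning
    i<m : i < m
    i<m = ℕP.<-trans i<l (ℕP.m<n+m l (s≤s z≤n))
    at : ∀ s i → i < m → antiperiodic m s (+ i) ≡ s i
    at s i = antiperiodic-< m s i
    at₂ : ∀ s → antiperiodic m s (+ (i + 2)) ≡ s (suc (suc i))
    at₂ s = trans (cong (λ k → antiperiodic m s (+ k)) (ℕP.+-comm i 2)) (at s (suc (suc i)) (s≤s (s≤s i<l)))
    eq : ∀ t x x′ y y′ → x ℤ.* (t ℤ.* y′ ℤ.- y) ℤ.- y ℤ.* (t ℤ.* x′ ℤ.- x) ≡ t ℤ.* (x ℤ.* y′ ℤ.- y ℤ.* x′)
    eq = solve-∀

-- The bijection between friezes and solutions

module Bijection (n l : ℕ) .{{_ : NonZero n}} where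

  m : ℕ
  m = suc (suc l)

  quiddities : RegularTameFrieze n m → ℕ → ℤ
  quiddities (E , _) i = quiddity E (+ i)

  -- The entries E(0 , d) form the solution that starts with 0 and 1, and regularity makes the one
  -- at d = m - 1 equal to 1.
  closes : ∀ x → run l (quiddities x) (+ 0) (+ 1) ≋ + 1 ⟨mod n ⟩
  closes x@(E , frieze , tame , regular) = mod-trans (≡⇒mod (run≡solution l (quiddities x) (+ 0) (+ 1)))
      (mod-trans (mod-sym (row-solution (suc l) ℕP.≤-refl)) (row-last (+ 0)))
    where
    open FriezeRecurrence E frieze tame regular
    row-solution : ∀ d → d ≤ suc l → row E (+ 0) d ≋ solution (quiddities x) (+ 0) (+ 1) d ⟨mod n ⟩
    row-solution = two-step (λ d → d ≤ suc l → row E (+ 0) d ≋ solution (quiddities x) (+ 0) (+ 1) d ⟨mod n ⟩)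
      (λ _ → row-0 (+ 0)) (λ _ → row-1 (+ 0))
      (λ d h₀ h₁ 2+d≤ → mod-trans (recurrence d (ℕP.<⇒≤ (ℕP.≤-pred 2+d≤)) (+ 0))
        (-‿mod (*-modʳ (quiddity E (+ d)) (h₁ (ℕP.<⇒≤ 2+d≤))) (h₀ (ℕP.<⇒≤ (ℕP.<⇒≤ 2+d≤)))))

  path : RegularTameFrieze n m → Path n l (+ 0) (+ 1)
  path x = proj₁ (mkPath n l (quiddities x) (+ 0) (+ 1) (closes x))

  bits-path : ∀ x i → i < l → bits l (path x) i ≋ quiddities x i ⟨mod n ⟩
  bits-path x = proj₂ (mkPath n l (quiddities x) (+ 0) (+ 1) (closes x))

  ofPath : Path n l (+ 0) (+ 1) → RegularTameFrieze n m
  ofPath w = FriezeOfSolution.regularTameFrieze (bits l w) (run-bits l w)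

  quiddities-ofPath : ∀ w i → i < l → quiddities (ofPath w) i ≡ bits l w i
  quiddities-ofPath w = FriezeOfSolution.quiddity-frieze (bits l w) (run-bits l w)

  quiddities-cong : ∀ x y → _≈F_ {n} {m} x y → ∀ i → i < l → quiddities x i ≋ quiddities y i ⟨mod n ⟩
  quiddities-cong x y x≈y i i<l = cong-mod (x≈y (+ i) (+ i ℤ.+ + 2) (diff-≥ (+ i) z≤n) (diff-≤ (+ i) (s≤s (s≤s z≤n))))

  path-cong : ∀ {x y} → _≈F_ {n} {m} x y → path x ≡ path y
  path-cong {x} {y} x≈y = Path-ext l (path x) (path y) (λ i i<l → mod-trans (bits-path x i i<l)
    (mod-trans (quiddities-cong x y x≈y i i<l) (mod-sym (bits-path y i i<l))))

  path-ofPath : ∀ w → path (ofPath w) ≡ w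
  path-ofPath w = Path-ext l (path (ofPath w)) w (λ i i<l → mod-trans (bits-path (ofPath w) i i<l)
    (≡⇒mod (quiddities-ofPath w i i<l)))

  ofPath-path : ∀ x → _≈F_ {n} {m} (ofPath (path x)) x
  ofPath-path x@(E , frieze , tame , regular) = FriezeUnique.agree (proj₁ y) E
    (proj₁ (proj₂ y)) (proj₁ (proj₂ (proj₂ y))) (proj₂ (proj₂ (proj₂ y))) frieze tame regular
    (λ i i<l → mod-trans (≡⇒mod (quiddities-ofPath (path x) i i<l)) (bits-path x i i<l))
    where
    y : RegularTameFrieze n m
    y = ofPath (path x)

  friezes↔Fin : Inverse (RTFriezeSetoid n m) (setoid (Fin (F n l (+ 0) (+ 1))))
  friezes↔Fin = record
    { to = λ x → P.to (path x)
    ; from = λ i → ofPath (P.from i)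
    ; to-cong = λ {x} {y} x≈y → cong P.to (path-cong {x} {y} x≈y)
    ; from-cong = λ { {i} refl → Setoid.refl (RTFriezeSetoid n m) {ofPath (P.from i)} }
    ; inverse = (λ {i} {x} x≈ → trans (cong P.to (trans (path-cong {x} {ofPath (P.from i)} x≈) (path-ofPath (P.from i))))
                                      (P.strictlyInverseˡ i))
              , (λ { {x} refl → subst (λ w → _≈F_ {n} {m} (ofPath w) x) (sym (P.strictlyInverseʳ (path x))) (ofPath-path x) })
    }
    where
    module P = Inverse (Path↔Fin n l (+ 0) (+ 1))

theoremB : (n m : ℕ) → 2 ≤ n → 2 ≤ m →
    Σ ℕ (λ N → Inverse (RTFriezeSetoid n m) (setoid (Fin N)) × fromℕ N ≡ friezeCount n m)
theoremB n@(suc _) (suc (suc l)) _ _ = F n l (+ 0) (+ 1) , Bijection.friezes↔Fin n l , count≡friezeCount n l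
theoremB _ (suc zero) _ (s≤s ())
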